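{- Let $x$ be an indeterminate. For all positive integers $n$, $$D_3(n;x):=\det_{0\le i,j\le n-1}\left(2^i\binom {x+i+2j}{2j}+\binom {x-i+2j}{2j}\right)$$ satisfies $$D_3(n;x)=2^{\binom n2+1}\prod _{i=0} ^{n-1}\frac {i!} {(2i)!}\prod _{i=0} ^{\lfloor (n-1)/2\rfloor}(x+4i+3)_{n-2i-1}\prod _{i=0} ^{\lfloor (n-2)/2\rfloor}(x-2i+3n-1)_{n-2i-2}$$ and $$D_3(n;x)=2\prod_{i=1}^n \frac{2^{2i-2} \, \Gamma(i) \, \Gamma(2i+x) \,\Gamma(4i+x-3) \, \Gamma\bigl(\frac{3i+x-1}{2}\bigr)}{\Gamma(2i-1) \,\Gamma(3i+x-1) \, \Gamma(3i+x-2) \, \Gamma\bigl(\frac{i+x+1}{2}\bigr)}.$$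
   Context: The binomial coefficient is $\binom{\alpha}{p}=\frac{\alpha(\alpha-1)\cdots(\alpha-p+1)}{p!}$ if $p\ge 0$ is an integer, and $0$ if $p<0$. The Pochhammer symbol is $(\alpha)_p=\alpha(\alpha+1)\cdots(\alpha+p-1)$ for $p\ge1$ and $(\alpha)_0=1$. Empty products (in particular $\prod_{i=0}^{ -1}$) are $1$. The quotients of Gamma functions are understood as the rational functions of $x$ obtained by simplifying using $\Gamma(z+1)=z\Gamma(z)$. -}

module Defs where

open import Level using (Level; _⊔_) renaming (suc to lsuc)
open import Algebra.Bundles using (CommutativeRing; Semiring)
import Algebra.Definitions.RawSemiring as RawSemiringDefs
import Algebra.Properties.Semiring.Mult as SemiringMult
open import Data.Fin.Base using (Fin; zero; suc; toℕ; punchIn)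
open import Data.Integer.Base using (ℤ; +_; -[1+_])
open import Data.List.Base using (List; []; _∷_; foldr)
open import Data.List.Relation.Unary.Any using (Any; here)
open import Data.Nat.Base as ℕ using (ℕ; zero; suc; _!)
open import Data.Nat.Tactic.RingSolver using (solve-∀)
open import Relation.Binary.PropositionalEquality.Core as ≡ using (_≡_; _≢_)
import Relation.Binary.Reasoning.Setoid as SetoidReasoning
open import Relation.Nullary.Negation.Core using (¬_)

-- Inversion is a total function, so that quotients can be written without
-- nonvanishing proofs; the value of 0# ⁻¹ is left unspecified.
record Field (c ℓ : Level) : Set (lsuc (c ⊔ ℓ)) where
  field
    commutativeRing : CommutativeRing c ℓ
  open CommutativeRing commutativeRing public
  infix 9 _⁻¹
  field
    _⁻¹      : Carrier → Carrier
    ⁻¹-cong  : ∀ {a b} → a ≈ b → a ⁻¹ ≈ b ⁻¹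
    inverseʳ : ∀ {a} → ¬ (a ≈ 0#) → a * a ⁻¹ ≈ 1#
    1≉0      : ¬ (1# ≈ 0#)

module FieldDefs {c ℓ : Level} (K : Field c ℓ) where

  open Field K public hiding (zero)
  open RawSemiringDefs (Semiring.rawSemiring semiring) public using (_×_; _^_; sum; product)

  infixl 7 _/_
  _/_ : Carrier → Carrier → Carrier
  a / b = a * b ⁻¹

  infix 10 ↑_
  ↑_ : ℕ → Carrier
  ↑ n = n × 1#

  fromℤ : ℤ → Carrier
  fromℤ (+ n)    = ↑ n
  fromℤ -[1+ n ] = - ↑ suc n

  -- Coefficient lists start with the constant term.
  eval : List ℤ → Carrier → Carrier
  eval p x = foldr (λ a v → fromℤ a + x * v) 0# p

  -- x is transcendental over ℚ, i.e. ℚ[x] ⊆ K is a polynomial ring in the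
  -- indeterminate x (denominators of rational coefficients are cleared).
  -- Constant polynomials are included, so K has characteristic zero.
  IsIndeterminate : Carrier → Set ℓ
  IsIndeterminate x = ∀ (p : List ℤ) → Any (_≢ + 0) p → ¬ (eval p x ≈ 0#)

  -- ∏ n f is the product of f i over 0 ≤ i < n.
  ∏ : ℕ → (ℕ → Carrier) → Carrier
  ∏ n f = product {n} (λ i → f (toℕ i))

  pochhammer : Carrier → ℕ → Carrier
  pochhammer α p = ∏ p (λ k → α + ↑ k)

  binomial : Carrier → ℤ → Carrier
  binomial α (+ p)    = ∏ p (λ k → α - ↑ k) / ↑ (p !)
  binomial α -[1+ _ ] = 0#

  -- Laplace expansion along the first row.
  det : ∀ n → (Fin n → Fin n → Carrier) → Carrier
  det zero    A = 1#
  det (suc n) A = sum {suc n} λ j →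
    (- 1#) ^ toℕ j * A zero j * det n (λ r s → A (suc r) (punchIn j s))

  D₃ : ℕ → Carrier → Carrier
  D₃ n x = det n λ i′ j′ → let i = toℕ i′ ; j = toℕ j′ in
      (↑ 2) ^ i * binomial (x + ↑ i + ↑ (2 ℕ.* j)) (+ (2 ℕ.* j))
    + binomial (x - ↑ i + ↑ (2 ℕ.* j)) (+ (2 ℕ.* j))

  data IntegerShift (a b : Carrier) : Set ℓ where
    up   : ∀ k → a ≈ b + ↑ k → IntegerShift a b
    down : ∀ k → b ≈ a + ↑ k → IntegerShift a b

  -- Γ(a) / Γ(b), simplified by Γ(z + 1) = z Γ(z).
  Γ-quotient : (a b : Carrier) → IntegerShift a b → Carrier
  Γ-quotient a b (up k _)   = pochhammer b k
  Γ-quotient a b (down k _) = 1# / pochhammer a k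

  private
    open SemiringMult semiring using (×-homo-+; ×1-homo-*)
    open SetoidReasoning setoid

    ↑-+ : ∀ {m} a b → m ≡ a ℕ.+ b → ↑ m ≈ ↑ a + ↑ b
    ↑-+ a b ≡.refl = ×-homo-+ 1# a b

    cancel : ∀ u v → u + v - v ≈ u
    cancel u v = begin
      u + v - v    ≈⟨ +-assoc u v (- v) ⟩
      u + (v - v)  ≈⟨ +-congˡ (-‿inverseʳ v) ⟩
      u + 0#       ≈⟨ +-identityʳ u ⟩
      u            ∎

    swapʳ : ∀ u v w → u + v + w ≈ u + w + v
    swapʳ u v w = begin
      u + v + w    ≈⟨ +-assoc u v w ⟩
      u + (v + w)  ≈⟨ +-congˡ (+-comm v w) ⟩
      u + (w + v)  ≈⟨ +-assoc u w v ⟨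
      u + w + v    ∎

    add : ∀ {p} x m q → p ≡ m ℕ.+ q → ↑ p + x ≈ ↑ m + x + ↑ q
    add x m q eq = trans (+-congʳ (↑-+ m q eq)) (swapʳ (↑ m) (↑ q) x)

    subtract : ∀ {p} x m q → p ≡ m ℕ.+ q → ↑ p + x - ↑ q ≈ ↑ m + x
    subtract x m q eq = trans (+-congʳ (add x m q eq)) (cancel (↑ m + x) (↑ q))

  shift₁ : ∀ k → let i = suc k in
           IntegerShift (↑ i) (↑ (2 ℕ.* i) - ↑ 1)
  shift₁ k = down k (begin
    ↑ (2 ℕ.* suc k) - ↑ 1         ≈⟨ +-congʳ (↑-+ (suc k ℕ.+ k) 1 (eq k)) ⟩
    ↑ (suc k ℕ.+ k) + ↑ 1 - ↑ 1   ≈⟨ cancel _ _ ⟩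
    ↑ (suc k ℕ.+ k)               ≈⟨ ↑-+ (suc k) k ≡.refl ⟩
    ↑ suc k + ↑ k                 ∎)
    where
    eq : ∀ k → 2 ℕ.* suc k ≡ suc k ℕ.+ k ℕ.+ 1
    eq = solve-∀

  shift₂ : ∀ x k → let i = suc k in
           IntegerShift (↑ (2 ℕ.* i) + x) (↑ (3 ℕ.* i) + x - ↑ 1)
  shift₂ x k = down k (begin
    ↑ (3 ℕ.* suc k) + x - ↑ 1       ≈⟨ subtract x (2 ℕ.* suc k ℕ.+ k) 1 (eq k) ⟩
    ↑ (2 ℕ.* suc k ℕ.+ k) + x       ≈⟨ add x (2 ℕ.* suc k) k ≡.refl ⟩
    ↑ (2 ℕ.* suc k) + x + ↑ k       ∎)
    where
    eq : ∀ k → 3 ℕ.* suc k ≡ 2 ℕ.* suc k ℕ.+ k ℕ.+ 1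
    eq = solve-∀

  shift₃ : ∀ x k → let i = suc k in
           IntegerShift (↑ (4 ℕ.* i) + x - ↑ 3) (↑ (3 ℕ.* i) + x - ↑ 2)
  shift₃ x k = up k (begin
    ↑ (4 ℕ.* suc k) + x - ↑ 3         ≈⟨ subtract x (3 ℕ.* k ℕ.+ 1 ℕ.+ k) 3 (eq₁ k) ⟩
    ↑ (3 ℕ.* k ℕ.+ 1 ℕ.+ k) + x       ≈⟨ add x (3 ℕ.* k ℕ.+ 1) k ≡.refl ⟩
    ↑ (3 ℕ.* k ℕ.+ 1) + x + ↑ k       ≈⟨ +-congʳ (subtract x (3 ℕ.* k ℕ.+ 1) 2 (eq₂ k)) ⟨
    ↑ (3 ℕ.* suc k) + x - ↑ 2 + ↑ k   ∎)
    where
    eq₁ : ∀ k → 4 ℕ.* suc k ≡ 3 ℕ.* k ℕ.+ 1 ℕ.+ k ℕ.+ 3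
    eq₁ = solve-∀
    eq₂ : ∀ k → 3 ℕ.* suc k ≡ 3 ℕ.* k ℕ.+ 1 ℕ.+ 2
    eq₂ = solve-∀

  shift₄ : ∀ x → IsIndeterminate x → ∀ k → let i = suc k in
           IntegerShift ((↑ (3 ℕ.* i) + x - ↑ 1) / ↑ 2) ((↑ i + x + ↑ 1) / ↑ 2)
  shift₄ x ind k = up k (begin
    (↑ (3 ℕ.* suc k) + x - ↑ 1) / ↑ 2              ≈⟨ *-congʳ numerators ⟩
    (↑ suc k + x + ↑ 1 + ↑ (2 ℕ.* k)) / ↑ 2        ≈⟨ distribʳ _ _ _ ⟩
    (↑ suc k + x + ↑ 1) / ↑ 2 + ↑ (2 ℕ.* k) / ↑ 2  ≈⟨ +-congˡ halve ⟩
    (↑ suc k + x + ↑ 1) / ↑ 2 + ↑ k                ∎)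
    where
    eq₁ : ∀ k → 3 ℕ.* suc k ≡ suc k ℕ.+ 1 ℕ.+ 2 ℕ.* k ℕ.+ 1
    eq₁ = solve-∀

    numerators : ↑ (3 ℕ.* suc k) + x - ↑ 1 ≈ ↑ suc k + x + ↑ 1 + ↑ (2 ℕ.* k)
    numerators = begin
      ↑ (3 ℕ.* suc k) + x - ↑ 1
        ≈⟨ subtract x (suc k ℕ.+ 1 ℕ.+ 2 ℕ.* k) 1 (eq₁ k) ⟩
      ↑ (suc k ℕ.+ 1 ℕ.+ 2 ℕ.* k) + x
        ≈⟨ add x (suc k ℕ.+ 1) (2 ℕ.* k) ≡.refl ⟩
      ↑ (suc k ℕ.+ 1) + x + ↑ (2 ℕ.* k)
        ≈⟨ +-congʳ (add x (suc k) 1 ≡.refl) ⟩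
      ↑ suc k + x + ↑ 1 + ↑ (2 ℕ.* k) ∎

    2≉0 : ¬ (↑ 2 ≈ 0#)
    2≉0 2≈0 = ind (+ 2 ∷ []) (here λ ()) (begin
      ↑ 2 + x * 0#  ≈⟨ +-congˡ (zeroʳ x) ⟩
      ↑ 2 + 0#      ≈⟨ +-identityʳ _ ⟩
      ↑ 2           ≈⟨ 2≈0 ⟩
      0#            ∎)

    halve : ↑ (2 ℕ.* k) / ↑ 2 ≈ ↑ k
    halve = begin
      ↑ (2 ℕ.* k) * (↑ 2) ⁻¹    ≈⟨ *-congʳ (×1-homo-* 2 k) ⟩
      ↑ 2 * ↑ k * (↑ 2) ⁻¹      ≈⟨ *-congʳ (*-comm _ _) ⟩
      ↑ k * ↑ 2 * (↑ 2) ⁻¹      ≈⟨ *-assoc _ _ _ ⟩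
      ↑ k * (↑ 2 * (↑ 2) ⁻¹)    ≈⟨ *-congˡ (inverseʳ 2≉0) ⟩
      ↑ k * 1#                  ≈⟨ *-identityʳ _ ⟩
      ↑ k                       ∎

{-# OPTIONS --safe #-}

-- Let s = (1 + t²) / (1 - t) and σ = s - 1.  Since 2 / (1 - t) and 1 - t have
-- product 2 and sum σ + 3, the i-th row consists of the even coefficients of
-- (1 - t)^(-x-1) times a polynomial of degree i in σ, which is monic except that
-- it is 2 for i = 0.  Hence D₃(n; x) = 2 E(n; x + 1) with
-- E(n; z) = det [t²ʲ] s^z σⁱ.  As σ is t s² times an even series,
-- E(n + 1; z) = det [t²ʲ⁺¹] s^(z+2) σⁱ, and applying t d/dt turns this into
-- ∏ (z + 2 + i) / (2i + 1) times the determinant of the even coefficients of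
-- s^(z+1) s′ σⁱ.  The powers of σ are dual to each other under the residue of
-- σᵏ dσ, so by Jacobi's identity for complementary minors the last determinant
-- is E(n; -1 - 4n - z) up to sign.  Two such steps express E(n + 2; z) by
-- E(n; z + 4), and both products satisfy the same recursion.
module Submission where

open import Defs
open import Algebra.Bundles using (CommutativeRing)
import Algebra.Properties.CommutativeSemiring.Exp as CommutativeExp
import Algebra.Properties.Ring as RingProperties
import Algebra.Properties.Semiring.Exp as Exp
import Algebra.Properties.Semiring.Mult as SemiringMult
import Algebra.Properties.Semiring.Sum as SemiringSum
import Algebra.Solver.Ring as Solver
open import Algebra.Solver.Ring.AlmostCommutativeRing
  using (fromCommutativeRing; _-Raw-AlmostCommutative⟶_)
open import Data.Fin.Base using (Fin; zero; suc; toℕ; fromℕ; punchIn; punchOut; inject₁)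
import Data.Fin.Properties as Fin
open import Data.Fin.Properties using (punchInᵢ≢i; suc-injective; toℕ-inject₁; toℕ<n; toℕ-fromℕ;
    toℕ-injective)
open import Data.Integer.Base as ℤ using (ℤ; +_; -[1+_]; _⊖_)
import Data.Integer.Properties as ℤ
open import Data.List.Base using ([]; _∷_)
open import Data.List.Relation.Unary.Any using (here; there)
open import Data.Maybe.Base using (just; nothing)
open import Data.Nat.Base as ℕ using (ℕ; zero; suc; z≤n; s≤s; z<s; s<s; _∸_; _!; ⌊_/2⌋)
import Data.Nat.Properties as ℕ
open import Data.Nat.Tactic.RingSolver using (solve-∀)
open import Data.Product.Base using (_,_) renaming (_×_ to _∧_)
open import Data.Sum.Base using (inj₁; inj₂)
open import Data.Unit.Polymorphic.Base using (⊤; tt)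
open import Function.Base using (_∘_)
open import Level using (Level; _⊔_)
open import Relation.Binary.Definitions using (WeaklyDecidable)
open import Relation.Binary.PropositionalEquality.Core as ≡ using (_≡_; _≢_)
import Relation.Binary.Reasoning.Setoid as SetoidReasoning
open import Relation.Nullary.Decidable using (yes; no)
open import Relation.Nullary.Negation.Core using (¬_; contradiction)

-- The entries of the matrix only involve powers of 1 - t, yet the proof works with powers of s. The
-- reason is that the rows s^z σⁱ form a family closed under everything that is done to them:
-- division by t, differentiation and passage to the dual family each give back a power of s (or of
-- s times s′ / s) up to an even series with constant term 1. Multiplying all rows by such a series
-- multiplies the matrix of even coefficients by a unitriangular one, so the determinant does not
-- notice it. A single step turns z into a constant minus z and leaves a sign; only two steps
-- together translate z, by 4, with all signs cancelling. This is why the final induction lowers n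
-- by 2 while x moves to x + 4. Exponents lie in the field, so the laws of exponents cannot come
-- from induction; they come from the uniqueness of solutions of a first-order differential
-- equation, which rests on characteristic zero. Residues would call for negative powers of t;
-- writing σ = t w with w invertible keeps everything inside ordinary power series.

CharacteristicZero : ∀ {c ℓ} → Field c ℓ → Set ℓ
CharacteristicZero K = ∀ n → ¬ (↑ suc n ≈ 0#)
  where open FieldDefs K

-- A ring solver with integer coefficients

module IntegerSolver {c ℓ} (R : CommutativeRing c ℓ) where

  open CommutativeRing R hiding (zero)
  open RingProperties ring using (-0#≈0#; -‿+-comm; -‿involutive; -‿distribˡ-*; -‿distribʳ-*)
  open SemiringMult semiring using (_×_; ×-homo-+; ×1-homo-*)
  open SetoidReasoning setoid

  -- The cases 0 and 1 are kept apart so that `κ 0` and `κ 1` are `0#` and `1#` by definition,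
  -- whereas `↑ 1` unfolds to `1# + 0#` and has to be entered as `κ 1 :+ κ 0`. From 2 on, `κ n`
  -- agrees with `↑ n` by definition.
  image : ℤ → Carrier
  image (+ 0)           = 0#
  image (+ 1)           = 1#
  image (+ suc (suc n)) = suc (suc n) × 1#
  image -[1+ n ]        = - (suc n × 1#)

  private
    image-+ : ∀ n → image (+ n) ≈ n × 1#
    image-+ 0             = refl
    image-+ 1             = sym (+-identityʳ 1#)
    image-+ (suc (suc n)) = refl

    image-⊖ : ∀ m n → image (m ⊖ n) ≈ m × 1# - n × 1#
    image-⊖ zero    zero    = sym (-‿inverseʳ 0#)
    image-⊖ zero    (suc n) = sym (+-identityˡ _)
    image-⊖ (suc m) zero    = begin
      image (+ suc m)     ≈⟨ image-+ (suc m) ⟩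
      suc m × 1#          ≈⟨ +-identityʳ _ ⟨
      suc m × 1# + 0#     ≈⟨ +-congˡ -0#≈0# ⟨
      suc m × 1# - 0#     ∎
    image-⊖ (suc m) (suc n) = begin
      image (suc m ⊖ suc n)                 ≡⟨ ≡.cong image (ℤ.[1+m]⊖[1+n]≡m⊖n m n) ⟩
      image (m ⊖ n)                         ≈⟨ image-⊖ m n ⟩
      a - b                                 ≈⟨ +-congʳ (+-identityʳ a) ⟨
      a + 0# - b                            ≈⟨ +-congʳ (+-congˡ (-‿inverseʳ 1#)) ⟨
      a + (1# - 1#) - b                     ≈⟨ +-congʳ (+-assoc a 1# (- 1#)) ⟨
      a + 1# - 1# - b                       ≈⟨ +-assoc _ _ _ ⟩
      a + 1# + (- 1# - b)                   ≈⟨ +-cong (+-comm a 1#) (-‿+-comm 1# b) ⟩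
      1# + a - (1# + b)                     ∎
      where a = m × 1# ; b = n × 1#

    image-homo-+ : ∀ i j → image (i ℤ.+ j) ≈ image i + image j
    image-homo-+ (+ m)    (+ n)    = begin
      image (+ (m ℕ.+ n))      ≈⟨ image-+ (m ℕ.+ n) ⟩
      (m ℕ.+ n) × 1#           ≈⟨ ×-homo-+ 1# m n ⟩
      m × 1# + n × 1#          ≈⟨ +-cong (image-+ m) (image-+ n) ⟨
      image (+ m) + image (+ n) ∎
    image-homo-+ (+ m)    -[1+ n ] = trans (image-⊖ m (suc n)) (+-congʳ (sym (image-+ m)))
    image-homo-+ -[1+ m ] (+ n)    =
      trans (image-⊖ n (suc m)) (trans (+-congʳ (sym (image-+ n))) (+-comm _ _))
    image-homo-+ -[1+ m ] -[1+ n ] = begin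
      - (suc (suc (m ℕ.+ n)) × 1#)      ≡⟨ ≡.cong (λ k → - (suc k × 1#)) (ℕ-+-suc m n) ⟨
      - ((suc m ℕ.+ suc n) × 1#)        ≈⟨ -‿cong (×-homo-+ 1# (suc m) (suc n)) ⟩
      - (suc m × 1# + suc n × 1#)       ≈⟨ -‿+-comm _ _ ⟨
      - (suc m × 1#) - suc n × 1#       ∎
      where open import Data.Nat.Properties renaming (+-suc to ℕ-+-suc)

    image-neg : ∀ i → image (ℤ.- i) ≈ - image i
    image-neg (+ 0)           = sym -0#≈0#
    image-neg (+ 1)           = -‿cong (+-identityʳ 1#)
    image-neg (+ suc (suc n)) = refl
    image-neg -[1+ n ]        = trans (image-+ (suc n)) (sym (-‿involutive _))

    image-homo-*⁺ : ∀ m n → image (+ m ℤ.* + n) ≈ image (+ m) * image (+ n)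
    image-homo-*⁺ m n = begin
      image (+ m ℤ.* + n)        ≡⟨ ≡.cong image (ℤ.pos-* m n) ⟨
      image (+ (m ℕ.* n))        ≈⟨ image-+ (m ℕ.* n) ⟩
      (m ℕ.* n) × 1#             ≈⟨ ×1-homo-* m n ⟩
      (m × 1#) * (n × 1#)        ≈⟨ *-cong (image-+ m) (image-+ n) ⟨
      image (+ m) * image (+ n)  ∎

    image-homo-* : ∀ i j → image (i ℤ.* j) ≈ image i * image j
    image-homo-* (+ m) (+ n) = image-homo-*⁺ m n
    image-homo-* (+ m) -[1+ n ] = begin
      image (+ m ℤ.* ℤ.- + suc n)        ≡⟨ ≡.cong image (ℤ.neg-distribʳ-* (+ m) (+ suc n)) ⟨
      image (ℤ.- (+ m ℤ.* + suc n))      ≈⟨ image-neg (+ m ℤ.* + suc n) ⟩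
      - image (+ m ℤ.* + suc n)          ≈⟨ -‿cong (image-homo-*⁺ m (suc n)) ⟩
      - (image (+ m) * image (+ suc n))  ≈⟨ -‿distribʳ-* _ _ ⟩
      image (+ m) * - image (+ suc n)    ≈⟨ *-congˡ (-‿cong (image-+ (suc n))) ⟩
      image (+ m) * image -[1+ n ]       ∎
    image-homo-* -[1+ m ] j = begin
      image (ℤ.- + suc m ℤ.* j)          ≡⟨ ≡.cong image (ℤ.neg-distribˡ-* (+ suc m) j) ⟨
      image (ℤ.- (+ suc m ℤ.* j))        ≈⟨ image-neg (+ suc m ℤ.* j) ⟩
      - image (+ suc m ℤ.* j)            ≈⟨ -‿cong (pos j) ⟩
      - (image (+ suc m) * image j)      ≈⟨ -‿distribˡ-* _ _ ⟩
      - image (+ suc m) * image j        ≈⟨ *-congʳ (-‿cong (image-+ (suc m))) ⟩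
      image -[1+ m ] * image j           ∎
      where
      pos : ∀ j → image (+ suc m ℤ.* j) ≈ image (+ suc m) * image j
      pos (+ n)    = image-homo-*⁺ (suc m) n
      pos -[1+ n ] = image-homo-* (+ suc m) -[1+ n ]

    morphism : ℤ.+-*-rawRing -Raw-AlmostCommutative⟶ fromCommutativeRing R
    morphism = record
      { ⟦_⟧    = image
      ; +-homo = image-homo-+
      ; *-homo = image-homo-*
      ; -‿homo = image-neg
      ; 0-homo = refl
      ; 1-homo = refl
      }

    _≟_ : WeaklyDecidable (λ i j → image i ≈ image j)
    i ≟ j with i ℤ.≟ j
    ... | yes ≡.refl = just refl
    ... | no  _      = nothing

  open Solver ℤ.+-*-rawRing (fromCommutativeRing R) morphism _≟_ public
    using (solve; _:=_; con; _:+_; _:*_; :-_; _:-_; Polynomial)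

  κ : ∀ {n} → ℕ → Polynomial n
  κ n = con (+ n)

-- Determinants: multilinearity, alternation, uniqueness, products, transposition

module Determinant {c ℓ} (K : Field c ℓ) where

  open FieldDefs K
  open SemiringSum semiring
    using (sum-cong-≋; *-distribˡ-sum; *-distribʳ-sum; ∑-distrib-+; ∑-comm; sum-replicate-zero; sum-remove)
  open SetoidReasoning setoid
  open IntegerSolver commutativeRing

  Row : ℕ → Set c
  Row n = Fin n → Carrier

  Matrix : ℕ → ℕ → Set c
  Matrix m n = Fin m → Row n

  minor : ∀ {m n} → Matrix (suc m) (suc n) → Fin (suc m) → Fin (suc n) → Matrix m n
  minor A i j r s = A (punchIn i r) (punchIn j s)

  cofactor : ∀ {n} → Matrix (suc n) (suc n) → Fin (suc n) → Carrier
  cofactor {n} A j = (- 1#) ^ toℕ j * A zero j * det n (minor A zero j)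

  sum-cong : ∀ {n} (f g : Row n) → (∀ i → f i ≈ g i) → sum f ≈ sum g
  sum-cong f g = sum-cong-≋

  sum-zero : ∀ {n} (f : Row n) → (∀ i → f i ≈ 0#) → sum f ≈ 0#
  sum-zero {n} f h = trans (sum-cong-≋ h) (sum-replicate-zero n)

  sum-single : ∀ {n} (f : Row n) i → (∀ j → j ≢ i → f j ≈ 0#) → sum f ≈ f i
  sum-single {suc n} f i h = begin
    sum f                     ≈⟨ sum-remove f ⟩
    f i + sum (f ∘ punchIn i) ≈⟨ +-congˡ (sum-zero _ (λ j → h (punchIn i j) (punchInᵢ≢i i j))) ⟩
    f i + 0#                  ≈⟨ +-identityʳ _ ⟩
    f i                       ∎

  det-cong : ∀ n {A B : Matrix n n} → (∀ i j → A i j ≈ B i j) → det n A ≈ det n B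
  det-cong zero    h = refl
  det-cong (suc n) {A} {B} h = sum-cong (cofactor A) (cofactor B) λ j →
    *-cong (*-congˡ (h zero j)) (det-cong n λ r s → h (suc r) (punchIn j s))

  -- Three matrices are compared entry by entry instead of updating one row of a single matrix:
  -- matrices are functions without extensional equality, and minors or products are rarely row
  -- updates by definition.
  record IsMultilinear {m n} (F : Matrix m n → Carrier) : Set (c ⊔ ℓ) where
    field
      linear : ∀ r a d {A B C : Matrix m n} →
               (∀ j → A r j ≈ a * B r j + d * C r j) →
               (∀ i → i ≢ r → ∀ j → A i j ≈ B i j) →
               (∀ i → i ≢ r → ∀ j → A i j ≈ C i j) →
               F A ≈ a * F B + d * F C
      congruent : ∀ {A B : Matrix m n} → (∀ i j → A i j ≈ B i j) → F A ≈ F B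

    zero-row : ∀ r {A : Matrix m n} → (∀ j → A r j ≈ 0#) → F A ≈ 0#
    zero-row r {A} h = begin
      F A
        ≈⟨ linear r 0# 0# (λ j → trans (h j) (sym 0u+0v)) (λ _ _ _ → refl) (λ _ _ _ → refl) ⟩
      0# * F A + 0# * F A     ≈⟨ 0u+0v ⟩
      0#                      ∎
      where
      0u+0v : ∀ {u v} → 0# * u + 0# * v ≈ 0#
      0u+0v {u} {v} = solve 2 (λ u v → κ 0 :* u :+ κ 0 :* v := κ 0) refl u v

  IsAlternating : ∀ {m n} → (Matrix m n → Carrier) → Set (c ⊔ ℓ)
  IsAlternating F = ∀ {A} p q → p ≢ q → (∀ j → A p j ≈ A q j) → F A ≈ 0#

  open IsMultilinear

  det-linear : ∀ n r a d {A B C : Matrix n n} →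
               (∀ j → A r j ≈ a * B r j + d * C r j) →
               (∀ i → i ≢ r → ∀ j → A i j ≈ B i j) →
               (∀ i → i ≢ r → ∀ j → A i j ≈ C i j) →
               det n A ≈ a * det n B + d * det n C
  det-linear (suc n) r a d {A} {B} {C} h hB hC = begin
    sum (cofactor A)
      ≈⟨ sum-cong-≋ (term r h hB hC) ⟩
    sum (λ j → a * cofactor B j + d * cofactor C j)
      ≈⟨ ∑-distrib-+ (λ j → a * cofactor B j) (λ j → d * cofactor C j) ⟩
    sum (λ j → a * cofactor B j) + sum (λ j → d * cofactor C j)
      ≈⟨ +-cong (*-distribˡ-sum a (cofactor B)) (*-distribˡ-sum d (cofactor C)) ⟨
    a * sum (cofactor B) + d * sum (cofactor C) ∎
    where
    term : ∀ r → (∀ j → A r j ≈ a * B r j + d * C r j) →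
           (∀ i → i ≢ r → ∀ j → A i j ≈ B i j) →
           (∀ i → i ≢ r → ∀ j → A i j ≈ C i j) →
           ∀ j → cofactor A j ≈ a * cofactor B j + d * cofactor C j
    term zero h hB hC j = begin
      ε * A zero j * δ A                        ≈⟨ *-congʳ (*-congˡ (h j)) ⟩
      ε * (a * B zero j + d * C zero j) * δ A
        ≈⟨ solve 6 (λ ε a b d c δ → ε :* (a :* b :+ d :* c) :* δ
            := a :* (ε :* b :* δ) :+ d :* (ε :* c :* δ)) refl ε a (B zero j) d (C zero j) (δ A) ⟩
      a * (ε * B zero j * δ A) + d * (ε * C zero j * δ A)
        ≈⟨ +-cong (*-congˡ (*-congˡ (det-cong n λ i s → hB (suc i) (λ ()) (punchIn j s))))
                  (*-congˡ (*-congˡ (det-cong n λ i s → hC (suc i) (λ ()) (punchIn j s)))) ⟩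
      a * cofactor B j + d * cofactor C j ∎
      where
      ε = (- 1#) ^ toℕ j
      δ : Matrix (suc n) (suc n) → Carrier
      δ M = det n (minor M zero j)
    term (suc r) h hB hC j = begin
      ε * A zero j * δ A                      ≈⟨ *-congˡ ih ⟩
      ε * A zero j * (a * δ B + d * δ C)
        ≈⟨ solve 6 (λ ε x a b d c → ε :* x :* (a :* b :+ d :* c)
            := a :* (ε :* x :* b) :+ d :* (ε :* x :* c)) refl ε (A zero j) a (δ B) d (δ C) ⟩
      a * (ε * A zero j * δ B) + d * (ε * A zero j * δ C)
        ≈⟨ +-cong (*-congˡ (*-congʳ (*-congˡ (hB zero (λ ()) j))))
            (*-congˡ (*-congʳ (*-congˡ (hC zero (λ ()) j)))) ⟩
      a * cofactor B j + d * cofactor C j ∎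
      where
      ε = (- 1#) ^ toℕ j
      δ : Matrix (suc n) (suc n) → Carrier
      δ M = det n (minor M zero j)
      ih = det-linear n r a d (λ s → h (punchIn j s))
             (λ i i≢r s → hB (suc i) (i≢r ∘ suc-injective) (punchIn j s))
             (λ i i≢r s → hC (suc i) (i≢r ∘ suc-injective) (punchIn j s))

  det-multilinear : ∀ n → IsMultilinear (det n)
  det-multilinear n = record { linear = det-linear n ; congruent = det-cong n }

  infixl 5 _[_≔_]
  _[_≔_] : ∀ {m n} → Matrix m n → Fin m → Row n → Matrix m n
  (A [ zero  ≔ v ]) zero    = v
  (A [ zero  ≔ v ]) (suc i) = A (suc i)
  (A [ suc r ≔ v ]) zero    = A zero
  (A [ suc r ≔ v ]) (suc i) = (A ∘ suc [ r ≔ v ]) i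

  ≔-updated : ∀ {m n} (A : Matrix m n) r v → (A [ r ≔ v ]) r ≡ v
  ≔-updated A zero    v = ≡.refl
  ≔-updated A (suc r) v = ≔-updated (A ∘ suc) r v

  ≔-other : ∀ {m n} (A : Matrix m n) {r i} v → i ≢ r → (A [ r ≔ v ]) i ≡ A i
  ≔-other A {zero}  {zero}  v i≢r = contradiction ≡.refl i≢r
  ≔-other A {zero}  {suc i} v i≢r = ≡.refl
  ≔-other A {suc r} {zero}  v i≢r = ≡.refl
  ≔-other A {suc r} {suc i} v i≢r = ≔-other (A ∘ suc) v (i≢r ∘ ≡.cong suc)

  ≡⇒≈ : ∀ {n} {u v : Row n} → u ≡ v → ∀ j → u j ≈ v j
  ≡⇒≈ ≡.refl j = refl

  module _ {m n} {F : Matrix m n → Carrier} (ml : IsMultilinear F) where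

    row-additive : ∀ (A : Matrix m n) r u v → F (A [ r ≔ (λ j → u j + v j) ])
        ≈ F (A [ r ≔ u ]) + F (A [ r ≔ v ])
    row-additive A r u v = trans
      (linear ml r 1# 1#
        (λ j → begin
          (A [ r ≔ (λ j → u j + v j) ]) r j  ≈⟨ ≡⇒≈ (≔-updated A r _) j ⟩
          u j + v j                          ≈⟨ +-cong (*-identityˡ _) (*-identityˡ _) ⟨
          1# * u j + 1# * v j
            ≈⟨ +-cong (*-congˡ (≡⇒≈ (≔-updated A r u) j)) (*-congˡ (≡⇒≈ (≔-updated A r v) j)) ⟨
          1# * (A [ r ≔ u ]) r j + 1# * (A [ r ≔ v ]) r j ∎)
        (λ i i≢r → ≡⇒≈ (≡.trans (≔-other A _ i≢r) (≡.sym (≔-other A _ i≢r))))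
        (λ i i≢r → ≡⇒≈ (≡.trans (≔-other A _ i≢r) (≡.sym (≔-other A _ i≢r)))))
      (+-cong (*-identityˡ _) (*-identityˡ _))

    row-sum : ∀ {k} (A : Matrix m n) r (a : Row k) (v : Matrix k n) →
              F (A [ r ≔ (λ j → sum (λ l → a l * v l j)) ]) ≈ sum (λ l → a l * F (A [ r ≔ v l ]))
    row-sum {zero}  A r a v = zero-row ml r (≡⇒≈ (≔-updated A r _))
    row-sum {suc k} A r a v = begin
      F (A [ r ≔ (λ j → a zero * v zero j + rest j) ])
        ≈⟨ linear ml r (a zero) 1#
             (λ j → begin
               (A [ r ≔ (λ j → a zero * v zero j + rest j) ]) r j  ≈⟨ ≡⇒≈ (≔-updated A r _) j ⟩
               a zero * v zero j + rest j             ≈⟨ +-congˡ (*-identityˡ _) ⟨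
               a zero * v zero j + 1# * rest j
                 ≈⟨ +-cong (*-congˡ (≡⇒≈ (≔-updated A r (v zero)) j))
                     (*-congˡ (≡⇒≈ (≔-updated A r rest) j)) ⟨
               a zero * (A [ r ≔ v zero ]) r j + 1# * (A [ r ≔ rest ]) r j ∎)
             (λ i i≢r → ≡⇒≈ (≡.trans (≔-other A _ i≢r) (≡.sym (≔-other A _ i≢r))))
             (λ i i≢r → ≡⇒≈ (≡.trans (≔-other A _ i≢r) (≡.sym (≔-other A _ i≢r)))) ⟩
      a zero * F (A [ r ≔ v zero ]) + 1# * F (A [ r ≔ rest ])
        ≈⟨ +-congˡ (trans (*-identityˡ _) (row-sum A r (a ∘ suc) (v ∘ suc))) ⟩
      sum (λ l → a l * F (A [ r ≔ v l ])) ∎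
      where
      rest : Row n
      rest j = sum (λ l → a (suc l) * v (suc l) j)

    module _ (alt : IsAlternating F) where

      -- Put u + v into both rows p and q: the form vanishes there, and after expansion the terms
      -- with two equal rows vanish too, which leaves F(u, v) + F(v, u) = 0.
      swap-rows : ∀ {A B : Matrix m n} p q → p ≢ q →
                  (∀ j → A p j ≈ B q j) → (∀ j → A q j ≈ B p j) →
                  (∀ i → i ≢ p → i ≢ q → ∀ j → A i j ≈ B i j) → F A ≈ - F B
      swap-rows {A} {B} p q p≢q hp hq h = begin
        F A             ≈⟨ congruent ml A≈ ⟩
        F (W u v)       ≈⟨ solve 2 (λ x y → x := (x :+ y) :- y) refl (F (W u v)) (F (W v u)) ⟩
        F (W u v) + F (W v u) - F (W v u)  ≈⟨ +-congʳ sum≈0 ⟩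
        0# - F (W v u)  ≈⟨ +-identityˡ _ ⟩
        - F (W v u)     ≈⟨ -‿cong (congruent ml B≈) ⟨
        - F B           ∎
        where
        u v u+v : Row n
        u = A p
        v = A q
        u+v j = u j + v j
        q≢p : q ≢ p
        q≢p = p≢q ∘ ≡.sym
        W : Row n → Row n → Matrix m n
        W a b = A [ p ≔ a ] [ q ≔ b ]
        W-p : ∀ a b → W a b p ≡ a
        W-p a b = ≡.trans (≔-other (A [ p ≔ a ]) b p≢q) (≔-updated A p a)
        W-q : ∀ a b → W a b q ≡ b
        W-q a b = ≔-updated (A [ p ≔ a ]) q b
        W-other : ∀ a b i → i ≢ p → i ≢ q → W a b i ≡ A i
        W-other a b i i≢p i≢q = ≡.trans (≔-other (A [ p ≔ a ]) b i≢q) (≔-other A a i≢p)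
        W-same : ∀ a → F (W a a) ≈ 0#
        W-same a = alt p q p≢q (≡⇒≈ (≡.trans (W-p a a) (≡.sym (W-q a a))))
        W-swap : ∀ a b → ∀ i j → W a b i j ≈ (A [ q ≔ b ] [ p ≔ a ]) i j
        W-swap a b i j with i Fin.≟ p
        ... | yes ≡.refl = ≡⇒≈ (≡.trans (W-p a b) (≡.sym (≔-updated (A [ q ≔ b ]) p a))) j
        ... | no i≢p with i Fin.≟ q
        ...   | yes ≡.refl = ≡⇒≈ (≡.trans (W-q a b)
            (≡.sym (≡.trans (≔-other (A [ q ≔ b ]) a q≢p) (≔-updated A q b)))) j
        ...   | no i≢q = ≡⇒≈ (≡.trans (W-other a b i i≢p i≢q)
            (≡.sym (≡.trans (≔-other (A [ q ≔ b ]) a i≢p) (≔-other A b i≢q)))) j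
        A≈ : ∀ i j → A i j ≈ W u v i j
        A≈ i j with i Fin.≟ p
        ... | yes ≡.refl = ≡⇒≈ (≡.sym (W-p u v)) j
        ... | no i≢p with i Fin.≟ q
        ...   | yes ≡.refl = ≡⇒≈ (≡.sym (W-q u v)) j
        ...   | no i≢q = ≡⇒≈ (≡.sym (W-other u v i i≢p i≢q)) j
        B≈ : ∀ i j → B i j ≈ W v u i j
        B≈ i j with i Fin.≟ p
        ... | yes ≡.refl = trans (sym (hq j)) (≡⇒≈ (≡.sym (W-p v u)) j)
        ... | no i≢p with i Fin.≟ q
        ...   | yes ≡.refl = trans (sym (hp j)) (≡⇒≈ (≡.sym (W-q v u)) j)
        ...   | no i≢q = trans (sym (h i i≢p i≢q j)) (≡⇒≈ (≡.sym (W-other v u i i≢p i≢q)) j)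
        split : ∀ b → F (W u+v b) ≈ F (W u b) + F (W v b)
        split b = begin
          F (W u+v b)                     ≈⟨ congruent ml (W-swap u+v b) ⟩
          F (A [ q ≔ b ] [ p ≔ u+v ])     ≈⟨ row-additive (A [ q ≔ b ]) p u v ⟩
          F (A [ q ≔ b ] [ p ≔ u ]) + F (A [ q ≔ b ] [ p ≔ v ])
            ≈⟨ +-cong (congruent ml (W-swap u b)) (congruent ml (W-swap v b)) ⟨
          F (W u b) + F (W v b) ∎
        sum≈0 : F (W u v) + F (W v u) ≈ 0#
        sum≈0 = sym (begin
          0#                                 ≈⟨ W-same u+v ⟨
          F (W u+v u+v)                      ≈⟨ row-additive (A [ p ≔ u+v ]) q u v ⟩
          F (W u+v u) + F (W u+v v)          ≈⟨ +-cong (split u) (split v) ⟩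
          (F (W u u) + F (W v u)) + (F (W u v) + F (W v v))
            ≈⟨ +-cong (+-congʳ (W-same u)) (+-congˡ (W-same v)) ⟩
          (0# + F (W v u)) + (F (W u v) + 0#)
            ≈⟨ solve 2 (λ x y → (κ 0 :+ y) :+ (x :+ κ 0) := x :+ y) refl (F (W u v)) (F (W v u)) ⟩
          F (W u v) + F (W v u) ∎)

  -- The symmetry of a function of two distinct indices p and q, given as a
  -- function of p and of the position of q among the indices other than p.
  Symmetric : ∀ m → (Fin (suc m) → Fin m → Carrier) → Set ℓ
  Symmetric zero    G = ⊤
  Symmetric (suc m) G = (∀ k → G zero k ≈ G (suc k) zero) ∧ Symmetric m (λ j k → G (suc j) (suc k))

  -- The value depends only on the set of the two deleted columns, not on their order. The surviving
  -- columns are passed as a map φ so that column 0, once it is known to survive, can be put back by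
  -- `extend` while the induction treats the others.
  deleted-columns-symmetric :
    ∀ n (f : (Fin n → Fin (suc (suc n))) → Carrier) → (∀ {φ ψ} → (∀ s → φ s ≡ ψ s) → f φ ≈ f ψ) →
    ∀ (G : Fin (suc (suc n)) → Fin (suc n) → Carrier) → (∀ j k → G j k
        ≈ f (λ s → punchIn j (punchIn k s))) → Symmetric (suc n) G
  deleted-columns-symmetric n f f-cong G h =
      (λ k → trans (h zero k) (sym (h (suc k) zero))) , rest n f f-cong G h
    where
    rest : ∀ n (f : (Fin n → Fin (suc (suc n))) → Carrier) → (∀ {φ ψ} → (∀ s → φ s ≡ ψ s) → f φ ≈ f ψ) →
           ∀ (G : Fin (suc (suc n)) → Fin (suc n) → Carrier) → (∀ j k → G j k
               ≈ f (λ s → punchIn j (punchIn k s))) → Symmetric n (λ j k → G (suc j) (suc k))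
    rest zero    f f-cong G h = tt
    rest (suc n) f f-cong G h = deleted-columns-symmetric n (λ φ → f (extend φ))
      (λ φ≗ψ → f-cong λ where
        zero    → ≡.refl
        (suc s) → ≡.cong suc (φ≗ψ s))
      (λ j k → G (suc j) (suc k))
      λ j k → trans (h (suc j) (suc k)) (f-cong λ where
        zero    → ≡.refl
        (suc s) → ≡.refl)
      where
      extend : (Fin n → Fin (suc (suc n))) → Fin (suc n) → Fin (suc (suc (suc n)))
      extend φ zero    = zero
      extend φ (suc s) = suc (φ s)

  -- The pair of columns 0 and k + 1 occurs twice, as (0, k) and as (k + 1, 0), with opposite signs
  -- and equal values of G. The pairs without column 0 form the same double sum for `a ∘ suc`.
  alternating-double-sum : ∀ m (a : Row (suc m)) G → Symmetric m G →
    sum (λ j → (- 1#) ^ toℕ j * a j * sum (λ k → (- 1#) ^ toℕ k * a (punchIn j k) * G j k)) ≈ 0#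
  alternating-double-sum zero a G _ = solve 1 (λ x → κ 1 :* x :* κ 0 :+ κ 0 := κ 0) refl (a zero)
  alternating-double-sum (suc m) a G (G-sym , G′-sym) = begin
    1# * a zero * sum e + sum (λ j → - 1# * ε j * a (suc j) * sum (inner j))
      ≈⟨ +-congˡ (sum-cong-≋ term) ⟩
    1# * a zero * sum e + sum (λ j → - (1# * a zero) * e j + ε j * a (suc j) * sum (inner′ j))
      ≈⟨ +-congˡ (∑-distrib-+ (λ j → - (1# * a zero) * e j) (λ j → ε j * a (suc j) * sum (inner′ j))) ⟩
    1# * a zero * sum e + (sum (λ j → - (1# * a zero) * e j) + sum (λ j → ε j * a (suc j) * sum (inner′ j)))
      ≈⟨ +-congˡ (+-cong (sym (*-distribˡ-sum (- (1# * a zero)) e))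
          (alternating-double-sum m (a ∘ suc) (λ j k → G (suc j) (suc k)) G′-sym)) ⟩
    1# * a zero * sum e + (- (1# * a zero) * sum e + 0#)
      ≈⟨ solve 2 (λ x y → x :* y :+ ((:- x) :* y :+ κ 0) := κ 0) refl (1# * a zero) (sum e) ⟩
    0# ∎
    where
    ε : ∀ {n} → Fin n → Carrier
    ε j = (- 1#) ^ toℕ j
    e : Row (suc m)
    e k = ε k * a (suc k) * G zero k
    inner : Fin (suc m) → Row (suc m)
    inner j k = ε k * a (punchIn (suc j) k) * G (suc j) k
    inner′ : Fin (suc m) → Row m
    inner′ j k = ε k * a (suc (punchIn j k)) * G (suc j) (suc k)
    tail-sum : ∀ j → sum (inner j ∘ suc) ≈ - 1# * sum (inner′ j)
    tail-sum j = trans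
      (sum-cong-≋ λ k → solve 3 (λ ε x g → (:- κ 1) :* ε :* x :* g := (:- κ 1) :* (ε :* x :* g)) refl
        (ε k) (a (suc (punchIn j k))) (G (suc j) (suc k)))
      (sym (*-distribˡ-sum (- 1#) (inner′ j)))
    term : ∀ j → - 1# * ε j * a (suc j) * sum (inner j)
               ≈ - (1# * a zero) * e j + ε j * a (suc j) * sum (inner′ j)
    term j = begin
      - 1# * ε j * a (suc j) * (1# * a zero * G (suc j) zero + sum (inner j ∘ suc))
        ≈⟨ *-congˡ (+-cong (*-congˡ (sym (G-sym j))) (tail-sum j)) ⟩
      - 1# * ε j * a (suc j) * (1# * a zero * G zero j + - 1# * sum (inner′ j))
        ≈⟨ solve 5 (λ ε x y g s → (:- κ 1) :* ε :* x :* (κ 1 :* y :* g :+ (:- κ 1) :* s)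
            := (:- (κ 1 :* y)) :* (ε :* x :* g) :+ ε :* x :* s)
             refl (ε j) (a (suc j)) (a zero) (G zero j) (sum (inner′ j)) ⟩
      - (1# * a zero) * e j + ε j * a (suc j) * sum (inner′ j) ∎

  private
    ≡⇒≈′ : ∀ {n} (a : Row n) {i j} → i ≡ j → a i ≈ a j
    ≡⇒≈′ a ≡.refl = refl

  -- If row 1 equals row 0, expanding along both gives the antisymmetric double sum. Otherwise rows
  -- 1 and q + 2 are exchanged inside every minor of row 0, where `alt` is available for the smaller
  -- size, and the equal row arrives at position 1.
  det-equal-first : ∀ n → IsAlternating (det n) → ∀ (A : Matrix (suc n) (suc n)) q → (∀ j → A zero j
      ≈ A (suc q) j) → det (suc n) A ≈ 0#
  det-equal-first (suc n) alt A zero h = begin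
    det (suc (suc n)) A
      ≈⟨ sum-cong (cofactor A) (λ j → ε j * a j * sum (λ k → ε k * a (punchIn j k) * G j k)) (λ j → *-congˡ
           (sum-cong (cofactor (minor A zero j)) (λ k → ε k * a (punchIn j k) * G j k) λ k →
               *-congʳ (*-congˡ (sym (h (punchIn j k)))))) ⟩
    sum (λ j → ε j * a j * sum (λ k → ε k * a (punchIn j k) * G j k))
      ≈⟨ alternating-double-sum (suc n) a G (deleted-columns-symmetric n (λ φ →
          det n (λ r s → A (suc (suc r)) (φ s)))
           (λ φ≗ψ → det-cong n λ r s → ≡⇒≈′ (A (suc (suc r))) (φ≗ψ s)) G (λ j k → refl)) ⟩
    0# ∎
    where
    a : Row (suc (suc n))
    a = A zero
    ε : ∀ {n} → Fin n → Carrier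
    ε j = (- 1#) ^ toℕ j
    G : Fin (suc (suc n)) → Fin (suc n) → Carrier
    G j k = det n (λ r s → A (suc (suc r)) (punchIn j (punchIn k s)))
  det-equal-first (suc n) alt A (suc q) h = begin
    det (suc (suc n)) A                ≈⟨ sum-cong (cofactor A) (λ j → - 1# * cofactor B j) swapped ⟩
    sum (λ j → - 1# * cofactor B j)    ≈⟨ *-distribˡ-sum (- 1#) (cofactor B) ⟨
    - 1# * det (suc (suc n)) B         ≈⟨ *-congˡ (det-equal-first (suc n) alt B zero h) ⟩
    - 1# * 0#                          ≈⟨ zeroʳ _ ⟩
    0#                                 ∎
    where
    B : Matrix (suc (suc n)) (suc (suc n))
    B = A [ suc zero ≔ A (suc (suc q)) ] [ suc (suc q) ≔ A (suc zero) ]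
    below : Matrix n (suc (suc n))
    below i = A (suc (suc i))
    swapped : ∀ j → cofactor A j ≈ - 1# * cofactor B j
    swapped j = begin
      (- 1#) ^ toℕ j * A zero j * det (suc n) (minor A zero j)
        ≈⟨ *-congˡ (swap-rows (det-multilinear (suc n)) alt {A = minor A zero j} {B = minor B zero j} zero
            (suc q) (λ ())
             (λ s → sym (≡⇒≈ (≔-updated below q (A (suc zero))) (punchIn j s)))
             (λ s → refl)
             λ where
               zero    i≢0 _   s → contradiction ≡.refl i≢0
               (suc i) _   i≢q s → sym (≡⇒≈ (≔-other below (A (suc zero)) (i≢q ∘ ≡.cong suc))
                   (punchIn j s))) ⟩
      (- 1#) ^ toℕ j * A zero j * - det (suc n) (minor B zero j)
        ≈⟨ solve 3 (λ ε x d → ε :* x :* (:- d) := (:- κ 1) :* (ε :* x :* d))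
            refl ((- 1#) ^ toℕ j) (A zero j) (det (suc n) (minor B zero j)) ⟩
      - 1# * cofactor B j ∎

  det-alternating : ∀ n → IsAlternating (det n)
  det-alternating (suc n) {A} zero    zero    p≢q h = contradiction ≡.refl p≢q
  det-alternating (suc n) {A} zero    (suc q) p≢q h = det-equal-first n (det-alternating n) A q h
  det-alternating (suc n) {A} (suc p) zero    p≢q h = det-equal-first n (det-alternating n) A p λ j →
      sym (h j)
  det-alternating (suc n) {A} (suc p) (suc q) p≢q h = sum-zero (cofactor A) λ j →
    trans (*-congˡ (det-alternating n p q (p≢q ∘ ≡.cong suc) (h ∘ punchIn j))) (zeroʳ _)

  unit : ∀ {n} → Matrix n n
  unit zero    zero    = 1#
  unit zero    (suc j) = 0#
  unit (suc i) zero    = 0#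
  unit (suc i) (suc j) = unit i j

  unit-diagonal : ∀ {n} (i : Fin n) → unit i i ≈ 1#
  unit-diagonal zero    = refl
  unit-diagonal (suc i) = unit-diagonal i

  unit-off-diagonal : ∀ {n} {i j : Fin n} → i ≢ j → unit i j ≈ 0#
  unit-off-diagonal {i = zero}  {zero}  i≢j = contradiction ≡.refl i≢j
  unit-off-diagonal {i = zero}  {suc j} i≢j = refl
  unit-off-diagonal {i = suc i} {zero}  i≢j = refl
  unit-off-diagonal {i = suc i} {suc j} i≢j = unit-off-diagonal (i≢j ∘ ≡.cong suc)

  sum-unit : ∀ {n} (a : Row n) i → sum (λ k → a k * unit k i) ≈ a i
  sum-unit a i = begin
    sum (λ k → a k * unit k i)
      ≈⟨ sum-single (λ k → a k * unit k i) i (λ j j≢i → trans (*-congˡ (unit-off-diagonal j≢i)) (zeroʳ _)) ⟩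
    a i * unit i i              ≈⟨ *-congˡ (unit-diagonal i) ⟩
    a i * 1#                    ≈⟨ *-identityʳ _ ⟩
    a i                         ∎

  unit-sum : ∀ {n} (a : Row n) i → sum (λ k → unit i k * a k) ≈ a i
  unit-sum a i = begin
    sum (λ k → unit i k * a k)
      ≈⟨ sum-single (λ k → unit i k * a k) i (λ j j≢i →
          trans (*-congʳ (unit-off-diagonal (j≢i ∘ ≡.sym))) (zeroˡ _)) ⟩
    unit i i * a i              ≈⟨ *-congʳ (unit-diagonal i) ⟩
    1# * a i                    ≈⟨ *-identityˡ _ ⟩
    a i                         ∎

  insert-zero : ∀ {n} → Fin (suc n) → Row n → Row (suc n)
  insert-zero         zero    v zero    = 0#
  insert-zero         zero    v (suc k) = v k
  insert-zero {suc n} (suc j) v zero    = v zero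
  insert-zero {suc n} (suc j) v (suc k) = insert-zero j (v ∘ suc) k

  insert-zero-cong : ∀ {n} j {u v : Row n} → (∀ k → u k ≈ v k) → ∀ k → insert-zero j u k ≈ insert-zero j v k
  insert-zero-cong         zero    h zero    = refl
  insert-zero-cong         zero    h (suc k) = h k
  insert-zero-cong {suc n} (suc j) h zero    = h zero
  insert-zero-cong {suc n} (suc j) h (suc k) = insert-zero-cong j (h ∘ suc) k

  insert-zero-linear : ∀ {n} j a d {u v w : Row n} → (∀ k → u k ≈ a * v k + d * w k) →
                       ∀ k → insert-zero j u k ≈ a * insert-zero j v k + d * insert-zero j w k
  insert-zero-linear         zero    a d h zero    = solve 2 (λ a d → κ 0 := a :* κ 0 :+ d :* κ 0) refl a d
  insert-zero-linear         zero    a d h (suc k) = h k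
  insert-zero-linear {suc n} (suc j) a d h zero    = h zero
  insert-zero-linear {suc n} (suc j) a d h (suc k) = insert-zero-linear j a d (h ∘ suc) k

  insert-zero-unit : ∀ {n} j (i : Fin n) k → insert-zero j (unit i) k ≈ unit (punchIn j i) k
  insert-zero-unit zero    zero    zero    = refl
  insert-zero-unit zero    zero    (suc k) = refl
  insert-zero-unit zero    (suc i) zero    = refl
  insert-zero-unit zero    (suc i) (suc k) = refl
  insert-zero-unit (suc j) zero    zero    = refl
  insert-zero-unit (suc j) zero    (suc k) = zeros j k
    where
    zeros : ∀ {n} j k → insert-zero {n} j (λ _ → 0#) k ≈ 0#
    zeros         zero    zero    = refl
    zeros         zero    (suc k) = refl
    zeros {suc n} (suc j) zero    = refl
    zeros {suc n} (suc j) (suc k) = zeros j k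
  insert-zero-unit (suc j) (suc i) zero    = refl
  insert-zero-unit (suc j) (suc i) (suc k) = insert-zero-unit j i k

  row-split : ∀ {n} j (u : Row (suc n)) k → u k ≈ insert-zero j (u ∘ punchIn j) k + u j * unit j k
  row-split         zero    u zero    = solve 1 (λ x → x := κ 0 :+ x :* κ 1) refl (u zero)
  row-split         zero    u (suc k) = solve 2 (λ x y → x := x :+ y :* κ 0) refl (u (suc k)) (u zero)
  row-split {suc n} (suc j) u zero    = solve 2 (λ x y → x := x :+ y :* κ 0) refl (u zero) (u (suc j))
  row-split {suc n} (suc j) u (suc k) = row-split j (u ∘ suc) k

  infixr 5 _◂_
  _◂_ : ∀ {m n} → Row n → Matrix m n → Matrix (suc m) n
  (v ◂ A) zero    = v
  (v ◂ A) (suc i) = A i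

  ◂-multilinear : ∀ {m n} {F : Matrix (suc m) n → Carrier} → IsMultilinear F → ∀ v →
      IsMultilinear (λ A → F (v ◂ A))
  ◂-multilinear ml v = record
    { linear = λ r a d h hB hC → linear ml (suc r) a d h
        (λ where
          zero    _   j → refl
          (suc i) i≢r j → hB i (i≢r ∘ ≡.cong suc) j)
        (λ where
          zero    _   j → refl
          (suc i) i≢r j → hC i (i≢r ∘ ≡.cong suc) j)
    ; congruent = λ h → congruent ml λ where
        zero    j → refl
        (suc i) j → h i j
    }

  -- Multiples of e are stripped from the rows one at a time; each correction term has a row equal
  -- to e. With a unit vector as e this clears a whole column.
  multilinear-modulo : ∀ {m n} {F : Matrix m n → Carrier} → IsMultilinear F →
    ∀ (e : Row n) → (∀ {A} i → (∀ k → A i k ≈ e k) → F A ≈ 0#) →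
    ∀ {A B : Matrix m n} (a : Fin m → Carrier) → (∀ i k → A i k ≈ B i k + a i * e k) → F A ≈ F B
  multilinear-modulo {zero}          ml e F-e a h = congruent ml λ ()
  multilinear-modulo {suc m} {F = F} ml e F-e {A} {B} a h = begin
    F A
      ≈⟨ linear ml zero 1# (a zero) {B = B zero ◂ A ∘ suc} {C = e ◂ A ∘ suc}
           (λ k → trans (h zero k) (+-congʳ (sym (*-identityˡ _))))
           (λ where
             zero    0≢0 j → contradiction ≡.refl 0≢0
             (suc i) _   j → refl)
           (λ where
             zero    0≢0 j → contradiction ≡.refl 0≢0
             (suc i) _   j → refl) ⟩
    1# * F (B zero ◂ A ∘ suc) + a zero * F (e ◂ A ∘ suc)
      ≈⟨ +-congˡ (*-congˡ (F-e {e ◂ A ∘ suc} zero (λ k → refl))) ⟩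
    1# * F (B zero ◂ A ∘ suc) + a zero * 0#
      ≈⟨ solve 2 (λ x y → κ 1 :* x :+ y :* κ 0 := x) refl (F (B zero ◂ A ∘ suc)) (a zero) ⟩
    F (B zero ◂ A ∘ suc)
      ≈⟨ multilinear-modulo (◂-multilinear ml (B zero)) e (λ i → F-e (suc i)) (a ∘ suc) (h ∘ suc) ⟩
    F (B zero ◂ B ∘ suc)
      ≈⟨ congruent ml (λ where
           zero    j → refl
           (suc i) j → refl) ⟩
    F B ∎

  unit-to-front : ∀ {n} → Fin (suc n) → Matrix (suc n) (suc n)
  unit-to-front l = unit l ◂ λ r → unit (punchIn l r)

  private
    punchIn-suc-self : ∀ {n} (l : Fin n) → punchIn (suc l) l ≡ inject₁ l
    punchIn-suc-self zero    = ≡.refl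
    punchIn-suc-self (suc l) = ≡.cong suc (punchIn-suc-self l)

    punchIn-inject₁-self : ∀ {n} (l : Fin n) → punchIn (inject₁ l) l ≡ suc l
    punchIn-inject₁-self zero    = ≡.refl
    punchIn-inject₁-self (suc l) = ≡.cong suc (punchIn-inject₁-self l)

    punchIn-other : ∀ {n} {l i : Fin n} → i ≢ l → punchIn (suc l) i ≡ punchIn (inject₁ l) i
    punchIn-other {l = zero}  {zero}  i≢l = contradiction ≡.refl i≢l
    punchIn-other {l = zero}  {suc i} i≢l = ≡.refl
    punchIn-other {l = suc l} {zero}  i≢l = ≡.refl
    punchIn-other {l = suc l} {suc i} i≢l = ≡.cong suc (punchIn-other (i≢l ∘ ≡.cong suc))

  module _ {n} {F : Matrix (suc n) (suc n) → Carrier} (ml : IsMultilinear F) (alt : IsAlternating F) where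

    -- Exchanging row 0 with row l + 1 turns the arrangement for l + 1 into the one for l. The
    -- induction runs on k because `inject₁ l` is not a subterm of `suc l`.
    unit-to-front-sign : ∀ k l → toℕ l ≡ k → F (unit-to-front l) ≈ (- 1#) ^ k * F unit
    unit-to-front-sign zero zero ≡.refl = trans (congruent ml λ where
      zero    j → refl
      (suc i) j → refl) (sym (*-identityˡ _))
    unit-to-front-sign (suc k) (suc l) eq = begin
      F (unit-to-front (suc l))
        ≈⟨ swap-rows ml alt {A = unit-to-front (suc l)} {B = unit-to-front (inject₁ l)} zero (suc l) (λ ())
             (≡⇒≈ (≡.cong unit (≡.sym (punchIn-inject₁-self l))))
             (≡⇒≈ (≡.cong unit (punchIn-suc-self l)))
             (λ where
               zero    0≢0 _   → contradiction ≡.refl 0≢0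
               (suc i) _   i≢l → ≡⇒≈ (≡.cong unit (punchIn-other (i≢l ∘ ≡.cong suc)))) ⟩
      - F (unit-to-front (inject₁ l))
        ≈⟨ -‿cong (unit-to-front-sign k (inject₁ l) (≡.trans (toℕ-inject₁ l) (ℕ.suc-injective eq))) ⟩
      - ((- 1#) ^ k * F unit)
        ≈⟨ solve 2 (λ x y → :- (x :* y) := (:- κ 1) :* x :* y) refl ((- 1#) ^ k) (F unit) ⟩
      (- 1#) ^ suc k * F unit ∎

  -- Multiplicativity of `det` rests on this. Once row 0 is `unit l`, column l of the other rows can
  -- be cleared, so that F becomes an alternating form of the minor; bringing the unit matrix back
  -- into order supplies the sign of the cofactor.
  alternating-unique : ∀ n {F : Matrix n n → Carrier} → IsMultilinear F → IsAlternating F →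
                       ∀ A → F A ≈ det n A * F unit
  alternating-unique zero        ml alt A = trans (congruent ml λ ()) (sym (*-identityˡ _))
  alternating-unique (suc n) {F} ml alt A = begin
    F A
      ≈⟨ congruent ml (λ where
           zero    j → sym (sum-unit (A zero) j)
           (suc i) j → refl) ⟩
    F (A [ zero ≔ (λ j → sum (λ l → A zero l * unit l j)) ])
      ≈⟨ row-sum ml A zero (A zero) unit ⟩
    sum (λ l → A zero l * F (A [ zero ≔ unit l ]))
      ≈⟨ sum-cong (λ l → A zero l * F (A [ zero ≔ unit l ])) (λ l → cofactor A l * F unit) term ⟩
    sum (λ l → cofactor A l * F unit)
      ≈⟨ *-distribʳ-sum (F unit) (cofactor A) ⟨
    sum (cofactor A) * F unit ∎
    where
    F′ : Fin (suc n) → Matrix n n → Carrier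
    F′ l M = F (unit l ◂ insert-zero l ∘ M)
    ml′ : ∀ l → IsMultilinear (F′ l)
    ml′ l = record
      { linear = λ r a d h hB hC → linear (◂-multilinear ml (unit l)) r a d (insert-zero-linear l a d h)
          (λ i i≢r → insert-zero-cong l (hB i i≢r)) (λ i i≢r → insert-zero-cong l (hC i i≢r))
      ; congruent = λ h → congruent (◂-multilinear ml (unit l)) (λ i → insert-zero-cong l (h i))
      }
    alt′ : ∀ l → IsAlternating (F′ l)
    alt′ l {M} p q p≢q h = alt {unit l ◂ insert-zero l ∘ M} (suc p) (suc q) (p≢q ∘ suc-injective)
        (insert-zero-cong l h)
    term : ∀ l → A zero l * F (A [ zero ≔ unit l ]) ≈ cofactor A l * F unit
    term l = begin
      A zero l * F (A [ zero ≔ unit l ])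
        ≈⟨ *-congˡ (congruent ml λ where
             zero    j → refl
             (suc i) j → refl) ⟩
      A zero l * F (unit l ◂ A ∘ suc)
        ≈⟨ *-congˡ (multilinear-modulo (◂-multilinear ml (unit l)) (unit l)
             (λ {M} i h → alt {unit l ◂ M} zero (suc i) (λ ()) (λ k → sym (h k))) (λ i → A (suc i) l)
                 (λ i → row-split l (A (suc i)))) ⟩
      A zero l * F′ l (minor A zero l)
        ≈⟨ *-congˡ (alternating-unique n (ml′ l) (λ {M} → alt′ l {M}) (minor A zero l)) ⟩
      A zero l * (det n (minor A zero l) * F′ l unit)
        ≈⟨ *-congˡ (*-congˡ (congruent ml λ where
             zero    j → refl
             (suc i) j → insert-zero-unit l i j)) ⟩
      A zero l * (det n (minor A zero l) * F (unit-to-front l))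
        ≈⟨ *-congˡ (*-congˡ (unit-to-front-sign ml alt (toℕ l) l ≡.refl)) ⟩
      A zero l * (det n (minor A zero l) * ((- 1#) ^ toℕ l * F unit))
        ≈⟨ solve 4 (λ a d ε f → a :* (d :* (ε :* f)) := ε :* a :* d :* f)
            refl (A zero l) (det n (minor A zero l)) ((- 1#) ^ toℕ l) (F unit) ⟩
      cofactor A l * F unit ∎

  infixl 7 _·_
  _·_ : ∀ {l m n} → Matrix l m → Matrix m n → Matrix l n
  (A · B) i j = sum (λ k → A i k * B k j)

  det-· : ∀ n (A B : Matrix n n) → det n (A · B) ≈ det n A * det n B
  det-· n A B = begin
    det n (A · B)              ≈⟨ alternating-unique n ml (λ {M} → alt {M}) A ⟩
    det n A * det n (unit · B) ≈⟨ *-congˡ (det-cong n λ i j → unit-sum (λ k → B k j) i) ⟩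
    det n A * det n B          ∎
    where
    ·-cong : ∀ {u v : Row n} → (∀ k → u k ≈ v k) → ∀ j → sum (λ k → u k * B k j) ≈ sum (λ k → v k * B k j)
    ·-cong {u} {v} h j = sum-cong (λ k → u k * B k j) (λ k → v k * B k j) λ k → *-congʳ (h k)
    ml : IsMultilinear (λ M → det n (M · B))
    ml = record
      { linear = λ r a d {M} {M₁} {M₂} h h₁ h₂ → det-linear n r a d
          (λ j → begin
            sum (λ k → M r k * B k j)
              ≈⟨ sum-cong (λ k → M r k * B k j) (λ k → a * (M₁ r k * B k j) + d * (M₂ r k * B k j))
                  (λ k → trans (*-congʳ (h k))
                   (solve 5 (λ a x d y b → (a :* x :+ d :* y) :* b := a :* (x :* b) :+ d :* (y :* b))
                       refl a (M₁ r k) d (M₂ r k) (B k j))) ⟩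
            sum (λ k → a * (M₁ r k * B k j) + d * (M₂ r k * B k j))
              ≈⟨ ∑-distrib-+ (λ k → a * (M₁ r k * B k j)) (λ k → d * (M₂ r k * B k j)) ⟩
            sum (λ k → a * (M₁ r k * B k j)) + sum (λ k → d * (M₂ r k * B k j))
              ≈⟨ +-cong (*-distribˡ-sum a (λ k → M₁ r k * B k j))
                  (*-distribˡ-sum d (λ k → M₂ r k * B k j)) ⟨
            a * sum (λ k → M₁ r k * B k j) + d * sum (λ k → M₂ r k * B k j) ∎)
          (λ i i≢r → ·-cong (h₁ i i≢r)) (λ i i≢r → ·-cong (h₂ i i≢r))
      ; congruent = λ h → det-cong n λ i → ·-cong (h i)
      }
    alt : IsAlternating (λ M → det n (M · B))
    alt {M} p q p≢q h = det-alternating n {M · B} p q p≢q (·-cong h)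

  -- `det` only knows its first row, and transposition exchanges it with the first column. Apart
  -- from the corner, both expansions, carried one step further, are the same double sum of the
  -- `t i j`.
  first-column-expansion : ∀ n (A : Matrix (suc n) (suc n)) →
    det (suc n) A ≈ sum (λ i → (- 1#) ^ toℕ i * A i zero * det n (minor A i zero))
  first-column-expansion zero    A = refl
  first-column-expansion (suc n) A = +-congˡ (begin
    sum (λ j → cofactor A (suc j))
      ≈⟨ sum-cong (λ j → cofactor A (suc j)) (λ j → sum (λ i → t i j)) byRow ⟩
    sum (λ j → sum (λ i → t i j))
      ≈⟨ ∑-comm (λ j i → t i j) ⟩
    sum (λ i → sum (t i))
      ≈⟨ sum-cong (λ i → sum (t i)) (λ i → - 1# * ε i * A (suc i) zero
          * det (suc n) (minor A (suc i) zero)) byColumn ⟩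
    sum (λ i → - 1# * ε i * A (suc i) zero * det (suc n) (minor A (suc i) zero)) ∎)
    where
    ε : Row (suc n)
    ε j = (- 1#) ^ toℕ j
    d : Matrix (suc n) (suc n)
    d i j = det n (λ r s → A (suc (punchIn i r)) (suc (punchIn j s)))
    t : Matrix (suc n) (suc n)
    t i j = - 1# * ε i * ε j * A (suc i) zero * A zero (suc j) * d i j
    byRow : ∀ j → cofactor A (suc j) ≈ sum (λ i → t i j)
    byRow j = begin
      - 1# * ε j * A zero (suc j) * det (suc n) (minor A zero (suc j))
        ≈⟨ *-congˡ (first-column-expansion n (minor A zero (suc j))) ⟩
      - 1# * ε j * A zero (suc j) * sum (λ i → ε i * A (suc i) zero * d i j)
        ≈⟨ *-distribˡ-sum _ (λ i → ε i * A (suc i) zero * d i j) ⟩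
      sum (λ i → - 1# * ε j * A zero (suc j) * (ε i * A (suc i) zero * d i j))
        ≈⟨ sum-cong (λ i → - 1# * ε j * A zero (suc j) * (ε i * A (suc i) zero * d i j)) (λ i → t i j)
             (λ i → solve 5 (λ e f a b d → (:- κ 1) :* f :* b :* (e :* a :* d)
                 := (:- κ 1) :* e :* f :* a :* b :* d)
               refl (ε i) (ε j) (A (suc i) zero) (A zero (suc j)) (d i j)) ⟩
      sum (λ i → t i j) ∎
    byColumn : ∀ i → sum (t i) ≈ - 1# * ε i * A (suc i) zero * det (suc n) (minor A (suc i) zero)
    byColumn i = begin
      sum (t i)
        ≈⟨ sum-cong (t i) (λ j → - 1# * ε i * A (suc i) zero * (ε j * A zero (suc j) * d i j))
             (λ j → solve 5 (λ e f a b d → (:- κ 1) :* e :* f :* a :* b :* d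
                 := (:- κ 1) :* e :* a :* (f :* b :* d))
               refl (ε i) (ε j) (A (suc i) zero) (A zero (suc j)) (d i j)) ⟩
      sum (λ j → - 1# * ε i * A (suc i) zero * (ε j * A zero (suc j) * d i j))
        ≈⟨ *-distribˡ-sum _ (λ j → ε j * A zero (suc j) * d i j) ⟨
      - 1# * ε i * A (suc i) zero * det (suc n) (minor A (suc i) zero) ∎

  det-transpose : ∀ n (A : Matrix n n) → det n (λ i j → A j i) ≈ det n A
  det-transpose zero    A = refl
  det-transpose (suc n) A = trans
    (sum-cong (cofactor (λ i j → A j i)) (λ i → (- 1#) ^ toℕ i * A i zero * det n (minor A i zero))
      λ i → *-congˡ (det-transpose n (minor A i zero)))
    (sym (first-column-expansion n A))

  det-zero-column : ∀ n (A : Matrix n n) k → (∀ i → A i k ≈ 0#) → det n A ≈ 0#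
  det-zero-column n A k h = trans (sym (det-transpose n A)) (zero-row (det-multilinear n) k h)

  det-expand-row : ∀ n (A : Matrix (suc n) (suc n)) k → (∀ j → j ≢ k → A zero j ≈ 0#) →
                   det (suc n) A ≈ (- 1#) ^ toℕ k * A zero k * det n (minor A zero k)
  det-expand-row n A k h = sum-single (cofactor A) k λ j j≢k →
    trans (*-congʳ (trans (*-congˡ (h j j≢k)) (zeroʳ _))) (zeroˡ _)

  det-expand-column : ∀ n (A : Matrix (suc n) (suc n)) k → (∀ i → A (suc i) k ≈ 0#) →
                      det (suc n) A ≈ (- 1#) ^ toℕ k * A zero k * det n (minor A zero k)
  det-expand-column n A k h = sum-single (cofactor A) k λ j j≢k → trans
    (*-congˡ (det-zero-column n (minor A zero j) (punchOut j≢k) λ i → ≡.subst (λ l → A (suc i) l ≈ 0#)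
      (≡.sym (Fin.punchIn-punchOut j≢k)) (h i)))
    (zeroʳ _)

  -- Sums and determinants indexed by natural numbers

  ∑ : ℕ → (ℕ → Carrier) → Carrier
  ∑ n f = sum {n} (λ i → f (toℕ i))

  ∑-cong : ∀ n {f g : ℕ → Carrier} → (∀ {i} → i ℕ.< n → f i ≈ g i) → ∑ n f ≈ ∑ n g
  ∑-cong n {f} {g} h = sum-cong {n} (f ∘ toℕ) (g ∘ toℕ) (λ i → h (toℕ<n i))

  ∑-zero : ∀ n {f : ℕ → Carrier} → (∀ {i} → i ℕ.< n → f i ≈ 0#) → ∑ n f ≈ 0#
  ∑-zero n {f} h = sum-zero {n} (f ∘ toℕ) (λ i → h (toℕ<n i))

  ∑-+ : ∀ m n f → ∑ (m ℕ.+ n) f ≈ ∑ m f + ∑ n (λ i → f (m ℕ.+ i))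
  ∑-+ zero    n f = sym (+-identityˡ _)
  ∑-+ (suc m) n f = trans (+-congˡ (∑-+ m n (f ∘ suc))) (sym (+-assoc _ _ _))

  ∏-cong : ∀ n {f g : ℕ → Carrier} → (∀ {i} → i ℕ.< n → f i ≈ g i) → ∏ n f ≈ ∏ n g
  ∏-cong zero    h = refl
  ∏-cong (suc n) h = *-cong (h z<s) (∏-cong n (λ i<n → h (s<s i<n)))

  ∏-1 : ∀ n {f : ℕ → Carrier} → (∀ {i} → i ℕ.< n → f i ≈ 1#) → ∏ n f ≈ 1#
  ∏-1 zero    h = refl
  ∏-1 (suc n) h = trans (*-cong (h z<s) (∏-1 n (λ i<n → h (s<s i<n)))) (*-identityˡ 1#)

  -- An infinite matrix, of which `Det n` takes the leading corner: shifted rows, blocks and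
  -- truncations are then plain functions and need no arithmetic on `Fin`.
  Matrixℕ : Set c
  Matrixℕ = ℕ → ℕ → Carrier

  Det : ℕ → Matrixℕ → Carrier
  Det n A = det n (λ i j → A (toℕ i) (toℕ j))

  Det-cong : ∀ n {A B : Matrixℕ} → (∀ {i j} → i ℕ.< n → j ℕ.< n → A i j ≈ B i j) → Det n A ≈ Det n B
  Det-cong n h = det-cong n λ i j → h (toℕ<n i) (toℕ<n j)

  Det-· : ∀ n (A B : Matrixℕ) → Det n (λ i j → ∑ n (λ k → A i k * B k j)) ≈ Det n A * Det n B
  Det-· n A B = det-· n (λ i j → A (toℕ i) (toℕ j)) (λ i j → B (toℕ i) (toℕ j))

  Det-transpose : ∀ n (A : Matrixℕ) → Det n (λ i j → A j i) ≈ Det n A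
  Det-transpose n A = det-transpose n (λ i j → A (toℕ i) (toℕ j))

  Det-first-column : ∀ n (A : Matrixℕ) → (∀ {i} → i ℕ.< n → A (suc i) 0 ≈ 0#) →
                     Det (suc n) A ≈ A 0 0 * Det n (λ i j → A (suc i) (suc j))
  Det-first-column n A h = trans (det-expand-column n (λ i j → A (toℕ i) (toℕ j)) zero (λ i → h (toℕ<n i)))
      (*-congʳ (*-identityˡ _))

  Det-first-row : ∀ n (A : Matrixℕ) → (∀ {j} → j ℕ.< n → A 0 (suc j) ≈ 0#) →
                  Det (suc n) A ≈ A 0 0 * Det n (λ i j → A (suc i) (suc j))
  Det-first-row n A h = trans
    (det-expand-row n (λ i j → A (toℕ i) (toℕ j)) zero λ where
      zero    0≢0 → contradiction ≡.refl 0≢0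
      (suc j) _   → h (toℕ<n j))
    (*-congʳ (*-identityˡ _))

  private
    toℕ-punchIn-last : ∀ {n} (s : Fin n) → toℕ (punchIn (fromℕ n) s) ≡ toℕ s
    toℕ-punchIn-last zero    = ≡.refl
    toℕ-punchIn-last (suc s) = ≡.cong suc (toℕ-punchIn-last s)

    last-minor : ∀ n (A : Matrixℕ) →
      (- 1#) ^ toℕ (fromℕ n) * A 0 (toℕ (fromℕ n))
          * det n (λ r s → A (suc (toℕ r)) (toℕ (punchIn (fromℕ n) s)))
      ≈ (- 1#) ^ n * A 0 n * Det n (λ i j → A (suc i) j)
    last-minor n A = *-cong
      (reflexive (≡.cong (λ k → (- 1#) ^ k * A 0 k) (toℕ-fromℕ n)))
      (det-cong n λ r s → reflexive (≡.cong (A (suc (toℕ r))) (toℕ-punchIn-last s)))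

  Det-last-column : ∀ n (A : Matrixℕ) → (∀ {i} → i ℕ.< n → A (suc i) n ≈ 0#) →
                    Det (suc n) A ≈ (- 1#) ^ n * A 0 n * Det n (λ i j → A (suc i) j)
  Det-last-column n A h = trans
    (det-expand-column n (λ i j → A (toℕ i) (toℕ j)) (fromℕ n) λ i →
      trans (reflexive (≡.cong (A (suc (toℕ i))) (toℕ-fromℕ n))) (h (toℕ<n i)))
    (last-minor n A)

  Det-last-entry : ∀ n (A : Matrixℕ) → (∀ {j} → j ℕ.< n → A 0 j ≈ 0#) →
                   Det (suc n) A ≈ (- 1#) ^ n * A 0 n * Det n (λ i j → A (suc i) j)
  Det-last-entry n A h = trans
    (det-expand-row n (λ i j → A (toℕ i) (toℕ j)) (fromℕ n) λ j j≢n → h (ℕ.≤∧≢⇒< (ℕ.s≤s⁻¹ (toℕ<n j))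
      λ toℕj≡n → j≢n (toℕ-injective (≡.trans toℕj≡n (≡.sym (toℕ-fromℕ n))))))
    (last-minor n A)

  Det-lower : ∀ n (A : Matrixℕ) → (∀ {i j} → i ℕ.< j → A i j ≈ 0#) → Det n A ≈ ∏ n (λ i → A i i)
  Det-lower zero    A h = refl
  Det-lower (suc n) A h = trans (Det-first-row n A (λ _ → h z<s))
      (*-congˡ (Det-lower n (λ i j → A (suc i) (suc j)) (h ∘ s<s)))

  Det-upper : ∀ n (A : Matrixℕ) → (∀ {i j} → j ℕ.< i → A i j ≈ 0#) → Det n A ≈ ∏ n (λ i → A i i)
  Det-upper zero    A h = refl
  Det-upper (suc n) A h = trans (Det-first-column n A (λ _ → h z<s))
      (*-congˡ (Det-upper n (λ i j → A (suc i) (suc j)) (h ∘ s<s)))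

  private
    punch : ℕ → ℕ → ℕ
    punch zero    s       = suc s
    punch (suc j) zero    = zero
    punch (suc j) (suc s) = suc (punch j s)

    toℕ-punchIn : ∀ {n} (j : Fin (suc n)) s → toℕ (punchIn j s) ≡ punch (toℕ j) (toℕ s)
    toℕ-punchIn zero    s       = ≡.refl
    toℕ-punchIn (suc j) zero    = ≡.refl
    toℕ-punchIn (suc j) (suc s) = ≡.cong suc (toℕ-punchIn j s)

    punch-≤ : ∀ {j s} → j ℕ.≤ s → punch j s ≡ suc s
    punch-≤ z≤n       = ≡.refl
    punch-≤ (s≤s j≤s) = ≡.cong suc (punch-≤ j≤s)

    zero-middle : ∀ x z {y} → y ≈ 0# → x * y * z ≈ 0#
    zero-middle x z y≈0 = trans (*-congʳ (trans (*-congˡ y≈0) (zeroʳ x))) (zeroˡ z)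

    Det-expand : ∀ n (A : Matrixℕ) →
      Det (suc n) A ≈ ∑ (suc n) (λ j → (- 1#) ^ j * A 0 j * Det n (λ r s → A (suc r) (punch j s)))
    Det-expand n A = sum-cong {suc n}
      (cofactor (λ i j → A (toℕ i) (toℕ j)))
      (λ j → (- 1#) ^ toℕ j * A 0 (toℕ j) * Det n (λ r s → A (suc r) (punch (toℕ j) s)))
      λ j → *-congˡ (det-cong n λ r s → reflexive (≡.cong (A (suc (toℕ r))) (toℕ-punchIn j s)))

  -- Expand along row 0, which meets only the left block. Deleting one of those columns moves the
  -- last n columns by one place and nothing else, so the zero block and the lower right block
  -- persist for the induction.
  Det-block : ∀ m n (A : Matrixℕ) → (∀ {i j} → i ℕ.< m → j ℕ.< n → A i (m ℕ.+ j) ≈ 0#) →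
              Det (m ℕ.+ n) A ≈ Det m A * Det n (λ i j → A (m ℕ.+ i) (m ℕ.+ j))
  Det-block zero    n A h = sym (*-identityˡ _)
  Det-block (suc m) n A h = begin
    Det (suc (m ℕ.+ n)) A
      ≈⟨ Det-expand (m ℕ.+ n) A ⟩
    ∑ (suc m ℕ.+ n) f
      ≈⟨ ∑-+ (suc m) n f ⟩
    ∑ (suc m) f + ∑ n (λ i → f (suc m ℕ.+ i))
      ≈⟨ +-cong (∑-cong (suc m) (λ {j} → ih j))
          (∑-zero n λ {j} j<n → zero-middle ((- 1#) ^ (suc m ℕ.+ j))
          (Det (m ℕ.+ n) (λ r s → A (suc r) (punch (suc m ℕ.+ j) s))) (h z<s j<n)) ⟩
    ∑ (suc m) (λ j → g j * D) + 0#
      ≈⟨ +-identityʳ _ ⟩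
    ∑ (suc m) (λ j → g j * D)
      ≈⟨ *-distribʳ-sum {suc m} D (g ∘ toℕ) ⟨
    ∑ (suc m) g * D
      ≈⟨ *-congʳ (Det-expand m A) ⟨
    Det (suc m) A * D ∎
    where
    D : Carrier
    D = Det n (λ i j → A (suc m ℕ.+ i) (suc m ℕ.+ j))
    f g : ℕ → Carrier
    f j = (- 1#) ^ j * A 0 j * Det (m ℕ.+ n) (λ r s → A (suc r) (punch j s))
    g j = (- 1#) ^ j * A 0 j * Det m (λ r s → A (suc r) (punch j s))
    ih : ∀ j → j ℕ.< suc m → f j ≈ g j * D
    ih j (s≤s j≤m) = begin
      (- 1#) ^ j * A 0 j * Det (m ℕ.+ n) (λ r s → A (suc r) (punch j s))
        ≈⟨ *-congˡ (Det-block m n (λ r s → A (suc r) (punch j s)) λ {i} {k} i<m k<n →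
             trans (reflexive (≡.cong (A (suc i)) (beyond k))) (h (s<s i<m) k<n)) ⟩
      (- 1#) ^ j * A 0 j * (Det m (λ r s → A (suc r) (punch j s))
          * Det n (λ i k → A (suc m ℕ.+ i) (punch j (m ℕ.+ k))))
        ≈⟨ *-assoc _ _ _ ⟨
      g j * Det n (λ i k → A (suc m ℕ.+ i) (punch j (m ℕ.+ k)))
        ≈⟨ *-congˡ (Det-cong n λ {i} {k} _ _ → reflexive (≡.cong (A (suc m ℕ.+ i)) (beyond k))) ⟩
      g j * D ∎
      where
      beyond : ∀ k → punch j (m ℕ.+ k) ≡ suc m ℕ.+ k
      beyond k = punch-≤ (ℕ.≤-trans j≤m (ℕ.m≤m+n m k))

-- The ring of formal power series and determinants of their coefficients

module Series {c ℓ} (K : Field c ℓ) where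

  open FieldDefs K
  open Determinant K
  open SetoidReasoning setoid
  open IntegerSolver commutativeRing

  Series : Set c
  Series = ℕ → Carrier

  -- A record, so that f and g can be inferred from f ≋ g.
  infix 4 _≋_
  record _≋_ (f g : Series) : Set ℓ where
    constructor coefficientwise
    field
      at : ∀ n → f n ≈ g n
  open _≋_ public

  infix 4 _≐_
  _≐_ : Series → Series → Set ℓ
  f ≐ g = ∀ n → f n ≈ g n

  tail : Series → Series
  tail f = f ∘ suc

  infixl 6 _⊕_
  _⊕_ : Series → Series → Series
  (f ⊕ g) n = f n + g n

  infixl 7 _⊛_
  -- The Cauchy product, by recursion on the first factor: no indices are subtracted, and the ring
  -- laws follow by induction on the degree.
  _⊛_ : Series → Series → Series
  (f ⊛ g) zero    = f 0 * g 0
  (f ⊛ g) (suc n) = f 0 * g (suc n) + (tail f ⊛ g) n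

  constant : Carrier → Series
  constant a zero    = a
  constant a (suc n) = 0#

  ⊛-cong : ∀ {f f′ g g′} → f ≐ f′ → g ≐ g′ → f ⊛ g ≐ f′ ⊛ g′
  ⊛-cong h k zero    = *-cong (h 0) (k 0)
  ⊛-cong h k (suc n) = +-cong (*-cong (h 0) (k (suc n))) (⊛-cong (h ∘ suc) k n)

  ⊛-distribˡ : ∀ f g h → f ⊛ (g ⊕ h) ≐ (f ⊛ g) ⊕ (f ⊛ h)
  ⊛-distribˡ f g h zero    = distribˡ _ _ _
  ⊛-distribˡ f g h (suc n) = trans (+-cong (distribˡ _ _ _) (⊛-distribˡ (tail f) g h n))
    (solve 4 (λ a b c d → a :+ b :+ (c :+ d) := a :+ c :+ (b :+ d)) refl _ _ _ _)

  ⊛-distribʳ : ∀ h f g → (f ⊕ g) ⊛ h ≐ (f ⊛ h) ⊕ (g ⊛ h)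
  ⊛-distribʳ h f g zero    = distribʳ _ _ _
  ⊛-distribʳ h f g (suc n) = trans (+-cong (distribʳ _ _ _) (⊛-distribʳ h (tail f) (tail g) n))
    (solve 4 (λ a b c d → a :+ b :+ (c :+ d) := a :+ c :+ (b :+ d)) refl _ _ _ _)

  ⊛-scale : ∀ a f g → (λ n → a * f n) ⊛ g ≐ (λ n → a * (f ⊛ g) n)
  ⊛-scale a f g zero    = *-assoc _ _ _
  ⊛-scale a f g (suc n) = trans (+-cong (*-assoc _ _ _) (⊛-scale a (tail f) g n)) (sym (distribˡ _ _ _))

  ⊛-assoc : ∀ f g h → (f ⊛ g) ⊛ h ≐ f ⊛ (g ⊛ h)
  ⊛-assoc f g h zero    = *-assoc _ _ _
  ⊛-assoc f g h (suc n) = begin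
    f 0 * g 0 * h (suc n) + (((λ k → f 0 * tail g k) ⊕ (tail f ⊛ g)) ⊛ h) n
      ≈⟨ +-congˡ (⊛-distribʳ h (λ k → f 0 * tail g k) (tail f ⊛ g) n) ⟩
    f 0 * g 0 * h (suc n) + (((λ k → f 0 * tail g k) ⊛ h) n + ((tail f ⊛ g) ⊛ h) n)
      ≈⟨ +-congˡ (+-cong (⊛-scale (f 0) (tail g) h n) (⊛-assoc (tail f) g h n)) ⟩
    f 0 * g 0 * h (suc n) + (f 0 * (tail g ⊛ h) n + (tail f ⊛ (g ⊛ h)) n)
      ≈⟨ solve 5 (λ a b c d e → a :* b :* c :+ (a :* d :+ e) := a :* (b :* c :+ d) :+ e) refl
           (f 0) (g 0) (h (suc n)) ((tail g ⊛ h) n) ((tail f ⊛ (g ⊛ h)) n) ⟩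
    f 0 * (g ⊛ h) (suc n) + (tail f ⊛ (g ⊛ h)) n ∎

  ⊛-suc : ∀ f g n → (f ⊛ g) (suc n) ≈ (f ⊛ tail g) n + f (suc n) * g 0
  ⊛-suc f g zero    = refl
  ⊛-suc f g (suc n) = trans (+-congˡ (⊛-suc (tail f) g n)) (sym (+-assoc _ _ _))

  ⊛-comm : ∀ f g → f ⊛ g ≐ g ⊛ f
  ⊛-comm f g zero    = *-comm _ _
  ⊛-comm f g (suc n) = begin
    f 0 * g (suc n) + (tail f ⊛ g) n   ≈⟨ +-cong (*-comm _ _) (⊛-comm (tail f) g n) ⟩
    g (suc n) * f 0 + (g ⊛ tail f) n   ≈⟨ +-comm _ _ ⟩
    (g ⊛ tail f) n + g (suc n) * f 0   ≈⟨ ⊛-suc g f n ⟨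
    (g ⊛ f) (suc n)                    ∎

  0⊛ : ∀ {f} → (∀ n → f n ≈ 0#) → ∀ g n → (f ⊛ g) n ≈ 0#
  0⊛ h g zero    = trans (*-congʳ (h 0)) (zeroˡ _)
  0⊛ h g (suc n) = trans (+-cong (trans (*-congʳ (h 0)) (zeroˡ _)) (0⊛ (h ∘ suc) g n)) (+-identityʳ _)

  constant-⊛ : ∀ a f → constant a ⊛ f ≐ (λ n → a * f n)
  constant-⊛ a f zero    = refl
  constant-⊛ a f (suc n) = trans (+-congˡ (0⊛ (λ _ → refl) f n)) (+-identityʳ _)

  ⊛-identityˡ : ∀ f → constant 1# ⊛ f ≐ f
  ⊛-identityˡ f n = trans (constant-⊛ 1# f n) (*-identityˡ _)

  seriesRing : CommutativeRing c ℓ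
  seriesRing = record
    { Carrier = Series
    ; _≈_ = _≋_
    ; _+_ = _⊕_
    ; _*_ = _⊛_
    ; -_ = λ f n → - f n
    ; 0# = λ _ → 0#
    ; 1# = constant 1#
    ; isCommutativeRing = record
      { isRing = record
        { +-isAbelianGroup = record
          { isGroup = record
            { isMonoid = record
              { isSemigroup = record
                { isMagma = record
                  { isEquivalence = record
                    { refl  = coefficientwise λ n → refl
                    ; sym   = λ h → coefficientwise λ n → sym (at h n)
                    ; trans = λ h k → coefficientwise λ n → trans (at h n) (at k n)
                    }
                  ; ∙-cong = λ h k → coefficientwise λ n → +-cong (at h n) (at k n)
                  }
                ; assoc = λ f g h → coefficientwise λ n → +-assoc (f n) (g n) (h n)
                }
              ; identity = (λ f → coefficientwise λ n → +-identityˡ (f n)) , (λ f → coefficientwise λ n →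
                  +-identityʳ (f n))
              }
            ; inverse = (λ f → coefficientwise λ n → -‿inverseˡ (f n)) , (λ f → coefficientwise λ n →
                -‿inverseʳ (f n))
            ; ⁻¹-cong = λ h → coefficientwise λ n → -‿cong (at h n)
            }
          ; comm = λ f g → coefficientwise λ n → +-comm (f n) (g n)
          }
        ; *-cong = λ h k → coefficientwise (⊛-cong (at h) (at k))
        ; *-assoc = λ f g h → coefficientwise (⊛-assoc f g h)
        ; *-identity = (λ f → coefficientwise (⊛-identityˡ f))
                     , (λ f → coefficientwise λ n → trans (⊛-comm f (constant 1#) n) (⊛-identityˡ f n))
        ; distrib = (λ f g h → coefficientwise (⊛-distribˡ f g h)) , (λ h f g →
            coefficientwise (⊛-distribʳ h f g))
        }
      ; *-comm = λ f g → coefficientwise (⊛-comm f g)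
      }
    }

  -- The Euler operator t d/dt. Unlike d/dt it leaves every coefficient in its place, so that its
  -- effect on a matrix of coefficients is a mere scaling of columns.
  θ : Series → Series
  θ f n = ↑ n * f n

  θ-⊛ : ∀ f g → θ (f ⊛ g) ≐ (θ f ⊛ g) ⊕ (f ⊛ θ g)
  θ-⊛ f g zero    = solve 2 (λ a b → κ 0 :* (a :* b) := κ 0 :* a :* b :+ a :* (κ 0 :* b)) refl (f 0) (g 0)
  θ-⊛ f g (suc n) = begin
    (1# + ↑ n) * (f 0 * g (suc n) + (tail f ⊛ g) n)
      ≈⟨ solve 4 (λ m a b p → (κ 1 :+ m) :* (a :* b :+ p) := a :* ((κ 1 :+ m) :* b) :+ (p :+ m :* p)) refl
           (↑ n) (f 0) (g (suc n)) ((tail f ⊛ g) n) ⟩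
    f 0 * θ g (suc n) + ((tail f ⊛ g) n + ↑ n * (tail f ⊛ g) n)
      ≈⟨ +-congˡ (+-congˡ (θ-⊛ (tail f) g n)) ⟩
    f 0 * θ g (suc n) + ((tail f ⊛ g) n + ((θ (tail f) ⊛ g) n + (tail f ⊛ θ g) n))
      ≈⟨ +-congˡ (+-assoc _ _ _) ⟨
    f 0 * θ g (suc n) + ((tail f ⊛ g) n + (θ (tail f) ⊛ g) n + (tail f ⊛ θ g) n)
      ≈⟨ +-congˡ (+-congʳ (⊛-distribʳ g (tail f) (θ (tail f)) n)) ⟨
    f 0 * θ g (suc n) + (((tail f ⊕ θ (tail f)) ⊛ g) n + (tail f ⊛ θ g) n)
      ≈⟨ +-congˡ (+-congʳ (⊛-cong (λ k → solve 2 (λ m a → a :+ m :* a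
          := (κ 1 :+ m) :* a) refl (↑ k) (f (suc k))) (λ _ → refl) n)) ⟩
    f 0 * θ g (suc n) + ((tail (θ f) ⊛ g) n + (tail f ⊛ θ g) n)
      ≈⟨ solve 5 (λ a b p q z → b :+ (p :+ q) := κ 0 :* a :* z :+ p :+ (b :+ q)) refl
           (f 0) (f 0 * θ g (suc n)) ((tail (θ f) ⊛ g) n) ((tail f ⊛ θ g) n) (g (suc n)) ⟩
    (θ f ⊛ g) (suc n) + (f ⊛ θ g) (suc n) ∎

  ⊛-low : ∀ n f g → (∀ {i} → i ℕ.< n → g i ≈ 0#) → (f ⊛ g) n ≈ f 0 * g n
  ⊛-low zero    f g h = refl
  ⊛-low (suc n) f g h = begin
    f 0 * g (suc n) + (tail f ⊛ g) n  ≈⟨ +-congˡ (⊛-low n (tail f) g (λ i<n → h (ℕ.m<n⇒m<1+n i<n))) ⟩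
    f 0 * g (suc n) + f 1 * g n       ≈⟨ +-congˡ (trans (*-congˡ (h ℕ.≤-refl)) (zeroʳ _)) ⟩
    f 0 * g (suc n) + 0#              ≈⟨ +-identityʳ _ ⟩
    f 0 * g (suc n)                   ∎

  ⊛-∑ : ∀ n f g → (f ⊛ g) n ≈ ∑ (suc n) (λ i → f i * g (n ∸ i))
  ⊛-∑ zero    f g = sym (+-identityʳ _)
  ⊛-∑ (suc n) f g = +-congˡ (⊛-∑ n (tail f) g)

  -- Row k holds the coefficients of t^k f: the upper triangular Toeplitz matrix of multiplication
  -- by f.
  shift : Series → ℕ → Series
  shift f zero    j       = f j
  shift f (suc k) zero    = 0#
  shift f (suc k) (suc j) = shift f k j

  shift-lower : ∀ f {i j} → j ℕ.< i → shift f i j ≈ 0#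
  shift-lower f {suc i} {zero}  _         = refl
  shift-lower f {suc i} {suc j} (s≤s j<i) = shift-lower f j<i

  shift-diagonal : ∀ f i → shift f i i ≈ f 0
  shift-diagonal f zero    = refl
  shift-diagonal f (suc i) = shift-diagonal f i

  ⊛-shift : ∀ n f g {j} → j ℕ.< n → (f ⊛ g) j ≈ ∑ n (λ k → f k * shift g k j)
  ⊛-shift (suc n) f g {zero} _ = sym (trans
      (+-congˡ (∑-zero n {λ k → f (suc k) * 0#} λ {i} _ → zeroʳ (f (suc i)))) (+-identityʳ _))
  ⊛-shift (suc n) f g {suc j} (s≤s j<n) = +-congˡ (⊛-shift n (tail f) g j<n)

  -- Multiplying every row by f is multiplication from the right by a triangular matrix with `f 0`
  -- on its diagonal.
  Det-⊛ : ∀ n (h : ℕ → Series) f → f 0 ≈ 1# → Det n (λ i → h i ⊛ f) ≈ Det n h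
  Det-⊛ n h f f0 = begin
    Det n (λ i → h i ⊛ f)                             ≈⟨ Det-cong n (λ {i} _ → ⊛-shift n (h i) f) ⟩
    Det n (λ i j → ∑ n (λ k → h i k * shift f k j))   ≈⟨ Det-· n h (shift f) ⟩
    Det n h * Det n (shift f)
      ≈⟨ *-congˡ (trans (Det-upper n (shift f) (shift-lower f))
          (∏-1 n λ {i} _ → trans (shift-diagonal f i) f0)) ⟩
    Det n h * 1#                                      ≈⟨ *-identityʳ _ ⟩
    Det n h                                           ∎

  -- Even and odd parts of series

  even-part : Series → Series
  even-part f zero    = f 0
  even-part f (suc j) = even-part (tail (tail f)) j

  odd-part : Series → Series
  odd-part f = even-part (tail f)

  even-part-cong : ∀ {f g} → f ≐ g → even-part f ≐ even-part g
  even-part-cong h zero    = h 0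
  even-part-cong h (suc j) = even-part-cong (λ n → h (suc (suc n))) j

  even-part-at : ∀ f j → even-part f j ≈ f (2 ℕ.* j)
  even-part-at f zero    = refl
  even-part-at f (suc j) = trans (even-part-at (tail (tail f)) j)
      (reflexive (≡.cong f (≡.sym (ℕ.*-suc 2 j))))

  even-part-+ : ∀ f g → even-part (f ⊕ g) ≐ even-part f ⊕ even-part g
  even-part-+ f g zero    = refl
  even-part-+ f g (suc j) = even-part-+ (tail (tail f)) (tail (tail g)) j

  even-part-scale : ∀ a f → even-part (λ n → a * f n) ≐ (λ n → a * even-part f n)
  even-part-scale a f zero    = refl
  even-part-scale a f (suc j) = even-part-scale a (tail (tail f)) j

  -- Writing f as f₀(t²) + t f₁(t²) and g likewise, the product of the two odd halves carries an
  -- extra t², whence j next to `suc j`.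
  even-part-⊛ : ∀ f g j → even-part (f ⊛ g) (suc j)
      ≈ (even-part f ⊛ even-part g) (suc j) + (odd-part f ⊛ odd-part g) j
  even-part-⊛ f g j = begin
    even-part (λ n → f 0 * g (suc (suc n)) + (f 1 * g (suc n) + (tail (tail f) ⊛ g) n)) j
      ≈⟨ even-part-+ (λ n → f 0 * g (suc (suc n))) (λ n → f 1 * g (suc n) + (tail (tail f) ⊛ g) n) j ⟩
    even-part (λ n → f 0 * g (suc (suc n))) j + even-part (λ n → f 1 * g (suc n) + (tail (tail f) ⊛ g) n) j
      ≈⟨ +-cong (even-part-scale (f 0) (tail (tail g)) j)
           (trans (even-part-+ (λ n → f 1 * g (suc n)) (tail (tail f) ⊛ g) j)
               (+-congʳ (even-part-scale (f 1) (tail g) j))) ⟩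
    f 0 * even-part g (suc j) + (f 1 * odd-part g j + even-part (tail (tail f) ⊛ g) j)
      ≈⟨ rest j ⟩
    (even-part f ⊛ even-part g) (suc j) + (odd-part f ⊛ odd-part g) j ∎
    where
    rest : ∀ j → f 0 * even-part g (suc j) + (f 1 * odd-part g j + even-part (tail (tail f) ⊛ g) j)
               ≈ (even-part f ⊛ even-part g) (suc j) + (odd-part f ⊛ odd-part g) j
    rest zero    = solve 3 (λ a b d → a :+ (b :+ d) := a :+ d :+ b) refl _ _ _
    rest (suc j) = trans
      (+-congˡ (+-congˡ (even-part-⊛ (tail (tail f)) g j)))
      (solve 4 (λ a b d e → a :+ (b :+ (d :+ e)) := a :+ d :+ (b :+ e)) refl _ _ _ _)

  odd-part-⊛ : ∀ f g j → odd-part (f ⊛ g) j ≈ (even-part f ⊛ odd-part g) j + (odd-part f ⊛ even-part g) j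
  odd-part-⊛ f g j = begin
    even-part (λ n → f 0 * g (suc n) + (tail f ⊛ g) n) j
      ≈⟨ even-part-+ (λ n → f 0 * g (suc n)) (tail f ⊛ g) j ⟩
    even-part (λ n → f 0 * g (suc n)) j + even-part (tail f ⊛ g) j
      ≈⟨ +-congʳ (even-part-scale (f 0) (tail g) j) ⟩
    f 0 * odd-part g j + even-part (tail f ⊛ g) j
      ≈⟨ rest j ⟩
    (even-part f ⊛ odd-part g) j + (odd-part f ⊛ even-part g) j ∎
    where
    rest : ∀ j → f 0 * odd-part g j + even-part (tail f ⊛ g) j
        ≈ (even-part f ⊛ odd-part g) j + (odd-part f ⊛ even-part g) j
    rest zero    = refl
    rest (suc j) = trans (+-congˡ (even-part-⊛ (tail f) g j))
      (solve 3 (λ a b d → a :+ (b :+ d) := a :+ d :+ b) refl _ _ _)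

  IsEven : Series → Set ℓ
  IsEven f = ∀ j → odd-part f j ≈ 0#

  even-⊛ : ∀ {f g} → IsEven f → IsEven g → IsEven (f ⊛ g)
  even-⊛ {f} {g} f-even g-even j = begin
    odd-part (f ⊛ g) j                                           ≈⟨ odd-part-⊛ f g j ⟩
    (even-part f ⊛ odd-part g) j + (odd-part f ⊛ even-part g) j
      ≈⟨ +-cong (trans (⊛-comm (even-part f) (odd-part g) j) (0⊛ g-even (even-part f) j))
          (0⊛ f-even (even-part g) j) ⟩
    0# + 0#                                                      ≈⟨ +-identityʳ _ ⟩
    0#                                                           ∎

  odd-part-⊛-even : ∀ f {g} → IsEven g → odd-part (f ⊛ g) ≐ odd-part f ⊛ even-part g
  odd-part-⊛-even f {g} g-even j = begin
    odd-part (f ⊛ g) j                                           ≈⟨ odd-part-⊛ f g j ⟩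
    (even-part f ⊛ odd-part g) j + (odd-part f ⊛ even-part g) j
      ≈⟨ +-congʳ (trans (⊛-comm (even-part f) (odd-part g) j) (0⊛ g-even (even-part f) j)) ⟩
    0# + (odd-part f ⊛ even-part g) j                            ≈⟨ +-identityˡ _ ⟩
    (odd-part f ⊛ even-part g) j                                 ∎

  even-part-⊛-even : ∀ f {g} → IsEven g → even-part (f ⊛ g) ≐ even-part f ⊛ even-part g
  even-part-⊛-even f {g} g-even zero    = refl
  even-part-⊛-even f {g} g-even (suc j) = begin
    even-part (f ⊛ g) (suc j)                                              ≈⟨ even-part-⊛ f g j ⟩
    (even-part f ⊛ even-part g) (suc j) + (odd-part f ⊛ odd-part g) j
      ≈⟨ +-congˡ (trans (⊛-comm (odd-part f) (odd-part g) j) (0⊛ g-even (odd-part f) j)) ⟩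
    (even-part f ⊛ even-part g) (suc j) + 0#                               ≈⟨ +-identityʳ _ ⟩
    (even-part f ⊛ even-part g) (suc j)                                    ∎

  -- This is the freedom used throughout: even factors with constant term 1, such as powers of 1 +
  -- t², can be inserted or removed at will.
  Det-even-part-⊛ : ∀ n (h : ℕ → Series) {f} → IsEven f → f 0 ≈ 1# →
                    Det n (λ i → even-part (h i ⊛ f)) ≈ Det n (λ i → even-part (h i))
  Det-even-part-⊛ n h {f} f-even f0 = trans
    (Det-cong n {λ i → even-part (h i ⊛ f)} {λ i → even-part (h i) ⊛ even-part f} λ {i} {j} _ _ →
        even-part-⊛-even (h i) {f} f-even j)
    (Det-⊛ n (λ i → even-part (h i)) (even-part f) f0)

  Det-odd-part-⊛ : ∀ n (h : ℕ → Series) {f} → IsEven f → f 0 ≈ 1# →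
                   Det n (λ i → odd-part (h i ⊛ f)) ≈ Det n (λ i → odd-part (h i))
  Det-odd-part-⊛ n h {f} f-even f0 = trans
    (Det-cong n {λ i → odd-part (h i ⊛ f)} {λ i → odd-part (h i) ⊛ even-part f} λ {i} {j} _ _ →
        odd-part-⊛-even (h i) {f} f-even j)
    (Det-⊛ n (λ i → odd-part (h i)) (even-part f) f0)

  -- Special determinants: bidiagonal, antidiagonal and interleaved matrices

  bidiagonal : (a b : ℕ → Carrier) → Matrixℕ
  bidiagonal a b zero          zero    = a 0
  bidiagonal a b zero          (suc j) = 0#
  bidiagonal a b (suc zero)    zero    = b 0
  bidiagonal a b (suc (suc i)) zero    = 0#
  bidiagonal a b (suc i)       (suc j) = bidiagonal (a ∘ suc) (b ∘ suc) i j

  bidiagonal-diagonal : ∀ a b i → bidiagonal a b i i ≡ a i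
  bidiagonal-diagonal a b zero          = ≡.refl
  bidiagonal-diagonal a b (suc zero)    = ≡.refl
  bidiagonal-diagonal a b (suc (suc i)) = bidiagonal-diagonal (a ∘ suc) (b ∘ suc) (suc i)

  bidiagonal-above : ∀ a b {i j} → i ℕ.< j → bidiagonal a b i j ≈ 0#
  bidiagonal-above a b {zero}        {suc j} _         = refl
  bidiagonal-above a b {suc zero}    {suc j} (s≤s i<j) = bidiagonal-above (a ∘ suc) (b ∘ suc) i<j
  bidiagonal-above a b {suc (suc i)} {suc j} (s≤s i<j) = bidiagonal-above (a ∘ suc) (b ∘ suc) i<j

  bidiagonal-first : ∀ n a b (h : ℕ → Carrier) → ∑ (suc n) (λ k → bidiagonal a b 0 k * h k) ≈ a 0 * h 0
  bidiagonal-first n a b h = trans (+-congˡ (∑-zero n {λ k → 0# * h (suc k)} λ _ → zeroˡ _)) (+-identityʳ _)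

  bidiagonal-suc : ∀ n a b (h : ℕ → Carrier) i → suc i ℕ.< n → ∑ n (λ k → bidiagonal a b (suc i) k * h k)
      ≈ b i * h i + a (suc i) * h (suc i)
  bidiagonal-suc (suc zero)    a b h zero    (s≤s ())
  bidiagonal-suc (suc (suc n)) a b h zero    _         =
      +-congˡ (bidiagonal-first n (a ∘ suc) (b ∘ suc) (h ∘ suc))
  bidiagonal-suc (suc n)       a b h (suc i) (s≤s i<n) = begin
    0# * h 0 + ∑ n (λ k → bidiagonal (a ∘ suc) (b ∘ suc) (suc i) k * h (suc k))
      ≈⟨ +-cong (zeroˡ _) (bidiagonal-suc n (a ∘ suc) (b ∘ suc) (h ∘ suc) i i<n) ⟩
    0# + (b (suc i) * h (suc i) + a (suc (suc i)) * h (suc (suc i)))             ≈⟨ +-identityˡ _ ⟩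
    b (suc i) * h (suc i) + a (suc (suc i)) * h (suc (suc i))                    ∎

  Det-bidiagonal : ∀ n a b → Det n (bidiagonal a b) ≈ ∏ n a
  Det-bidiagonal n a b = trans (Det-lower n (bidiagonal a b) (bidiagonal-above a b))
    (∏-cong n λ {i} _ → reflexive (bidiagonal-diagonal a b i))

  δ : Matrixℕ
  δ zero    zero    = 1#
  δ zero    (suc j) = 0#
  δ (suc i) zero    = 0#
  δ (suc i) (suc j) = δ i j

  ∑-δ : ∀ n (a : ℕ → Carrier) {j} → j ℕ.< n → ∑ n (λ k → a k * δ k j) ≈ a j
  ∑-δ (suc n) a {zero}  _         = begin
    a 0 * 1# + ∑ n (λ k → a (suc k) * 0#)
      ≈⟨ +-cong (*-identityʳ _) (∑-zero n {λ k → a (suc k) * 0#} λ _ → zeroʳ _) ⟩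
    a 0 + 0#                               ≈⟨ +-identityʳ _ ⟩
    a 0                                    ∎
  ∑-δ (suc n) a {suc j} (s≤s j<n) = trans (+-cong (zeroʳ _) (∑-δ n (a ∘ suc) j<n)) (+-identityˡ _)

  -- A diagonal matrix is `bidiagonal` with zeros below the diagonal, and transposition turns the
  -- columns into rows, on which multiplication from the left acts.
  Det-scale-columns : ∀ n (d : ℕ → Carrier) (A : Matrixℕ) → Det n (λ i j → d j * A i j) ≈ ∏ n d * Det n A
  Det-scale-columns n d A = begin
    Det n (λ i j → d j * A i j)
      ≈⟨ Det-transpose n (λ i j → d i * A j i) ⟩
    Det n (λ i j → d i * A j i)
      ≈⟨ Det-cong n {λ i j → d i * A j i} {λ i j → ∑ n (λ k → bidiagonal d (λ _ → 0#) i k * A j k)}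
          (λ {i} {j} i<n _ → sym (row n i (A j) i<n)) ⟩
    Det n (λ i j → ∑ n (λ k → bidiagonal d (λ _ → 0#) i k * A j k))
      ≈⟨ Det-· n (bidiagonal d (λ _ → 0#)) (λ k j → A j k) ⟩
    Det n (bidiagonal d (λ _ → 0#)) * Det n (λ k j → A j k)
      ≈⟨ *-cong (Det-bidiagonal n d (λ _ → 0#)) (Det-transpose n A) ⟩
    ∏ n d * Det n A ∎
    where
    row : ∀ n i (h : ℕ → Carrier) → i ℕ.< n → ∑ n (λ k → bidiagonal d (λ _ → 0#) i k * h k) ≈ d i * h i
    row (suc n) zero    h _   = bidiagonal-first n d (λ _ → 0#) h
    row n       (suc i) h i<n = trans (bidiagonal-suc n d (λ _ → 0#) h i i<n)
        (trans (+-congʳ (zeroˡ _)) (+-identityˡ _))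

  blend : ℕ → (f g : ℕ → Carrier) → ℕ → Carrier
  blend zero    f g j       = g j
  blend (suc n) f g zero    = f 0
  blend (suc n) f g (suc j) = blend n (f ∘ suc) g j

  blend-< : ∀ n f g {j} → j ℕ.< n → blend n f g j ≡ f j
  blend-< (suc n) f g {zero}  _         = ≡.refl
  blend-< (suc n) f g {suc j} (s≤s j<n) = blend-< n (f ∘ suc) g j<n

  blend-+ : ∀ n f g j → blend n f g (n ℕ.+ j) ≡ g j
  blend-+ zero    f g j = ≡.refl
  blend-+ (suc n) f g j = blend-+ n (f ∘ suc) g j

  blend-cong : ∀ m n {f f′ g g′} → (∀ {j} → j ℕ.< m → f j ≈ f′ j) → (∀ {j} → j ℕ.< n → g j ≈ g′ j) →
               ∀ {j} → j ℕ.< m ℕ.+ n → blend m f g j ≈ blend m f′ g′ j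
  blend-cong zero    n h k j<n                     = k j<n
  blend-cong (suc m) n h k {zero}  _               = h z<s
  blend-cong (suc m) n h k {suc j} (s≤s j<m+n)     = blend-cong m n (h ∘ s<s) k j<m+n

  blend-sum : ∀ m n (f g f′ g′ : ℕ → Carrier) →
              ∑ (m ℕ.+ n) (λ q → blend m f g q * blend m f′ g′ q)
                  ≈ ∑ m (λ j → f j * f′ j) + ∑ n (λ j → g j * g′ j)
  blend-sum m n f g f′ g′ = trans (∑-+ m n (λ q → blend m f g q * blend m f′ g′ q)) (+-cong
    (∑-cong m {λ q → blend m f g q * blend m f′ g′ q} {λ j → f j * f′ j} λ j<m →
      *-cong (reflexive (blend-< m f g j<m)) (reflexive (blend-< m f′ g′ j<m)))
    (∑-cong n {λ j → blend m f g (m ℕ.+ j) * blend m f′ g′ (m ℕ.+ j)} {λ j → g j * g′ j} λ {j} _ →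
      *-cong (reflexive (blend-+ m f g j)) (reflexive (blend-+ m f′ g′ j))))

  -- This is (-1)^(n(n - 1)/2), the sign of the permutation that reverses n columns.
  sign : ℕ → Carrier
  sign zero    = 1#
  sign (suc n) = (- 1#) ^ n * sign n

  Det-antidiagonal : ∀ n (A : Matrixℕ) → (∀ {i j} → i ℕ.< n → j ℕ.< n → suc (i ℕ.+ j) ≢ n → A i j ≈ 0#) →
                     (∀ {i j} → suc (i ℕ.+ j) ≡ n → A i j ≈ 1#) → Det n A ≈ sign n
  Det-antidiagonal zero    A h0 h1 = refl
  Det-antidiagonal (suc n) A h0 h1 = begin
    Det (suc n) A
      ≈⟨ Det-last-entry n A (λ j<n → h0 z<s (ℕ.m<n⇒m<1+n j<n) (ℕ.<⇒≢ j<n ∘ ℕ.suc-injective)) ⟩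
    (- 1#) ^ n * A 0 n * Det n (λ i j → A (suc i) j)
      ≈⟨ *-cong (trans (*-congˡ (h1 ≡.refl)) (*-identityʳ _))
           (Det-antidiagonal n (λ i j → A (suc i) j)
             (λ i<n j<n i+j≢n → h0 (s<s i<n) (ℕ.m<n⇒m<1+n j<n) (i+j≢n ∘ ℕ.suc-injective))
             (λ i+j≡n → h1 (≡.cong suc i+j≡n))) ⟩
    (- 1#) ^ n * sign n ∎

  Det-unit-columns : ∀ m n (A : Matrixℕ) → (∀ i {j} → j ℕ.< m → A i j ≈ δ i j) →
                     Det (m ℕ.+ n) A ≈ Det n (λ i j → A (m ℕ.+ i) (m ℕ.+ j))
  Det-unit-columns zero    n A h = refl
  Det-unit-columns (suc m) n A h = begin
    Det (suc m ℕ.+ n) A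
      ≈⟨ Det-first-column (m ℕ.+ n) A (λ {i} _ → h (suc i) z<s) ⟩
    A 0 0 * Det (m ℕ.+ n) (λ i j → A (suc i) (suc j))
      ≈⟨ *-cong (h 0 z<s) (Det-unit-columns m n (λ i j → A (suc i) (suc j))
          (λ i j<m → h (suc i) (s<s j<m))) ⟩
    1# * Det n (λ i j → A (suc m ℕ.+ i) (suc m ℕ.+ j))
      ≈⟨ *-identityˡ _ ⟩
    Det n (λ i j → A (suc m ℕ.+ i) (suc m ℕ.+ j)) ∎

  -- The coefficients of h k in the order t⁰, t², …, t²ⁿ⁻², t²ⁿ⁻¹, …, t³, t¹;
  -- the permutation is even, whence the determinant of a triangular family is 1.
  even-odd : ℕ → (ℕ → Carrier) → ℕ → Carrier
  even-odd n h = blend n (even-part h) (λ j → odd-part h (n ∸ suc j))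

  Det-even-odd : ∀ n (h : ℕ → ℕ → Carrier) → (∀ {k i} → i ℕ.< k → h k i ≈ 0#) → (∀ k → h k k ≈ 1#) →
                 Det (n ℕ.+ n) (λ k → even-odd n (h k)) ≈ 1#
  Det-even-odd zero    h h0 h1 = refl
  Det-even-odd (suc n) h h0 h1 = begin
    Det (suc n ℕ.+ suc n) (λ k → even-odd (suc n) (h k))
      ≈⟨ Det-first-column (n ℕ.+ suc n) (λ k → even-odd (suc n) (h k)) (λ _ → h0 z<s) ⟩
    h 0 0 * Det (n ℕ.+ suc n) A
      ≈⟨ trans (*-congʳ (h1 0)) (*-identityˡ _) ⟩
    Det (n ℕ.+ suc n) A
      ≡⟨ ≡.cong (λ m → Det m A) (ℕ.+-suc n n) ⟩
    Det (suc (n ℕ.+ n)) A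
      -- The column of t¹ comes last and is nonzero only in the row of `h 1`; the 2n columns before
      -- it make the sign even.
      ≈⟨ Det-last-column (n ℕ.+ n) A (λ {i} _ → trans (last (suc i)) (h0 (s<s z<s))) ⟩
    (- 1#) ^ (n ℕ.+ n) * A 0 (n ℕ.+ n) * Det (n ℕ.+ n) (λ k → A (suc k))
      ≈⟨ trans (*-congʳ (*-cong (even-sign n) (trans (last 0) (h1 1))))
          (trans (*-congʳ (*-identityˡ 1#)) (*-identityˡ _)) ⟩
    Det (n ℕ.+ n) (λ k → A (suc k))
      ≈⟨ Det-cong (n ℕ.+ n) {λ k → A (suc k)} {λ k → even-odd n (h′ k)} (λ {k} _ →
          blend-cong n n (λ _ → refl)
           (λ {j} j<n → reflexive (≡.cong (odd-part (h (suc (suc k)))) (ℕ.+-∸-assoc 1 j<n)))) ⟩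
    Det (n ℕ.+ n) (λ k → even-odd n (h′ k))
      ≈⟨ Det-even-odd n h′ (h0 ∘ s<s ∘ s<s) (λ k → h1 (suc (suc k))) ⟩
    1# ∎
    where
    A : Matrixℕ
    A k j = even-odd (suc n) (h (suc k)) (suc j)
    h′ : ℕ → ℕ → Carrier
    h′ k = tail (tail (h (suc (suc k))))
    last : ∀ k → A k (n ℕ.+ n) ≈ h (suc k) 1
    last k = trans
      (reflexive (blend-+ n (even-part (tail (tail (h (suc k))))) (λ j → odd-part (h (suc k)) (n ∸ j)) n))
      (reflexive (≡.cong (odd-part (h (suc k))) (ℕ.n∸n≡0 n)))
    even-sign : ∀ n → (- 1#) ^ (n ℕ.+ n) ≈ 1#
    even-sign zero    = refl
    even-sign (suc n) = begin
      - 1# * (- 1#) ^ (n ℕ.+ suc n)     ≡⟨ ≡.cong (λ m → - 1# * (- 1#) ^ m) (ℕ.+-suc n n) ⟩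
      - 1# * (- 1# * (- 1#) ^ (n ℕ.+ n))
        ≈⟨ solve 1 (λ x → (:- κ 1) :* ((:- κ 1) :* x) := x) refl ((- 1#) ^ (n ℕ.+ n)) ⟩
      (- 1#) ^ (n ℕ.+ n)                ≈⟨ even-sign n ⟩
      1#                                ∎

-- Powers of 1 - t, of 1 + t² and of s with exponents in the field

module Powers {c ℓ} (K : Field c ℓ) (char0 : CharacteristicZero K) where

  module K where
    open FieldDefs K public
    open SetoidReasoning setoid public
  open IntegerSolver K.commutativeRing using () renaming
    (solve to solveᴷ; κ to κᴷ; _:+_ to _⊞_; _:*_ to _⊠_; _:-_ to _⊟_; :-_ to ⊟_; _:=_ to _⊜_)
  open Determinant K
  open Series K
  open CommutativeRing seriesRing hiding (zero)
  open IntegerSolver seriesRing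
  open SetoidReasoning setoid
  open Exp semiring using (_^_; ^-homo-*; ^-congˡ)
  open CommutativeExp commutativeSemiring using (^-distrib-*)
  open SemiringMult K.semiring using (×1-homo-*)

  ↑≉0 : ∀ n → K.↑ suc n K.* (K.↑ suc n) K.⁻¹ K.≈ K.1#
  ↑≉0 n = K.inverseʳ (char0 n)

  cancel-↑ : ∀ n {a} → K.↑ suc n K.* a K.≈ K.0# → a K.≈ K.0#
  cancel-↑ n {a} h = K.begin
    a                                                 K.≈⟨ K.*-identityˡ a ⟨
    K.1# K.* a                                        K.≈⟨ K.*-congʳ (↑≉0 n) ⟨
    K.↑ suc n K.* (K.↑ suc n) K.⁻¹ K.* a
      K.≈⟨ solveᴷ 3 (λ m i a → m ⊠ i ⊠ a ⊜ i ⊠ (m ⊠ a)) K.refl (K.↑ suc n) ((K.↑ suc n) K.⁻¹) a ⟩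
    (K.↑ suc n) K.⁻¹ K.* (K.↑ suc n K.* a)            K.≈⟨ K.*-congˡ h ⟩
    (K.↑ suc n) K.⁻¹ K.* K.0#                         K.≈⟨ K.zeroʳ _ ⟩
    K.0#                                              K.∎

  -- The variable t.
  X : Series
  X 0             = K.0#
  X 1             = K.1#
  X (suc (suc n)) = K.0#

  X*-suc : ∀ f n → (X * f) (suc n) K.≈ f n
  X*-suc f n = K.begin
      K.0# K.* f (suc n) K.+ (tail X * f) n  K.≈⟨ K.+-cong (K.zeroˡ _) (⊛-cong tail-X (λ _ → K.refl) n) ⟩
      K.0# K.+ (constant K.1# * f) n         K.≈⟨ K.+-identityˡ _ ⟩
      (constant K.1# * f) n                  K.≈⟨ ⊛-identityˡ f n ⟩
      f n                                    K.∎
      where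
      tail-X : tail X ≐ constant K.1#
      tail-X zero    = K.refl
      tail-X (suc n) = K.refl

  X*-cancel : ∀ {f g} → X * f ≈ X * g → f ≈ g
  X*-cancel {f} {g} h = coefficientwise λ n →
      K.trans (K.sym (X*-suc f n)) (K.trans (at h (suc n)) (X*-suc g n))

  θ-+ : ∀ f g → θ (f + g) ≈ θ f + θ g
  θ-+ f g = coefficientwise λ n → K.distribˡ _ _ _

  θ-neg : ∀ f → θ (- f) ≈ - θ f
  θ-neg f = coefficientwise λ n → solveᴷ 2 (λ m a → m ⊠ (⊟ a) ⊜ ⊟ (m ⊠ a)) K.refl (K.↑ n) (f n)

  θ-cong : ∀ {f g} → f ≈ g → θ f ≈ θ g
  θ-cong h = coefficientwise λ n → K.*-congˡ (at h n)

  θ-* : ∀ f g → θ (f * g) ≈ θ f * g + f * θ g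
  θ-* f g = coefficientwise (θ-⊛ f g)

  θ-constant : ∀ a → θ (constant a) ≈ 0#
  θ-constant a = coefficientwise λ where
    zero    → K.zeroˡ _
    (suc n) → K.zeroʳ _

  θX : θ X ≈ X
  θX = coefficientwise λ where
    0             → K.zeroˡ _
    1             → solveᴷ 0 ((κᴷ 1 ⊞ κᴷ 0) ⊠ κᴷ 1 ⊜ κᴷ 1) K.refl
    (suc (suc n)) → K.zeroʳ _

  module _ {p q f g : Series} (p0 : p 0 K.≈ K.1#) (q0 : q 0 K.≈ K.0#)
           (hf : p * θ f ≈ q * f) (hg : p * θ g ≈ q * g) (h0 : f 0 K.≈ g 0) where

    private
      h : Series
      h = f - g

      ode : p * θ h ≈ q * h
      ode = begin
        p * θ (f - g)          ≈⟨ *-congˡ (trans (θ-+ f (- g)) (+-congˡ (θ-neg g))) ⟩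
        p * (θ f - θ g)        ≈⟨ solve 3 (λ p a b → p :* (a :- b) := p :* a :- p :* b) refl p (θ f) (θ g) ⟩
        p * θ f - p * θ g      ≈⟨ +-cong hf (-‿cong hg) ⟩
        q * f - q * g          ≈⟨ solve 3 (λ p a b → p :* a :- p :* b := p :* (a :- b)) refl q f g ⟩
        q * (f - g)            ∎

      vanish-below : ∀ n {i} → i ℕ.< n → h i K.≈ K.0#
      vanish-below (suc n) {i} (s≤s i≤n) with ℕ.m≤n⇒m<n∨m≡n i≤n
      ... | inj₁ i<n = vanish-below n i<n
      vanish-below (suc zero)    _ | inj₂ ≡.refl = K.trans (K.+-congʳ h0) (K.-‿inverseʳ _)
      vanish-below (suc (suc n)) _ | inj₂ ≡.refl = cancel-↑ n (K.begin
        θ h (suc n)               K.≈⟨ K.*-identityˡ _ ⟨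
        K.1# K.* θ h (suc n)      K.≈⟨ K.*-congʳ p0 ⟨
        p 0 K.* θ h (suc n)
          K.≈⟨ ⊛-low (suc n) p (θ h) (λ i<n → K.trans (K.*-congˡ (vanish-below (suc n) i<n)) (K.zeroʳ _)) ⟨
        (p * θ h) (suc n)         K.≈⟨ at ode (suc n) ⟩
        (q * h) (suc n)           K.≈⟨ ⊛-low (suc n) q h (vanish-below (suc n)) ⟩
        q 0 K.* h (suc n)         K.≈⟨ K.*-congʳ q0 ⟩
        K.0# K.* h (suc n)        K.≈⟨ K.zeroˡ _ ⟩
        K.0#                      K.∎)

    -- As soon as the coefficients of the difference h below degree n > 0 vanish, the equation in
    -- degree n reads n h_n = 0, because p starts with 1 and q with 0. The laws for powers are
    -- proved by exhibiting such an equation for both sides.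
    ode-unique : f ≈ g
    ode-unique = coefficientwise λ n → K.begin
      f n                        K.≈⟨ solveᴷ 2 (λ a b → a ⊜ a ⊟ b ⊞ b) K.refl (f n) (g n) ⟩
      f n K.- g n K.+ g n        K.≈⟨ K.+-congʳ (vanish-below (suc n) (ℕ.n<1+n n)) ⟩
      K.0# K.+ g n               K.≈⟨ K.+-identityˡ _ ⟩
      g n                        K.∎

  constant-cong : ∀ {a b} → a K.≈ b → constant a ≈ constant b
  constant-cong h = coefficientwise λ where
    zero    → h
    (suc n) → K.refl

  constant-+ : ∀ a b → constant (a K.+ b) ≈ constant a + constant b
  constant-+ a b = coefficientwise λ where
    zero    → K.refl
    (suc n) → K.sym (K.+-identityˡ _)

  constant-neg : ∀ a → constant (K.- a) ≈ - constant a
  constant-neg a = coefficientwise λ where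
    zero    → K.refl
    (suc n) → solveᴷ 0 (κᴷ 0 ⊜ ⊟ κᴷ 0) K.refl

  -- U α = (1 - t)^(-α)
  U : K.Carrier → Series
  U α zero    = K.1#
  U α (suc n) = U α n K.* (α K.+ K.↑ n) K.* (K.↑ suc n) K.⁻¹

  -- V β = (1 + t²)^β
  V : K.Carrier → Series
  V β zero          = K.1#
  V β (suc zero)    = K.0#
  V β (suc (suc n)) = V β n K.* (β K.+ β K.- K.↑ n) K.* (K.↑ suc (suc n)) K.⁻¹

  -- B = 1 / (1 - t²)
  B : Series
  B zero          = K.1#
  B (suc zero)    = K.0#
  B (suc (suc n)) = B n

  V-even : ∀ β → IsEven (V β)
  V-even β j = K.trans (even-part-at (tail (V β)) j) (odd-coefficient j)
    where
    odd-coefficient : ∀ j → V β (suc (2 ℕ.* j)) K.≈ K.0#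
    odd-coefficient zero = K.refl
    odd-coefficient (suc j) rewrite ℕ.+-suc j (j ℕ.+ 0) =
      K.trans (K.*-congʳ (K.trans (K.*-congʳ (odd-coefficient j)) (K.zeroˡ _))) (K.zeroˡ _)

  B-even : IsEven B
  B-even zero    = K.refl
  B-even (suc j) = B-even j

  private
    ↑-cancel : ∀ n a b → K.↑ suc n K.* (a K.* b K.* (K.↑ suc n) K.⁻¹) K.≈ a K.* b
    ↑-cancel n a b = K.begin
      K.↑ suc n K.* (a K.* b K.* (K.↑ suc n) K.⁻¹)
        K.≈⟨ solveᴷ 4 (λ m i a b → m ⊠ (a ⊠ b ⊠ i) ⊜ a ⊠ b ⊠ (m ⊠ i))
            K.refl (K.↑ suc n) ((K.↑ suc n) K.⁻¹) a b ⟩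
      a K.* b K.* (K.↑ suc n K.* (K.↑ suc n) K.⁻¹)  K.≈⟨ K.*-congˡ (↑≉0 n) ⟩
      a K.* b K.* K.1#                              K.≈⟨ K.*-identityʳ _ ⟩
      a K.* b                                       K.∎

    U-recurrence : ∀ α → θ (U α) ≈ X * (constant α * U α + θ (U α))
    U-recurrence α = coefficientwise λ where
      zero    → K.trans (K.zeroˡ _) (K.sym (K.zeroˡ _))
      (suc n) → K.begin
        K.↑ suc n K.* U α (suc n)                    K.≈⟨ ↑-cancel n (U α n) (α K.+ K.↑ n) ⟩
        U α n K.* (α K.+ K.↑ n)
          K.≈⟨ solveᴷ 3 (λ u a m → u ⊠ (a ⊞ m) ⊜ a ⊠ u ⊞ m ⊠ u) K.refl (U α n) α (K.↑ n) ⟩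
        α K.* U α n K.+ K.↑ n K.* U α n              K.≈⟨ K.+-congʳ (constant-⊛ α (U α) n) ⟨
        (constant α * U α + θ (U α)) n               K.≈⟨ X*-suc (constant α * U α + θ (U α)) n ⟨
        (X * (constant α * U α + θ (U α))) (suc n)   K.∎

    V-recurrence : ∀ β → θ (V β) ≈ X * (X * (constant (β K.+ β) * V β - θ (V β)))
    V-recurrence β = coefficientwise λ where
      zero          → K.trans (K.zeroˡ _) (K.sym (K.zeroˡ _))
      (suc zero)    → K.trans (K.zeroʳ _) (K.sym
          (K.trans (X*-suc (X * (constant (β K.+ β) * V β - θ (V β))) 0) (K.zeroˡ _)))
      (suc (suc n)) → K.begin
        K.↑ suc (suc n) K.* V β (suc (suc n))
          K.≈⟨ ↑-cancel (suc n) (V β n) (β K.+ β K.- K.↑ n) ⟩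
        V β n K.* (β K.+ β K.- K.↑ n)
          K.≈⟨ solveᴷ 3 (λ u a m → u ⊠ (a ⊟ m) ⊜ a ⊠ u ⊟ m ⊠ u) K.refl (V β n) (β K.+ β) (K.↑ n) ⟩
        (β K.+ β) K.* V β n K.- K.↑ n K.* V β n
          K.≈⟨ K.+-congʳ (constant-⊛ (β K.+ β) (V β) n) ⟨
        (constant (β K.+ β) * V β - θ (V β)) n
          K.≈⟨ X*-suc (constant (β K.+ β) * V β - θ (V β)) n ⟨
        (X * (constant (β K.+ β) * V β - θ (V β))) (suc n)
          K.≈⟨ X*-suc (X * (constant (β K.+ β) * V β - θ (V β))) (suc n) ⟨
        (X * (X * (constant (β K.+ β) * V β - θ (V β)))) (suc (suc n)) K.∎

    B-recurrence : B ≈ 1# + X * (X * B)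
    B-recurrence = coefficientwise λ where
      zero          → K.sym (K.trans (K.+-congˡ (K.zeroˡ _)) (K.+-identityʳ _))
      (suc zero)    → K.sym (K.trans (K.+-identityˡ _) (K.trans (X*-suc (X * B) 0) (K.zeroˡ _)))
      (suc (suc n)) → K.sym (K.trans (K.+-identityˡ _) (K.trans (X*-suc (X * B) (suc n)) (X*-suc B n)))

  B-inverse : (1# - X * X) * B ≈ 1#
  B-inverse = begin
    (1# - X * X) * B
      ≈⟨ solve 2 (λ x b → (κ 1 :- x :* x) :* b := b :- x :* (x :* b)) refl X B ⟩
    B - X * (X * B)                ≈⟨ +-congʳ B-recurrence ⟩
    1# + X * (X * B) - X * (X * B) ≈⟨ solve 1 (λ y → κ 1 :+ y :- y := κ 1) refl (X * (X * B)) ⟩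
    1#                             ∎

  U-ode : ∀ α → (1# - X) * θ (U α) ≈ constant α * X * U α
  U-ode α = begin
    (1# - X) * θ (U α)             ≈⟨ solve 2 (λ x d → (κ 1 :- x) :* d := d :- x :* d) refl X (θ (U α)) ⟩
    θ (U α) - X * θ (U α)          ≈⟨ +-congʳ (U-recurrence α) ⟩
    X * (constant α * U α + θ (U α)) - X * θ (U α)
      ≈⟨ solve 4 (λ x a u d → x :* (a :* u :+ d) :- x :* d := a :* x :* u)
          refl X (constant α) (U α) (θ (U α)) ⟩
    constant α * X * U α           ∎

  V-ode : ∀ β → (1# + X * X) * θ (V β) ≈ constant (β K.+ β) * (X * X) * V β
  V-ode β = begin
    (1# + X * X) * θ (V β)
      ≈⟨ solve 2 (λ x d → (κ 1 :+ x :* x) :* d := d :+ x :* x :* d) refl X (θ (V β)) ⟩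
    θ (V β) + X * X * θ (V β)          ≈⟨ +-congʳ (V-recurrence β) ⟩
    X * (X * (constant (β K.+ β) * V β - θ (V β))) + X * X * θ (V β)
      ≈⟨ solve 4 (λ x a u d → x :* (x :* (a :* u :- d)) :+ x :* x :* d := a :* (x :* x) :* u)
          refl X (constant (β K.+ β)) (V β) (θ (V β)) ⟩
    constant (β K.+ β) * (X * X) * V β ∎

  -- Logarithmic derivatives add; here they are cleared of their common denominator p.
  ode-product : ∀ {p q r f g} → p * θ f ≈ q * f → p * θ g ≈ r * g → p * θ (f * g) ≈ (q + r) * (f * g)
  ode-product {p} {q} {r} {f} {g} hf hg = begin
    p * θ (f * g)                    ≈⟨ *-congˡ (θ-* f g) ⟩
    p * (θ f * g + f * θ g)
      ≈⟨ solve 5 (λ p f g d e → p :* (d :* g :+ f :* e) := p :* d :* g :+ f :* (p :* e))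
          refl p f g (θ f) (θ g) ⟩
    p * θ f * g + f * (p * θ g)      ≈⟨ +-cong (*-congʳ hf) (*-congˡ hg) ⟩
    q * f * g + f * (r * g)
      ≈⟨ solve 4 (λ q r f g → q :* f :* g :+ f :* (r :* g) := (q :+ r) :* (f :* g)) refl q r f g ⟩
    (q + r) * (f * g)                ∎

  private
    1-X-at-0 : (1# - X) 0 K.≈ K.1#
    1-X-at-0 = solveᴷ 0 (κᴷ 1 ⊟ κᴷ 0 ⊜ κᴷ 1) K.refl

    1+X²-at-0 : (1# + X * X) 0 K.≈ K.1#
    1+X²-at-0 = solveᴷ 0 (κᴷ 1 ⊞ κᴷ 0 ⊠ κᴷ 0 ⊜ κᴷ 1) K.refl

    aX-at-0 : ∀ a → (constant a * X) 0 K.≈ K.0#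
    aX-at-0 a = K.zeroʳ a

    aX²-at-0 : ∀ a → (constant a * (X * X)) 0 K.≈ K.0#
    aX²-at-0 a = solveᴷ 1 (λ a → a ⊠ (κᴷ 0 ⊠ κᴷ 0) ⊜ κᴷ 0) K.refl a

    θ1 : θ 1# ≈ 0#
    θ1 = θ-constant K.1#

  U-+ : ∀ α β → U α * U β ≈ U (α K.+ β)
  U-+ α β = ode-unique {1# - X} {constant (α K.+ β) * X} 1-X-at-0 (aX-at-0 _)
    (trans (ode-product (U-ode α) (U-ode β))
      (*-congʳ (trans (sym (distribʳ X (constant α) (constant β))) (*-congʳ (sym (constant-+ α β))))))
    (U-ode (α K.+ β)) (K.*-identityˡ _)

  V-+ : ∀ α β → V α * V β ≈ V (α K.+ β)
  V-+ α β = ode-unique {1# + X * X} {constant ((α K.+ β) K.+ (α K.+ β)) * (X * X)} 1+X²-at-0 (aX²-at-0 _)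
    (trans (ode-product (V-ode α) (V-ode β))
      (*-congʳ (trans (sym (distribʳ (X * X) (constant (α K.+ α)) (constant (β K.+ β))))
          (*-congʳ (trans (sym (constant-+ (α K.+ α) (β K.+ β)))
        (constant-cong (solveᴷ 2 (λ a b → a ⊞ a ⊞ (b ⊞ b) ⊜ a ⊞ b ⊞ (a ⊞ b)) K.refl α β)))))))
    (V-ode (α K.+ β)) (K.*-identityˡ _)

  U-cong : ∀ {α β} → α K.≈ β → U α ≈ U β
  U-cong {α} {β} h = coefficientwise go
    where
    go : ∀ n → U α n K.≈ U β n
    go zero    = K.refl
    go (suc n) = K.*-congʳ (K.*-cong (go n) (K.+-congʳ h))

  V-cong : ∀ {α β} → α K.≈ β → V α ≈ V β
  V-cong {α} {β} h = coefficientwise go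
    where
    go : ∀ n → V α n K.≈ V β n
    go zero          = K.refl
    go (suc zero)    = K.refl
    go (suc (suc n)) = K.*-congʳ (K.*-cong (go n) (K.+-congʳ (K.+-cong h h)))

  U-0 : U K.0# ≈ 1#
  U-0 = ode-unique {1# - X} {constant K.0# * X} 1-X-at-0 (aX-at-0 _) (U-ode K.0#)
    (begin
      (1# - X) * θ 1#          ≈⟨ *-congˡ θ1 ⟩
      (1# - X) * 0#            ≈⟨ solve 1 (λ x → (κ 1 :- x) :* κ 0 := κ 0 :* x :* κ 1) refl X ⟩
      0# * X * 1#              ≈⟨ *-congʳ (*-congʳ (coefficientwise λ where
                                    zero    → K.refl
                                    (suc n) → K.refl)) ⟩
      constant K.0# * X * 1#   ∎)
    K.refl

  V-0 : V K.0# ≈ 1#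
  V-0 = ode-unique {1# + X * X} {constant (K.0# K.+ K.0#) * (X * X)} 1+X²-at-0 (aX²-at-0 _) (V-ode K.0#)
    (begin
      (1# + X * X) * θ 1#                    ≈⟨ *-congˡ θ1 ⟩
      (1# + X * X) * 0#
        ≈⟨ solve 1 (λ x → (κ 1 :+ x :* x) :* κ 0 := κ 0 :* (x :* x) :* κ 1) refl X ⟩
      0# * (X * X) * 1#                      ≈⟨ *-congʳ (*-congʳ (coefficientwise λ where
                                                  zero    → K.sym (K.+-identityˡ _)
                                                  (suc n) → K.refl)) ⟩
      constant (K.0# K.+ K.0#) * (X * X) * 1# ∎)
    K.refl

  U-[-1] : U (K.- K.1#) ≈ 1# - X
  U-[-1] = ode-unique {1# - X} {constant (K.- K.1#) * X} 1-X-at-0 (aX-at-0 _) (U-ode (K.- K.1#))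
    (begin
      (1# - X) * θ (1# - X)
        ≈⟨ *-congˡ (trans (θ-+ 1# (- X)) (+-cong θ1 (trans (θ-neg X) (-‿cong θX)))) ⟩
      (1# - X) * (0# - X)
        ≈⟨ solve 1 (λ x → (κ 1 :- x) :* (κ 0 :- x) := (:- κ 1) :* x :* (κ 1 :- x)) refl X ⟩
      - 1# * X * (1# - X)             ≈⟨ *-congʳ (*-congʳ (constant-neg K.1#)) ⟨
      constant (K.- K.1#) * X * (1# - X) ∎)
    (K.sym 1-X-at-0)

  V-1 : V K.1# ≈ 1# + X * X
  V-1 = ode-unique {1# + X * X} {constant (K.1# K.+ K.1#) * (X * X)} 1+X²-at-0 (aX²-at-0 _) (V-ode K.1#)
    (begin
      (1# + X * X) * θ (1# + X * X)
        ≈⟨ *-congˡ (trans (θ-+ 1# (X * X)) (+-cong θ1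
            (trans (θ-* X X) (+-cong (*-congʳ θX) (*-congˡ θX))))) ⟩
      (1# + X * X) * (0# + (X * X + X * X))
        ≈⟨ solve 1 (λ x → (κ 1 :+ x :* x) :* (κ 0 :+ (x :* x :+ x :* x))
            := (κ 1 :+ κ 1) :* (x :* x) :* (κ 1 :+ x :* x)) refl X ⟩
      (1# + 1#) * (X * X) * (1# + X * X)
        ≈⟨ *-congʳ (*-congʳ (constant-+ K.1# K.1#)) ⟨
      constant (K.1# K.+ K.1#) * (X * X) * (1# + X * X) ∎)
    (K.sym 1+X²-at-0)

  U-inverse : U K.1# * (1# - X) ≈ 1#
  U-inverse = begin
    U K.1# * (1# - X)        ≈⟨ *-congˡ U-[-1] ⟨
    U K.1# * U (K.- K.1#)    ≈⟨ U-+ K.1# (K.- K.1#) ⟩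
    U (K.1# K.- K.1#)        ≈⟨ U-cong (K.-‿inverseʳ _) ⟩
    U K.0#                   ≈⟨ U-0 ⟩
    1#                       ∎

  V-inverse : ∀ β → V (K.- β) * V β ≈ 1#
  V-inverse β = begin
    V (K.- β) * V β      ≈⟨ V-+ (K.- β) β ⟩
    V (K.- β K.+ β)      ≈⟨ V-cong (K.-‿inverseˡ _) ⟩
    V K.0#               ≈⟨ V-0 ⟩
    1#                   ∎

  -- S α = ((1 + t²) / (1 - t))^α
  S : K.Carrier → Series
  S α = U α * V α

  S-cong : ∀ {α β} → α K.≈ β → S α ≈ S β
  S-cong h = *-cong (U-cong h) (V-cong h)

  S-+ : ∀ α β → S α * S β ≈ S (α K.+ β)
  S-+ α β = begin
    U α * V α * (U β * V β)
      ≈⟨ solve 4 (λ a b c d → a :* b :* (c :* d) := a :* c :* (b :* d)) refl (U α) (V α) (U β) (V β) ⟩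
    U α * U β * (V α * V β)      ≈⟨ *-cong (U-+ α β) (V-+ α β) ⟩
    S (α K.+ β)                  ∎

  -- X * M is the logarithmic derivative of (1 + t²) / (1 - t) with respect to θ.
  M : Series
  M = U K.1# + (X + X) * V (K.- K.1#)

  private
    V-inverse₁ : V (K.- K.1#) * (1# + X * X) ≈ 1#
    V-inverse₁ = trans (*-congˡ (sym V-1)) (V-inverse K.1#)

  θU : ∀ α → θ (U α) ≈ constant α * X * U K.1# * U α
  θU α = begin
    θ (U α)                              ≈⟨ *-identityˡ _ ⟨
    1# * θ (U α)                         ≈⟨ *-congʳ U-inverse ⟨
    U K.1# * (1# - X) * θ (U α)          ≈⟨ *-assoc _ _ _ ⟩
    U K.1# * ((1# - X) * θ (U α))        ≈⟨ *-congˡ (U-ode α) ⟩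
    U K.1# * (constant α * X * U α)
      ≈⟨ solve 4 (λ a b c d → a :* (b :* c :* d) := b :* c :* a :* d) refl (U K.1#) (constant α) X (U α) ⟩
    constant α * X * U K.1# * U α        ∎

  θV : ∀ β → θ (V β) ≈ (constant β + constant β) * (X * X) * V (K.- K.1#) * V β
  θV β = begin
    θ (V β)                                              ≈⟨ *-identityˡ _ ⟨
    1# * θ (V β)                                         ≈⟨ *-congʳ V-inverse₁ ⟨
    V (K.- K.1#) * (1# + X * X) * θ (V β)                ≈⟨ *-assoc _ _ _ ⟩
    V (K.- K.1#) * ((1# + X * X) * θ (V β))              ≈⟨ *-congˡ (V-ode β) ⟩
    V (K.- K.1#) * (constant (β K.+ β) * (X * X) * V β)  ≈⟨ *-congˡ (*-congʳ (*-congʳ (constant-+ β β))) ⟩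
    V (K.- K.1#) * ((constant β + constant β) * (X * X) * V β)
      ≈⟨ solve 4 (λ a b c d → a :* (b :* c :* d) := b :* c :* a :* d)
          refl (V (K.- K.1#)) (constant β + constant β) (X * X) (V β) ⟩
    (constant β + constant β) * (X * X) * V (K.- K.1#) * V β ∎

  θS : ∀ α → θ (S α) ≈ constant α * (X * M) * S α
  θS α = begin
    θ (U α * V α)                  ≈⟨ θ-* (U α) (V α) ⟩
    θ (U α) * V α + U α * θ (V α)  ≈⟨ +-cong (*-congʳ (θU α)) (*-congˡ (θV α)) ⟩
    constant α * X * U K.1# * U α * V α + U α * ((constant α + constant α) * (X * X) * V (K.- K.1#) * V α)
      ≈⟨ solve 6 (λ a x u v u′ v′ → a :* x :* u′ :* u :* v :+ u :* ((a :+ a) :* (x :* x) :* v′ :* v)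
                                 := a :* (x :* (u′ :+ (x :+ x) :* v′)) :* (u :* v)) refl
           (constant α) X (U α) (V α) (U K.1#) (V (K.- K.1#)) ⟩
    constant α * (X * M) * S α     ∎

  -- σ = (1 + t²) / (1 - t) - 1 = t w with w = (1 + t) / (1 - t)
  σ w w⁻¹ : Series
  σ   = S K.1# - 1#
  w   = (1# + X) * U K.1#
  w⁻¹ = (1# - X) * (1# - X) * B

  σ≈X*w : σ ≈ X * w
  σ≈X*w = begin
    U K.1# * V K.1# - 1#                            ≈⟨ +-cong (*-congˡ V-1) (-‿cong (sym U-inverse)) ⟩
    U K.1# * (1# + X * X) - U K.1# * (1# - X)
      ≈⟨ solve 2 (λ u x → u :* (κ 1 :+ x :* x) :- u :* (κ 1 :- x) := x :* ((κ 1 :+ x) :* u))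
          refl (U K.1#) X ⟩
    X * w                                           ∎

  w*w⁻¹ : w * w⁻¹ ≈ 1#
  w*w⁻¹ = begin
    (1# + X) * U K.1# * ((1# - X) * (1# - X) * B)
      ≈⟨ solve 3 (λ x u b → (κ 1 :+ x) :* u :* ((κ 1 :- x) :* (κ 1 :- x) :* b)
          := u :* (κ 1 :- x) :* ((κ 1 :- x :* x) :* b)) refl X (U K.1#) B ⟩
    U K.1# * (1# - X) * ((1# - X * X) * B)           ≈⟨ *-cong U-inverse B-inverse ⟩
    1# * 1#                                          ≈⟨ *-identityˡ 1# ⟩
    1#                                               ∎

  2ᴷ : K.Carrier
  2ᴷ = K.1# K.+ K.1#

  -- The quotient (1 - t²) / (1 + t²)² of w by s². Its inverse is `η`, the quotient of w⁻¹ by s⁻².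
  even-kernel : Series
  even-kernel = (1# - X * X) * V (K.- 2ᴷ)

  σ≈even-kernel : σ ≈ X * even-kernel * S 2ᴷ
  σ≈even-kernel = begin
    σ                                                    ≈⟨ σ≈X*w ⟩
    X * ((1# + X) * U K.1#)
      ≈⟨ solve 2 (λ x u → x :* ((κ 1 :+ x) :* u) := x :* ((κ 1 :+ x) :* u) :* (κ 1 :* κ 1))
          refl X (U K.1#) ⟩
    X * ((1# + X) * U K.1#) * (1# * 1#)                  ≈⟨ *-congˡ (*-cong U-inverse (V-inverse 2ᴷ)) ⟨
    X * ((1# + X) * U K.1#) * (U K.1# * (1# - X) * (V (K.- 2ᴷ) * V 2ᴷ))
      ≈⟨ solve 4 (λ x u v v′ → x :* ((κ 1 :+ x) :* u) :* (u :* (κ 1 :- x) :* (v′ :* v))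
                            := x :* ((κ 1 :- x :* x) :* v′) :* (u :* u :* v))
                                refl X (U K.1#) (V 2ᴷ) (V (K.- 2ᴷ)) ⟩
    X * even-kernel * (U K.1# * U K.1# * V 2ᴷ)           ≈⟨ *-congˡ (*-congʳ (U-+ K.1# K.1#)) ⟩
    X * even-kernel * S 2ᴷ                               ∎

  η : Series
  η = V K.1# * V K.1# * B

  -- Written with the denominator 1 - t² in place of 1 + t, w⁻¹ is (1 - t)² times an even series,
  -- and (1 - t)² is s⁻² up to a power of 1 + t².
  w⁻¹≈η*S : w⁻¹ ≈ η * S (K.- 2ᴷ)
  w⁻¹≈η*S = begin
    (1# - X) * (1# - X) * B                        ≈⟨ *-congʳ (*-cong U-[-1] U-[-1]) ⟨
    U (K.- K.1#) * U (K.- K.1#) * B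
      ≈⟨ *-congʳ (trans (U-+ _ _) (U-cong (solveᴷ 0 ((⊟ κᴷ 1) ⊞ (⊟ κᴷ 1) ⊜ ⊟ (κᴷ 1 ⊞ κᴷ 1)) K.refl))) ⟩
    U (K.- 2ᴷ) * B
      ≈⟨ solve 2 (λ u b → u :* b := κ 1 :* (u :* b)) refl (U (K.- 2ᴷ)) B ⟩
    1# * (U (K.- 2ᴷ) * B)                          ≈⟨ *-congʳ (V-inverse 2ᴷ) ⟨
    V (K.- 2ᴷ) * V 2ᴷ * (U (K.- 2ᴷ) * B)           ≈⟨ *-congʳ (*-congˡ (V-+ K.1# K.1#)) ⟨
    V (K.- 2ᴷ) * (V K.1# * V K.1#) * (U (K.- 2ᴷ) * B)
      ≈⟨ solve 4 (λ v′ v u b → v′ :* (v :* v) :* (u :* b) := v :* v :* b :* (u :* v′))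
          refl (V (K.- 2ᴷ)) (V K.1#) (U (K.- 2ᴷ)) B ⟩
    η * S (K.- 2ᴷ)                                 ∎

  θσ : θ σ ≈ X * M * S K.1#
  θσ = begin
    θ (S K.1# - 1#)
      ≈⟨ trans (θ-+ (S K.1#) (- 1#)) (+-congˡ (trans (θ-neg 1#) (-‿cong (θ-constant K.1#)))) ⟩
    θ (S K.1#) - 0#                     ≈⟨ +-congʳ (θS K.1#) ⟩
    1# * (X * M) * S K.1# - 0#
      ≈⟨ solve 3 (λ x m s → κ 1 :* (x :* m) :* s :- κ 0 := x :* m :* s) refl X M (S K.1#) ⟩
    X * M * S K.1#                      ∎

  -- Both sides are the derivative of σ, on the left as s times s′ / s and on the right from σ = t
  -- w. They are compared after multiplication by t, where θ σ is available.
  M*S₁ : M * S K.1# ≈ w + θ w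
  M*S₁ = X*-cancel (begin
    X * (M * S K.1#)     ≈⟨ *-assoc X M (S K.1#) ⟨
    X * M * S K.1#       ≈⟨ θσ ⟨
    θ σ                  ≈⟨ θ-cong σ≈X*w ⟩
    θ (X * w)            ≈⟨ θ-* X w ⟩
    θ X * w + X * θ w    ≈⟨ +-congʳ (*-congʳ θX) ⟩
    X * w + X * θ w      ≈⟨ distribˡ X w (θ w) ⟨
    X * (w + θ w)        ∎)


  S-^ : ∀ α n → S α ^ n ≈ S (K.↑ n K.* α)
  S-^ α zero    = begin
    1#              ≈⟨ *-identityˡ 1# ⟨
    1# * 1#         ≈⟨ *-cong U-0 V-0 ⟨
    S K.0#          ≈⟨ S-cong (K.sym (K.zeroˡ α)) ⟩
    S (K.0# K.* α)  ∎
  S-^ α (suc n) = begin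
    S α * S α ^ n                ≈⟨ *-congˡ (S-^ α n) ⟩
    S α * S (K.↑ n K.* α)        ≈⟨ S-+ α (K.↑ n K.* α) ⟩
    S (α K.+ K.↑ n K.* α)
      ≈⟨ S-cong (solveᴷ 2 (λ m a → a ⊞ m ⊠ a ⊜ (κᴷ 1 ⊞ m) ⊠ a) K.refl (K.↑ n) α) ⟩
    S (K.↑ suc n K.* α)          ∎

  θ-^ : ∀ f n → θ (f ^ suc n) ≈ constant (K.↑ suc n) * (f ^ n * θ f)
  θ-^ f zero = begin
    θ (f * 1#)                                ≈⟨ θ-cong (*-identityʳ f) ⟩
    θ f                                       ≈⟨ solve 1 (λ d → d := κ 1 :* (κ 1 :* d)) refl (θ f) ⟩
    1# * (1# * θ f)                           ≈⟨ *-congʳ (constant-cong (K.sym (K.+-identityʳ K.1#))) ⟩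
    constant (K.↑ 1) * (1# * θ f)             ∎
  θ-^ f (suc n) = begin
    θ (f * f ^ suc n)                         ≈⟨ θ-* f (f ^ suc n) ⟩
    θ f * f ^ suc n + f * θ (f ^ suc n)       ≈⟨ +-congˡ (*-congˡ (θ-^ f n)) ⟩
    θ f * (f * f ^ n) + f * (constant (K.↑ suc n) * (f ^ n * θ f))
      ≈⟨ solve 4 (λ d f p c → d :* (f :* p) :+ f :* (c :* (p :* d)) := (κ 1 :+ c) :* (f :* p :* d))
          refl (θ f) f (f ^ n) (constant (K.↑ suc n)) ⟩
    (1# + constant (K.↑ suc n)) * (f ^ suc n * θ f)   ≈⟨ *-congʳ (constant-+ K.1# (K.↑ suc n)) ⟨
    constant (K.↑ suc (suc n)) * (f ^ suc n * θ f)    ∎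

  -- The determinants of even and odd coefficients and one recursion step

  evenDet oddDet derivedDet : ℕ → K.Carrier → K.Carrier
  evenDet    n α = Det n (λ i → even-part (S α * σ ^ i))
  oddDet     n α = Det n (λ i → odd-part (S α * σ ^ i))
  derivedDet n α = Det n (λ i → even-part (S α * M * σ ^ i))

  odd-part-cong : ∀ {f g} → f ≈ g → odd-part f ≐ odd-part g
  odd-part-cong h = even-part-cong (at h ∘ suc)

  even-cong : ∀ {f g} → f ≈ g → even-part f ≐ even-part g
  even-cong h = even-part-cong (at h)

  odd-part-X : ∀ f → odd-part (X * f) ≐ even-part f
  odd-part-X f = even-part-cong (X*-suc f)

  evenDet-cong : ∀ n {α β} → α K.≈ β → evenDet n α K.≈ evenDet n β
  evenDet-cong n {α} {β} h = Det-cong n {λ i → even-part (S α * σ ^ i)} {λ i → even-part (S β * σ ^ i)}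
    λ {i} {j} _ _ → even-cong (*-congʳ (S-cong h)) j

  private
    1-even : IsEven 1#
    1-even zero    = K.refl
    1-even (suc j) = zeros j
      where
      zeros : ∀ j → even-part (λ _ → K.0#) j K.≈ K.0#
      zeros zero    = K.refl
      zeros (suc j) = zeros j

    X²-even : IsEven (X * X)
    X²-even j = K.trans (odd-part-X X j) (even-part-X j)
      where
      even-part-X : ∀ j → even-part X j K.≈ K.0#
      even-part-X zero    = K.refl
      even-part-X (suc j) = zeros j
        where
        zeros : ∀ j → even-part (tail (tail X)) j K.≈ K.0#
        zeros zero    = K.refl
        zeros (suc j) = 1-even (suc j)

    1-X²-even : IsEven (1# - X * X)
    1-X²-even j = K.begin
      odd-part (1# - X * X) j                    K.≈⟨ even-part-+ (tail 1#) (tail (- (X * X))) j ⟩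
      odd-part 1# j K.+ odd-part (- (X * X)) j
        K.≈⟨ K.+-cong (1-even j) (odd-part-cong (solve 1 (λ x → :- (x :* x)
            := (:- κ 1) :* (x :* x)) refl X) j) ⟩
      K.0# K.+ odd-part (- 1# * (X * X)) j
        K.≈⟨ K.trans (K.+-identityˡ _) (odd-part-cong (*-congʳ (sym (constant-neg K.1#))) j) ⟩
      odd-part (constant (K.- K.1#) * (X * X)) j
        K.≈⟨ even-part-cong (constant-⊛ (K.- K.1#) (X * X) ∘ suc) j ⟩
      even-part (λ n → K.- K.1# K.* (X * X) (suc n)) j K.≈⟨ even-part-scale (K.- K.1#) (tail (X * X)) j ⟩
      K.- K.1# K.* odd-part (X * X) j            K.≈⟨ K.*-congˡ (X²-even j) ⟩
      K.- K.1# K.* K.0#                          K.≈⟨ K.zeroʳ _ ⟩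
      K.0#                                       K.∎

  even-kernel-even : IsEven even-kernel
  even-kernel-even = even-⊛ {1# - X * X} {V (K.- 2ᴷ)} 1-X²-even (V-even (K.- 2ᴷ))

  even-kernel-0 : even-kernel 0 K.≈ K.1#
  even-kernel-0 = solveᴷ 0 ((κᴷ 1 ⊟ κᴷ 0 ⊠ κᴷ 0) ⊠ κᴷ 1 ⊜ κᴷ 1) K.refl

  η-even : IsEven η
  η-even = even-⊛ {V K.1# * V K.1#} {B} (even-⊛ {V K.1#} {V K.1#} (V-even K.1#) (V-even K.1#)) B-even

  η-0 : η 0 K.≈ K.1#
  η-0 = solveᴷ 0 (κᴷ 1 ⊠ κᴷ 1 ⊠ κᴷ 1 ⊜ κᴷ 1) K.refl

  ^-even : ∀ {f} → IsEven f → ∀ n → IsEven (f ^ n)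
  ^-even     h zero    = 1-even
  ^-even {f} h (suc n) = even-⊛ {f} {f ^ n} h (^-even h n)

  ^-0 : ∀ {f} → f 0 K.≈ K.1# → ∀ n → (f ^ n) 0 K.≈ K.1#
  ^-0 h zero    = K.refl
  ^-0 h (suc n) = K.trans (K.*-cong h (^-0 h n)) (K.*-identityˡ _)

  σ-0 : σ 0 K.≈ K.0#
  σ-0 = solveᴷ 0 (κᴷ 1 ⊠ κᴷ 1 ⊟ κᴷ 1 ⊜ κᴷ 0) K.refl

  -- As σ has no constant term, the column of t⁰ is zero below row 0. In every other row one factor
  -- σ is traded for t, s² and `even-kernel`; taking out t turns the coefficient of t^(2j + 2) into
  -- one of t^(2j + 1).
  evenDet-suc : ∀ n α → evenDet (suc n) α K.≈ oddDet n (α K.+ 2ᴷ)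
  evenDet-suc n α = K.begin
    Det (suc n) (λ i → even-part (S α * σ ^ i))
      K.≈⟨ Det-first-column n (λ i → even-part (S α * σ ^ i))
             (λ {i} _ → K.trans (K.*-congˡ (K.trans (K.*-congʳ σ-0) (K.zeroˡ _))) (K.zeroʳ _)) ⟩
    (S α * 1#) 0 K.* Det n (λ i j → odd-part (tail (S α * σ ^ suc i)) j)
      K.≈⟨ K.trans (K.*-congʳ (solveᴷ 0 (κᴷ 1 ⊠ κᴷ 1 ⊠ κᴷ 1 ⊜ κᴷ 1) K.refl)) (K.*-identityˡ _) ⟩
    Det n (λ i j → odd-part (tail (S α * σ ^ suc i)) j)
      K.≈⟨ Det-cong n {λ i → odd-part (tail (S α * σ ^ suc i))} {λ i →
          odd-part (S (α K.+ 2ᴷ) * σ ^ i * even-kernel)}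
             (λ {i} {j} _ _ → even-part-cong (λ k → K.trans (at (shifted i) (suc (suc k)))
                 (X*-suc (S (α K.+ 2ᴷ) * σ ^ i * even-kernel) (suc k))) j) ⟩
    Det n (λ i → odd-part (S (α K.+ 2ᴷ) * σ ^ i * even-kernel))
      K.≈⟨ Det-odd-part-⊛ n (λ i → S (α K.+ 2ᴷ) * σ ^ i) {even-kernel} even-kernel-even even-kernel-0 ⟩
    oddDet n (α K.+ 2ᴷ) K.∎
    where
    shifted : ∀ i → S α * σ ^ suc i ≈ X * (S (α K.+ 2ᴷ) * σ ^ i * even-kernel)
    shifted i = begin
      S α * (σ * σ ^ i)                                ≈⟨ *-congˡ (*-congʳ σ≈even-kernel) ⟩
      S α * (X * even-kernel * S 2ᴷ * σ ^ i)
        ≈⟨ solve 5 (λ s x e s′ p → s :* (x :* e :* s′ :* p) := x :* (s :* s′ :* p :* e))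
            refl (S α) X even-kernel (S 2ᴷ) (σ ^ i) ⟩
      X * (S α * S 2ᴷ * σ ^ i * even-kernel)           ≈⟨ *-congˡ (*-congʳ (*-congʳ (S-+ α 2ᴷ))) ⟩
      X * (S (α K.+ 2ᴷ) * σ ^ i * even-kernel)         ∎

  -- Since s = σ + 1, the series θ (s^α σⁱ) is t s^(α - 1) s′ times (α + i) σⁱ + i σⁱ⁻¹. The rows
  -- are thus transformed by a bidiagonal matrix, whose diagonal gives the product on the right. The
  -- factors 2j + 1 on the left are the action of θ on t^(2j + 1).
  oddDet-derived : ∀ n α → K.∏ n (λ j → K.↑ suc (2 ℕ.* j)) K.* oddDet n α
      K.≈ K.∏ n (λ i → α K.+ K.↑ i) K.* derivedDet n α
  oddDet-derived n α = K.begin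
    K.∏ n (λ j → K.↑ suc (2 ℕ.* j)) K.* oddDet n α
      K.≈⟨ Det-scale-columns n (λ j → K.↑ suc (2 ℕ.* j)) (λ i → odd-part (f i)) ⟨
    Det n (λ i j → K.↑ suc (2 ℕ.* j) K.* odd-part (f i) j)
      K.≈⟨ Det-cong n {λ i j → K.↑ suc (2 ℕ.* j) K.* odd-part (f i) j} {λ i j →
          ∑ n (λ k → L i k K.* H k j)} (λ {i} {j} i<n _ → K.sym (entry i j i<n)) ⟩
    Det n (λ i j → ∑ n (λ k → L i k K.* H k j))
      K.≈⟨ Det-· n L H ⟩
    Det n L K.* derivedDet n α
      K.≈⟨ K.*-congʳ (Det-bidiagonal n (λ i → α K.+ K.↑ i) (λ i → K.↑ suc i)) ⟩
    K.∏ n (λ i → α K.+ K.↑ i) K.* derivedDet n α K.∎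
    where
    f h : ℕ → Series
    f i = S α * σ ^ i
    h i = S α * M * σ ^ i
    L H : Matrixℕ
    L = bidiagonal (λ i → α K.+ K.↑ i) (λ i → K.↑ suc i)
    H i = even-part (h i)
    scaled : ∀ i j → K.↑ suc (2 ℕ.* j) K.* odd-part (f i) j K.≈ odd-part (θ (f i)) j
    scaled i j = K.trans (K.*-congˡ (even-part-at (tail (f i)) j)) (K.sym (even-part-at (tail (θ (f i))) j))
    derivative-0 : θ (f 0) ≈ X * (constant (α K.+ K.0#) * h 0)
    derivative-0 = begin
      θ (S α * 1#)                                 ≈⟨ θ-cong (*-identityʳ (S α)) ⟩
      θ (S α)                                      ≈⟨ θS α ⟩
      constant α * (X * M) * S α
        ≈⟨ solve 4 (λ c x m s → c :* (x :* m) :* s := x :* (c :* (s :* m :* κ 1)))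
            refl (constant α) X M (S α) ⟩
      X * (constant α * h 0)
        ≈⟨ *-congˡ (*-congʳ (constant-cong (K.sym (K.+-identityʳ α)))) ⟩
      X * (constant (α K.+ K.0#) * h 0)            ∎
    derivative : ∀ i → θ (f (suc i)) ≈ X * (constant (K.↑ suc i) * h i + constant (α K.+ K.↑ suc i)
        * h (suc i))
    derivative i = begin
      θ (S α * σ ^ suc i)                                      ≈⟨ θ-* (S α) (σ ^ suc i) ⟩
      θ (S α) * σ ^ suc i + S α * θ (σ ^ suc i)
        ≈⟨ +-cong (*-congʳ (θS α)) (*-congˡ (trans (θ-^ σ i) (*-congˡ (*-congˡ θσ)))) ⟩
      constant α * (X * M) * S α * (σ * σ ^ i) + S α * (constant (K.↑ suc i) * (σ ^ i * (X * M * S K.1#)))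
        -- Here u is s and σ is entered as u - 1, so that the factor s coming from θ σ splits into σ
        -- + 1.
        ≈⟨ solve 7 (λ a x m s u p c → a :* (x :* m) :* s :* ((u :- κ 1) :* p) :+ s
            :* (c :* (p :* (x :* m :* u)))
                                   := x :* (c :* (s :* m :* p) :+ (a :+ c) :* (s :* m
                                       :* ((u :- κ 1) :* p)))) refl
             (constant α) X M (S α) (S K.1#) (σ ^ i) (constant (K.↑ suc i)) ⟩
      X * (constant (K.↑ suc i) * h i + (constant α + constant (K.↑ suc i)) * h (suc i))
        ≈⟨ *-congˡ (+-congˡ (*-congʳ (constant-+ α (K.↑ suc i)))) ⟨
      X * (constant (K.↑ suc i) * h i + constant (α K.+ K.↑ suc i) * h (suc i)) ∎
    even-part-constant : ∀ a g j → even-part (constant a * g) j K.≈ a K.* even-part g j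
    even-part-constant a g j = K.trans (even-part-cong (constant-⊛ a g) j) (even-part-scale a g j)
    entry : ∀ i j → i ℕ.< n → ∑ n (λ k → L i k K.* H k j) K.≈ K.↑ suc (2 ℕ.* j) K.* odd-part (f i) j
    entry zero j (s≤s {n = m} _) = K.begin
      ∑ (suc m) (λ k → L 0 k K.* H k j)
        K.≈⟨ bidiagonal-first m (λ i → α K.+ K.↑ i) (λ i → K.↑ suc i) (λ k → H k j) ⟩
      (α K.+ K.0#) K.* H 0 j                     K.≈⟨ even-part-constant (α K.+ K.0#) (h 0) j ⟨
      even-part (constant (α K.+ K.0#) * h 0) j  K.≈⟨ odd-part-X (constant (α K.+ K.0#) * h 0) j ⟨
      odd-part (X * (constant (α K.+ K.0#) * h 0)) j  K.≈⟨ odd-part-cong derivative-0 j ⟨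
      odd-part (θ (f 0)) j                       K.≈⟨ scaled 0 j ⟨
      K.↑ suc (2 ℕ.* j) K.* odd-part (f 0) j     K.∎
    entry (suc i) j i<n = K.begin
      ∑ n (λ k → L (suc i) k K.* H k j)
        K.≈⟨ bidiagonal-suc n (λ i → α K.+ K.↑ i) (λ i → K.↑ suc i) (λ k → H k j) i i<n ⟩
      K.↑ suc i K.* H i j K.+ (α K.+ K.↑ suc i) K.* H (suc i) j
        K.≈⟨ K.+-cong (even-part-constant (K.↑ suc i) (h i) j)
            (even-part-constant (α K.+ K.↑ suc i) (h (suc i)) j) ⟨
      even-part (constant (K.↑ suc i) * h i) j K.+ even-part (constant (α K.+ K.↑ suc i) * h (suc i)) j
        K.≈⟨ even-part-+ (constant (K.↑ suc i) * h i) (constant (α K.+ K.↑ suc i) * h (suc i)) j ⟨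
      even-part (constant (K.↑ suc i) * h i + constant (α K.+ K.↑ suc i) * h (suc i)) j
        K.≈⟨ odd-part-X (constant (K.↑ suc i) * h i + constant (α K.+ K.↑ suc i) * h (suc i)) j ⟨
      odd-part (X * (constant (K.↑ suc i) * h i + constant (α K.+ K.↑ suc i) * h (suc i))) j
        K.≈⟨ odd-part-cong (derivative i) j ⟨
      odd-part (θ (f (suc i))) j                 K.≈⟨ scaled (suc i) j ⟨
      K.↑ suc (2 ℕ.* j) K.* odd-part (f (suc i)) j K.∎

  -- Residues and the duality of the powers of σ

  X^-low : ∀ r f {n} → n ℕ.< r → (X ^ r * f) n K.≈ K.0#
  X^-low (suc r) f {zero}  _         = K.trans (K.*-congʳ (K.zeroˡ _)) (K.zeroˡ _)
  X^-low (suc r) f {suc n} (s≤s n<r) = K.trans (at (*-assoc X (X ^ r) f) (suc n))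
      (K.trans (X*-suc (X ^ r * f) n) (X^-low r f n<r))

  X^-+ : ∀ r f n → (X ^ r * f) (r ℕ.+ n) K.≈ f n
  X^-+ zero    f n = at (*-identityˡ f) n
  X^-+ (suc r) f n = K.trans (at (*-assoc X (X ^ r) f) (suc (r ℕ.+ n)))
      (K.trans (X*-suc (X ^ r * f) (r ℕ.+ n)) (X^-+ r f n))

  σ^ : ∀ r → σ ^ r ≈ X ^ r * w ^ r
  σ^ r = trans (^-congˡ r σ≈X*w) (^-distrib-* X w r)

  w^*w⁻¹^ : ∀ n → w ^ n * w⁻¹ ^ n ≈ 1#
  w^*w⁻¹^ zero    = *-identityˡ 1#
  w^*w⁻¹^ (suc n) = begin
    w * w ^ n * (w⁻¹ * w⁻¹ ^ n)
      ≈⟨ solve 4 (λ a b c d → a :* b :* (c :* d) := a :* c :* (b :* d)) refl w (w ^ n) w⁻¹ (w⁻¹ ^ n) ⟩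
    w * w⁻¹ * (w ^ n * w⁻¹ ^ n)    ≈⟨ *-cong w*w⁻¹ (w^*w⁻¹^ n) ⟩
    1# * 1#                        ≈⟨ *-identityˡ 1# ⟩
    1#                             ∎

  θw⁻¹ : θ w⁻¹ ≈ - (w⁻¹ * w⁻¹ * θ w)
  θw⁻¹ = begin
    θ w⁻¹                                               ≈⟨ *-identityˡ _ ⟨
    1# * θ w⁻¹                                          ≈⟨ *-congʳ w*w⁻¹ ⟨
    w * w⁻¹ * θ w⁻¹
      ≈⟨ solve 4 (λ w v d e → w :* v :* e := v :* (d :* v :+ w :* e) :- v :* v :* d)
          refl w w⁻¹ (θ w) (θ w⁻¹) ⟩
    w⁻¹ * (θ w * w⁻¹ + w * θ w⁻¹) - w⁻¹ * w⁻¹ * θ w     ≈⟨ +-congʳ (*-congˡ (θ-* w w⁻¹)) ⟨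
    w⁻¹ * θ (w * w⁻¹) - w⁻¹ * w⁻¹ * θ w
      ≈⟨ +-congʳ (*-congˡ (trans (θ-cong w*w⁻¹) (θ-constant K.1#))) ⟩
    w⁻¹ * 0# - w⁻¹ * w⁻¹ * θ w
      ≈⟨ solve 2 (λ v y → v :* κ 0 :- y := :- y) refl w⁻¹ (w⁻¹ * w⁻¹ * θ w) ⟩
    - (w⁻¹ * w⁻¹ * θ w)                                 ∎

  -- The coefficient of t^d in residue d is the residue of σ^(-d-1) dσ.
  residue : ℕ → Series
  residue d = (w + θ w) * w⁻¹ ^ suc d

  residue-0 : residue 0 0 K.≈ K.1#
  residue-0 = solveᴷ 1 (λ a → ((κᴷ 1 ⊞ κᴷ 0) ⊠ κᴷ 1 ⊞ κᴷ 0 ⊠ a)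
    ⊠ ((κᴷ 1 ⊟ κᴷ 0) ⊠ (κᴷ 1 ⊟ κᴷ 0) ⊠ κᴷ 1 ⊠ κᴷ 1) ⊜ κᴷ 1) K.refl (w 0)

  -- d σ^(-d-1) dσ is exact.
  residue-exact : ∀ d → constant (K.↑ suc d) * residue (suc d)
      ≈ constant (K.↑ suc d) * w⁻¹ ^ suc d - θ (w⁻¹ ^ suc d)
  residue-exact d = begin
    a * ((w + θ w) * (w⁻¹ * (w⁻¹ * w⁻¹ ^ d)))
      ≈⟨ solve 5 (λ a w v e p → a :* ((w :+ e) :* (v :* (v :* p)))
          := a :* (w :* v :* (v :* p)) :- a :* (p :* (:- (v :* v :* e)))) refl a w w⁻¹ (θ w) (w⁻¹ ^ d) ⟩
    a * (w * w⁻¹ * (w⁻¹ * w⁻¹ ^ d)) - a * (w⁻¹ ^ d * - (w⁻¹ * w⁻¹ * θ w))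
      ≈⟨ +-cong (*-congˡ (trans (*-congʳ w*w⁻¹) (*-identityˡ _))) (-‿cong (*-congˡ (*-congˡ (sym θw⁻¹)))) ⟩
    a * w⁻¹ ^ suc d - a * (w⁻¹ ^ d * θ w⁻¹)
      ≈⟨ +-congˡ (-‿cong (θ-^ w⁻¹ d)) ⟨
    a * w⁻¹ ^ suc d - θ (w⁻¹ ^ suc d) ∎
    where
    a : Series
    a = constant (K.↑ suc d)

  -- In degree d + 1 the operator θ is multiplication by d + 1, so the two terms of the exact form
  -- cancel; characteristic zero removes the remaining factor d + 1.
  residue-suc : ∀ d → residue (suc d) (suc d) K.≈ K.0#
  residue-suc d = cancel-↑ d (K.begin
    K.↑ suc d K.* residue (suc d) (suc d)
      K.≈⟨ constant-⊛ (K.↑ suc d) (residue (suc d)) (suc d) ⟨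
    (constant (K.↑ suc d) * residue (suc d)) (suc d)         K.≈⟨ at (residue-exact d) (suc d) ⟩
    (constant (K.↑ suc d) * w⁻¹ ^ suc d) (suc d) K.- K.↑ suc d K.* (w⁻¹ ^ suc d) (suc d)
      K.≈⟨ K.+-congʳ (constant-⊛ (K.↑ suc d) (w⁻¹ ^ suc d) (suc d)) ⟩
    K.↑ suc d K.* (w⁻¹ ^ suc d) (suc d) K.- K.↑ suc d K.* (w⁻¹ ^ suc d) (suc d)
      K.≈⟨ K.-‿inverseʳ _ ⟩
    K.0# K.∎)

  -- Under f, g ↦ [t²ⁿ⁻¹] f g, which pairs even with odd coefficients, b i is dual to
  -- a (2n - 1 - i).  Computing the determinant of A Z = Y in two ways amounts to
  -- Jacobi's identity for complementary minors.
  module Duality (m : ℕ) (α : K.Carrier) where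

    n : ℕ
    n = suc m

    a b : ℕ → Series
    a k = S α * M * σ ^ k
    b i = S (K.1# K.- α) * w⁻¹ ^ (n ℕ.+ n) * σ ^ i

    -- The factor w⁻²ⁿ of `b i` stands for t²ⁿ σ⁻²ⁿ, and the product of s^α, s^(1 - α) and M is σ′.
    -- Hence the coefficient of t²ⁿ⁻¹ is the residue of σ^(k + i - 2n) dσ, obtained without negative
    -- powers of t.
    a*b : ∀ k i → a k * b i ≈ X ^ (k ℕ.+ i) * ((w + θ w) * (w ^ (k ℕ.+ i) * w⁻¹ ^ (n ℕ.+ n)))
    a*b k i = begin
      S α * M * σ ^ k * (S (K.1# K.- α) * w⁻¹ ^ (n ℕ.+ n) * σ ^ i)
        ≈⟨ solve 6 (λ s m p s′ v q → s :* m :* p :* (s′ :* v :* q) := m :* (s :* s′) :* (p :* q) :* v)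
            refl (S α) M (σ ^ k) (S (K.1# K.- α)) (w⁻¹ ^ (n ℕ.+ n)) (σ ^ i) ⟩
      M * (S α * S (K.1# K.- α)) * (σ ^ k * σ ^ i) * w⁻¹ ^ (n ℕ.+ n)
        ≈⟨ *-congʳ (*-cong (*-congˡ (trans (S-+ α (K.1# K.- α)) (S-cong (solveᴷ 1 (λ a → a ⊞ (κᴷ 1 ⊟ a)
            ⊜ κᴷ 1) K.refl α)))) (sym (^-homo-* σ k i))) ⟩
      M * S K.1# * σ ^ (k ℕ.+ i) * w⁻¹ ^ (n ℕ.+ n)
        ≈⟨ *-congʳ (*-cong M*S₁ (σ^ (k ℕ.+ i))) ⟩
      (w + θ w) * (X ^ (k ℕ.+ i) * w ^ (k ℕ.+ i)) * w⁻¹ ^ (n ℕ.+ n)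
        ≈⟨ solve 4 (λ d x p v → d :* (x :* p) :* v := x :* (d :* (p :* v)))
            refl (w + θ w) (X ^ (k ℕ.+ i)) (w ^ (k ℕ.+ i)) (w⁻¹ ^ (n ℕ.+ n)) ⟩
      X ^ (k ℕ.+ i) * ((w + θ w) * (w ^ (k ℕ.+ i) * w⁻¹ ^ (n ℕ.+ n))) ∎

    cancelled : ∀ r d → suc (r ℕ.+ d) ≡ n ℕ.+ n → (w + θ w) * (w ^ r * w⁻¹ ^ (n ℕ.+ n)) ≈ residue d
    cancelled r d eq = *-congˡ (begin
      w ^ r * w⁻¹ ^ (n ℕ.+ n)
        ≡⟨ ≡.cong (λ e → w ^ r * w⁻¹ ^ e) (≡.trans (≡.sym eq) (≡.sym (ℕ.+-suc r d))) ⟩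
      w ^ r * w⁻¹ ^ (r ℕ.+ suc d)          ≈⟨ *-congˡ (^-homo-* w⁻¹ r (suc d)) ⟩
      w ^ r * (w⁻¹ ^ r * w⁻¹ ^ suc d)      ≈⟨ *-assoc _ _ _ ⟨
      w ^ r * w⁻¹ ^ r * w⁻¹ ^ suc d        ≈⟨ trans (*-congʳ (w^*w⁻¹^ r)) (*-identityˡ _) ⟩
      w⁻¹ ^ suc d                          ∎)

    pairing : ℕ → ℕ → K.Carrier
    pairing k i = (a k * b i) (m ℕ.+ n)

    pairing-at : ∀ k i d → suc (k ℕ.+ i ℕ.+ d) ≡ n ℕ.+ n → pairing k i K.≈ residue d d
    pairing-at k i d eq = K.begin
      (a k * b i) (m ℕ.+ n)
        K.≈⟨ at (trans (a*b k i) (*-congˡ (cancelled (k ℕ.+ i) d eq))) (m ℕ.+ n) ⟩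
      (X ^ (k ℕ.+ i) * residue d) (m ℕ.+ n)
        K.≡⟨ ≡.cong (X ^ (k ℕ.+ i) * residue d) (ℕ.suc-injective eq) ⟨
      (X ^ (k ℕ.+ i) * residue d) (k ℕ.+ i ℕ.+ d)
        K.≈⟨ X^-+ (k ℕ.+ i) (residue d) d ⟩
      residue d d K.∎

    pairing-1 : ∀ k i → suc (k ℕ.+ i) ≡ n ℕ.+ n → pairing k i K.≈ K.1#
    pairing-1 k i eq = K.trans (pairing-at k i 0 (≡.trans (≡.cong suc (ℕ.+-identityʳ (k ℕ.+ i))) eq))
        residue-0

    -- For k + i ≥ 2n the product is divisible by t²ⁿ, and for k + i < 2n - 1 the differential is
    -- exact.
    pairing-0 : ∀ k i → suc (k ℕ.+ i) ≢ n ℕ.+ n → pairing k i K.≈ K.0#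
    pairing-0 k i neq with suc (k ℕ.+ i) ℕ.<? n ℕ.+ n
    ... | no ≮ = K.trans (at (a*b k i) (m ℕ.+ n))
        (X^-low (k ℕ.+ i) _ (ℕ.s≤s⁻¹ (ℕ.≤∧≢⇒< (ℕ.≮⇒≥ ≮) (neq ∘ ≡.sym))))
    ... | yes k+i<2n with ℕ.m≤n⇒∃[o]m+o≡n k+i<2n
    ...   | d , eq = K.trans (pairing-at k i (suc d) (≡.trans (≡.cong suc (ℕ.+-suc (k ℕ.+ i) d)) eq))
        (residue-suc d)

    -- The powers of t are ordered as in even-odd.
    A Y Z : Matrixℕ
    A k   = even-odd n (a k)
    Z q   = blend n (δ q) (λ i → blend n (λ j → odd-part (b i) (m ∸ j)) (even-part (b i)) q)
    Y k   = blend n (even-part (a k)) (pairing k)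

    -- The series `a k` begins with t^k with coefficient 1, so in the natural order of the columns
    -- the matrix is unitriangular.
    Det-A : Det (n ℕ.+ n) A K.≈ K.1#
    Det-A = Det-even-odd n a
      (λ {k} {i} i<k → K.trans (at (as-power k) i) (X^-low k (S α * M * w ^ k) i<k))
      (λ k → K.trans (K.reflexive (≡.cong (a k) (≡.sym (ℕ.+-identityʳ k))))
          (K.trans (at (as-power k) (k ℕ.+ 0)) (K.trans (X^-+ k (S α * M * w ^ k) 0) (leading k))))
      where
      as-power : ∀ k → a k ≈ X ^ k * (S α * M * w ^ k)
      as-power k = trans (*-congˡ (σ^ k)) (solve 4 (λ s m x p → s :* m :* (x :* p) := x :* (s :* m :* p))
          refl (S α) M (X ^ k) (w ^ k))
      leading : ∀ k → (S α * M * w ^ k) 0 K.≈ K.1#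
      leading k = K.trans
        (K.*-cong (solveᴷ 0 (κᴷ 1 ⊠ κᴷ 1 ⊠ (κᴷ 1 ⊞ (κᴷ 0 ⊞ κᴷ 0) ⊠ κᴷ 1) ⊜ κᴷ 1) K.refl)
          (^-0 {w} (solveᴷ 0 ((κᴷ 1 ⊞ κᴷ 0) ⊠ κᴷ 1 ⊜ κᴷ 1) K.refl) k))
        (K.*-identityˡ _)

    Det-Z : Det (n ℕ.+ n) Z K.≈ Det n (λ i → even-part (b i))
    Det-Z = K.begin
      Det (n ℕ.+ n) Z
        K.≈⟨ Det-unit-columns n n Z (λ q {j} j<n → K.reflexive (blend-< n (δ q) _ j<n)) ⟩
      Det n (λ i j → Z (n ℕ.+ i) (n ℕ.+ j))
        K.≈⟨ Det-cong n {λ i j → Z (n ℕ.+ i) (n ℕ.+ j)} {λ i j → even-part (b j) i} (λ {i} {j} _ _ →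
            K.reflexive
               (≡.trans (blend-+ n (δ (n ℕ.+ i)) _ j) (blend-+ n (λ j′ → odd-part (b j) (m ∸ j′))
                   (even-part (b j)) i))) ⟩
      Det n (λ i j → even-part (b j) i)
        K.≈⟨ Det-transpose n (λ i → even-part (b i)) ⟩
      Det n (λ i → even-part (b i)) K.∎

    -- For k and i below n the sum k + i stays below 2n - 1, so the upper right block of pairings is
    -- zero. In the lower right block they are 1 on the antidiagonal and 0 elsewhere.
    Det-Y : Det (n ℕ.+ n) Y K.≈ derivedDet n α K.* sign n
    Det-Y = K.begin
      Det (n ℕ.+ n) Y
        K.≈⟨ Det-block n n Y (λ {i} {j} i<n j<n →
            K.trans (K.reflexive (blend-+ n (even-part (a i)) (pairing i) j))
               (pairing-0 i j (ℕ.<⇒≢ (ℕ.<-≤-trans (ℕ.s≤s (ℕ.+-monoʳ-< i j<n)) (ℕ.+-monoˡ-≤ n i<n))))) ⟩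
      Det n Y K.* Det n (λ i j → Y (n ℕ.+ i) (n ℕ.+ j))
        K.≈⟨ K.*-cong
               (Det-cong n {Y} {λ i → even-part (a i)} λ {i} _ j<n →
                   K.reflexive (blend-< n (even-part (a i)) (pairing i) j<n))
               (Det-antidiagonal n (λ i j → Y (n ℕ.+ i) (n ℕ.+ j))
                 (λ {i} {j} _ _ i+j≢ → K.trans (corner i j)
                     (pairing-0 (n ℕ.+ i) j (λ eq → i+j≢ (ℕ.+-cancelˡ-≡ n (suc (i ℕ.+ j)) n
                     (≡.trans (regroup i j) eq)))))
                 (λ {i} {j} i+j≡ → K.trans (corner i j) (pairing-1 (n ℕ.+ i) j
                     (≡.trans (≡.sym (regroup i j)) (≡.cong (n ℕ.+_) i+j≡))))) ⟩
      derivedDet n α K.* sign n K.∎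
      where
      corner : ∀ i j → Y (n ℕ.+ i) (n ℕ.+ j) K.≈ pairing (n ℕ.+ i) j
      corner i j = K.reflexive (blend-+ n (even-part (a (n ℕ.+ i))) (pairing (n ℕ.+ i)) j)
      regroup : ∀ i j → n ℕ.+ suc (i ℕ.+ j) ≡ suc (n ℕ.+ i ℕ.+ j)
      regroup i j = ≡.trans (ℕ.+-suc n (i ℕ.+ j)) (≡.cong suc (≡.sym (ℕ.+-assoc n i j)))

    -- For c < n, column c of Z is a unit vector and copies a column of even coefficients. Column n
    -- + i lists the coefficients of `b i` in complementary order, that of t^(2n - 1 - e) facing the
    -- one of t^e in `a k`, so that their product is the coefficient of t²ⁿ⁻¹ in `a k * b i`.
    A·Z : ∀ k c → c ℕ.< n ℕ.+ n → ∑ (n ℕ.+ n) (λ q → A k q K.* Z q c) K.≈ Y k c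
    A·Z k c c<2n with c ℕ.<? n
    ... | yes c<n = K.begin
      ∑ (n ℕ.+ n) (λ q → A k q K.* Z q c)
        K.≈⟨ ∑-cong (n ℕ.+ n) {λ q → A k q K.* Z q c} {λ q → A k q K.* δ q c} (λ {q} _ →
            K.*-congˡ (K.reflexive (blend-< n (δ q) _ c<n))) ⟩
      ∑ (n ℕ.+ n) (λ q → A k q K.* δ q c)
        K.≈⟨ ∑-δ (n ℕ.+ n) (A k) c<2n ⟩
      A k c
        K.≡⟨ ≡.trans (blend-< n (even-part (a k)) _ c<n)
            (≡.sym (blend-< n (even-part (a k)) (pairing k) c<n)) ⟩
      Y k c K.∎
    ... | no c≮n with ℕ.m≤n⇒∃[o]m+o≡n (ℕ.≮⇒≥ c≮n)
    ...   | i , ≡.refl = K.begin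
      ∑ (n ℕ.+ n) (λ q → A k q K.* Z q (n ℕ.+ i))
        K.≈⟨ ∑-cong (n ℕ.+ n) {λ q → A k q K.* Z q (n ℕ.+ i)} {λ q → A k q K.* blend n odd-b even-b q}
            (λ {q} _ → K.*-congˡ (K.reflexive (blend-+ n (δ q) _ i))) ⟩
      ∑ (n ℕ.+ n) (λ q → blend n even-a odd-a q K.* blend n odd-b even-b q)
        K.≈⟨ blend-sum n n even-a odd-a odd-b even-b ⟩
      ∑ n (λ j → even-a j K.* odd-b j) K.+ ∑ n (λ j → odd-a j K.* even-b j)
        K.≈⟨ K.+-cong (K.sym (⊛-∑ m even-a (odd-part (b i))))
               (K.trans (∑-cong n {λ j → odd-a j K.* even-b j} {λ j → even-b j K.* odd-a j} (λ _ →
                   K.*-comm _ _)) (K.sym (⊛-∑ m even-b (odd-part (a k))))) ⟩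
      (even-a * odd-part (b i)) m K.+ (even-b * odd-part (a k)) m
        K.≈⟨ K.+-congˡ (⊛-comm even-b (odd-part (a k)) m) ⟩
      (even-a * odd-part (b i)) m K.+ (odd-part (a k) * even-b) m
        K.≈⟨ odd-part-⊛ (a k) (b i) m ⟨
      odd-part (a k * b i) m
        K.≈⟨ even-part-at (tail (a k * b i)) m ⟩
      (a k * b i) (suc (2 ℕ.* m))
        K.≡⟨ ≡.cong (a k * b i) (≡.trans (≡.cong (λ e → suc (m ℕ.+ e)) (ℕ.+-identityʳ m))
            (≡.sym (ℕ.+-suc m m))) ⟩
      pairing k i
        K.≡⟨ blend-+ n (even-part (a k)) (pairing k) i ⟨
      Y k (n ℕ.+ i) K.∎
      where
      even-a odd-a odd-b even-b : ℕ → K.Carrier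
      even-a  = even-part (a k)
      odd-a j = odd-part (a k) (m ∸ j)
      odd-b j = odd-part (b i) (m ∸ j)
      even-b  = even-part (b i)

    -- Trading w⁻²ⁿ for s⁻⁴ⁿ and an even factor brings the dual family back to the form s^β σⁱ. This
    -- is where the 4n in the reflected exponent comes from.
    Det-b : Det n (λ i → even-part (b i)) K.≈ evenDet n (K.1# K.- α K.+ K.↑ (n ℕ.+ n) K.* K.- 2ᴷ)
    Det-b = K.trans
      (Det-cong n {λ i → even-part (b i)} {λ i → even-part (S β * σ ^ i * η ^ (n ℕ.+ n))} λ {i} {j} _ _ →
          even-cong (rewritten i) j)
      (Det-even-part-⊛ n (λ i → S β * σ ^ i) {η ^ (n ℕ.+ n)} (^-even {η} η-even (n ℕ.+ n))
          (^-0 {η} η-0 (n ℕ.+ n)))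
      where
      β : K.Carrier
      β = K.1# K.- α K.+ K.↑ (n ℕ.+ n) K.* K.- 2ᴷ
      rewritten : ∀ i → b i ≈ S β * σ ^ i * η ^ (n ℕ.+ n)
      rewritten i = begin
        S (K.1# K.- α) * w⁻¹ ^ (n ℕ.+ n) * σ ^ i
          ≈⟨ *-congʳ (*-congˡ (trans (^-congˡ (n ℕ.+ n) w⁻¹≈η*S)
              (trans (^-distrib-* η (S (K.- 2ᴷ)) (n ℕ.+ n)) (*-congˡ (S-^ (K.- 2ᴷ) (n ℕ.+ n)))))) ⟩
        S (K.1# K.- α) * (η ^ (n ℕ.+ n) * S (K.↑ (n ℕ.+ n) K.* K.- 2ᴷ)) * σ ^ i
          ≈⟨ solve 4 (λ s e s′ p → s :* (e :* s′) :* p := s :* s′ :* p :* e)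
              refl (S (K.1# K.- α)) (η ^ (n ℕ.+ n)) (S (K.↑ (n ℕ.+ n) K.* K.- 2ᴷ)) (σ ^ i) ⟩
        S (K.1# K.- α) * S (K.↑ (n ℕ.+ n) K.* K.- 2ᴷ) * σ ^ i * η ^ (n ℕ.+ n)
          ≈⟨ *-congʳ (*-congʳ (S-+ (K.1# K.- α) (K.↑ (n ℕ.+ n) K.* K.- 2ᴷ))) ⟩
        S β * σ ^ i * η ^ (n ℕ.+ n) ∎

    duality : derivedDet n α K.* sign n K.≈ evenDet n (K.1# K.- α K.+ K.↑ (n ℕ.+ n) K.* K.- 2ᴷ)
    duality = K.begin
      derivedDet n α K.* sign n                       K.≈⟨ Det-Y ⟨
      Det (n ℕ.+ n) Y
        K.≈⟨ Det-cong (n ℕ.+ n) {λ k c → ∑ (n ℕ.+ n) (λ q → A k q K.* Z q c)} {Y} (λ {k} {c} _ c<2n →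
            A·Z k c c<2n) ⟨
      Det (n ℕ.+ n) (λ k c → ∑ (n ℕ.+ n) (λ q → A k q K.* Z q c))  K.≈⟨ Det-· (n ℕ.+ n) A Z ⟩
      Det (n ℕ.+ n) A K.* Det (n ℕ.+ n) Z             K.≈⟨ K.*-cong Det-A (K.trans Det-Z Det-b) ⟩
      K.1# K.* evenDet n (K.1# K.- α K.+ K.↑ (n ℕ.+ n) K.* K.- 2ᴷ)  K.≈⟨ K.*-identityˡ _ ⟩
      evenDet n (K.1# K.- α K.+ K.↑ (n ℕ.+ n) K.* K.- 2ᴷ) K.∎

  derivedDet-dual : ∀ n α → derivedDet n α K.* sign n
      K.≈ evenDet n (K.1# K.- α K.+ K.↑ (n ℕ.+ n) K.* K.- 2ᴷ)
  derivedDet-dual zero    α = K.*-identityˡ _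
  derivedDet-dual (suc m) α = Duality.duality m α

  -- From the binomial entries to powers of s

  ↑-nonzero : ∀ n → .{{ℕ.NonZero n}} → ¬ (K.↑ n K.≈ K.0#)
  ↑-nonzero (suc n) = char0 n

  -- The coefficient of t^p in (1 - t)^(-y - 1) has the numerator (y + 1)(y + 2)⋯(y + p), which is
  -- the falling product of the binomial read backwards: a new factor y + p + 1 is appended to the
  -- one and prepended to the other.
  binomial-U : ∀ y p → K.binomial (y K.+ K.↑ p) (+ p) K.≈ U (y K.+ K.1#) p
  binomial-U y p = K.begin
    P p K.* (K.↑ (p !)) K.⁻¹                               K.≈⟨ K.*-congʳ (falling p) ⟨
    U (y K.+ K.1#) p K.* K.↑ (p !) K.* (K.↑ (p !)) K.⁻¹    K.≈⟨ K.*-assoc _ _ _ ⟩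
    U (y K.+ K.1#) p K.* (K.↑ (p !) K.* (K.↑ (p !)) K.⁻¹)
      K.≈⟨ K.*-congˡ (K.inverseʳ (↑-nonzero (p !) {{ℕ._!≢0 p}})) ⟩
    U (y K.+ K.1#) p K.* K.1#                              K.≈⟨ K.*-identityʳ _ ⟩
    U (y K.+ K.1#) p                                       K.∎
    where
    P : ℕ → K.Carrier
    P p = K.∏ p (λ k → y K.+ K.↑ p K.- K.↑ k)
    falling : ∀ p → U (y K.+ K.1#) p K.* K.↑ (p !) K.≈ P p
    falling zero    = solveᴷ 0 (κᴷ 1 ⊠ (κᴷ 1 ⊞ κᴷ 0) ⊜ κᴷ 1) K.refl
    falling (suc p) = K.begin
      u K.* (y K.+ K.1# K.+ K.↑ p) K.* (K.↑ suc p) K.⁻¹ K.* K.↑ (suc p ℕ.* p !)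
        K.≈⟨ K.*-congˡ (×1-homo-* (suc p) (p !)) ⟩
      u K.* (y K.+ K.1# K.+ K.↑ p) K.* (K.↑ suc p) K.⁻¹ K.* (K.↑ suc p K.* K.↑ (p !))
        K.≈⟨ solveᴷ 6 (λ u y q i n f → u ⊠ (y ⊞ κᴷ 1 ⊞ q) ⊠ i ⊠ (n ⊠ f)
               ⊜ n ⊠ i ⊠ ((y ⊞ (κᴷ 1 ⊞ q) ⊟ κᴷ 0) ⊠ (u ⊠ f)))
                   K.refl u y (K.↑ p) ((K.↑ suc p) K.⁻¹) (K.↑ suc p) (K.↑ (p !)) ⟩
      K.↑ suc p K.* (K.↑ suc p) K.⁻¹ K.* ((y K.+ K.↑ suc p K.- K.↑ 0) K.* (u K.* K.↑ (p !)))
        K.≈⟨ K.trans (K.*-congʳ (↑≉0 p)) (K.*-identityˡ _) ⟩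
      (y K.+ K.↑ suc p K.- K.↑ 0) K.* (u K.* K.↑ (p !))
        K.≈⟨ K.*-congˡ (falling p) ⟩
      (y K.+ K.↑ suc p K.- K.↑ 0) K.* P p
        K.≈⟨ K.*-congˡ (∏-cong p λ {k} _ → solveᴷ 3 (λ y p k → y ⊞ p ⊟ k
            ⊜ y ⊞ (κᴷ 1 ⊞ p) ⊟ (κᴷ 1 ⊞ k)) K.refl y (K.↑ p) (K.↑ k)) ⟩
      P (suc p) K.∎
      where
      u : K.Carrier
      u = U (y K.+ K.1#) p

  constant-* : ∀ a b → constant (a K.* b) ≈ constant a * constant b
  constant-* a b = coefficientwise λ where
    zero    → K.refl
    (suc n) → K.sym (K.trans (constant-⊛ a (constant b) (suc n)) (K.zeroʳ a))

  two three : Series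
  two   = 1# + 1#
  three = 1# + two

  -- aⁱ + bⁱ for a = 2 / (1 - t) and b = 1 - t, where a b = 2 and a + b = σ + 3
  powerSum : ℕ → Series
  powerSum i = (two * U K.1#) ^ i + U (K.- K.1#) ^ i

  sum-of-roots : two * U K.1# + U (K.- K.1#) ≈ σ + three
  sum-of-roots = begin
    two * U K.1# + U (K.- K.1#)                       ≈⟨ +-congˡ (trans U-[-1] (sym (*-identityʳ _))) ⟩
    two * U K.1# + (1# - X) * 1#                      ≈⟨ +-congˡ (*-congˡ U-inverse) ⟨
    two * U K.1# + (1# - X) * (U K.1# * (1# - X))
      ≈⟨ solve 2 (λ x u → (κ 1 :+ κ 1) :* u :+ (κ 1 :- x) :* (u :* (κ 1 :- x))
                       := x :* ((κ 1 :+ x) :* u) :+ (κ 1 :+ (κ 1 :+ κ 1)) :* (u :* (κ 1 :- x)))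
                           refl X (U K.1#) ⟩
    X * w + three * (U K.1# * (1# - X))
      ≈⟨ +-cong (sym σ≈X*w) (trans (*-congˡ U-inverse) (*-identityʳ three)) ⟩
    σ + three                                         ∎

  -- The series a and b are the roots of z² - (σ + 3) z + 2.
  powerSum-recurrence : ∀ i → powerSum (suc (suc i))
      ≈ σ * powerSum (suc i) + three * powerSum (suc i) - two * powerSum i
  powerSum-recurrence i = begin
    a * (a * p) + b * (b * q)
      ≈⟨ solve 4 (λ a b p q → a :* (a :* p) :+ b :* (b :* q)
          := (a :+ b) :* (a :* p :+ b :* q) :- a :* b :* (p :+ q)) refl a b p q ⟩
    (a + b) * (a * p + b * q) - a * b * (p + q)
      ≈⟨ +-cong (*-congʳ sum-of-roots) (-‿cong (*-congʳ a*b)) ⟩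
    (σ + three) * (a * p + b * q) - two * (p + q)
      ≈⟨ +-congʳ (distribʳ _ σ three) ⟩
    σ * powerSum (suc i) + three * powerSum (suc i) - two * powerSum i ∎
    where
    a b p q : Series
    a = two * U K.1#
    b = U (K.- K.1#)
    p = a ^ i
    q = b ^ i
    a*b : a * b ≈ two
    a*b = begin
      two * U K.1# * U (K.- K.1#)     ≈⟨ *-congˡ U-[-1] ⟩
      two * U K.1# * (1# - X)         ≈⟨ *-assoc _ _ _ ⟩
      two * (U K.1# * (1# - X))       ≈⟨ *-congˡ U-inverse ⟩
      two * 1#                        ≈⟨ *-identityʳ two ⟩
      two                             ∎

  3ᴷ : K.Carrier
  3ᴷ = K.1# K.+ 2ᴷ

  -- The coefficients of powerSum i as a polynomial in σ.
  C : Matrixℕ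
  C 0 0                   = 2ᴷ
  C 0 (suc k)             = K.0#
  C 1 0                   = 3ᴷ
  C 1 1                   = K.1#
  C 1 (suc (suc k))       = K.0#
  C (suc (suc i)) zero    = 3ᴷ K.* C (suc i) zero K.- 2ᴷ K.* C i zero
  C (suc (suc i)) (suc k) =
    C (suc i) k K.+ 3ᴷ K.* C (suc i) (suc k) K.- 2ᴷ K.* C i (suc k)

  C-above : ∀ i k → i ℕ.< k → C i k K.≈ K.0#
  C-above 0 (suc k) _ = K.refl
  C-above 1 1 (s≤s ())
  C-above 1 (suc (suc k)) _ = K.refl
  C-above (suc (suc i)) (suc k) (s≤s i<k) = K.begin
    C (suc i) k K.+ 3ᴷ K.* C (suc i) (suc k) K.- 2ᴷ K.* C i (suc k)
      K.≈⟨ K.+-cong (K.+-cong (C-above (suc i) k i<k)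
          (K.*-congˡ (C-above (suc i) (suc k) (ℕ.m<n⇒m<1+n i<k))))
             (K.-‿cong (K.*-congˡ (C-above i (suc k) (ℕ.m<n⇒m<1+n (ℕ.<-trans (ℕ.n<1+n i) i<k))))) ⟩
    K.0# K.+ 3ᴷ K.* K.0# K.- 2ᴷ K.* K.0#
      K.≈⟨ solveᴷ 2 (λ a b → κᴷ 0 ⊞ a ⊠ κᴷ 0 ⊟ b ⊠ κᴷ 0 ⊜ κᴷ 0) K.refl 3ᴷ 2ᴷ ⟩
    K.0# K.∎

  C-diagonal : ∀ i → C (suc i) (suc i) K.≈ K.1#
  C-diagonal zero    = K.refl
  C-diagonal (suc i) = K.begin
    C (suc i) (suc i) K.+ 3ᴷ K.* C (suc i) (suc (suc i)) K.- 2ᴷ K.* C i (suc (suc i))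
      K.≈⟨ K.+-cong (K.+-cong (C-diagonal i) (K.*-congˡ (C-above (suc i) (suc (suc i)) ℕ.≤-refl)))
             (K.-‿cong (K.*-congˡ (C-above i (suc (suc i)) (ℕ.m<n⇒m<1+n (ℕ.n<1+n i))))) ⟩
    K.1# K.+ 3ᴷ K.* K.0# K.- 2ᴷ K.* K.0#
      K.≈⟨ solveᴷ 2 (λ a b → κᴷ 1 ⊞ a ⊠ κᴷ 0 ⊟ b ⊠ κᴷ 0 ⊜ κᴷ 1) K.refl 3ᴷ 2ᴷ ⟩
    K.1# K.∎

  Det-C : ∀ n → Det (suc n) C K.≈ 2ᴷ
  Det-C n = K.trans (Det-lower (suc n) C (λ {i} {k} → C-above i k))
    (K.trans (K.*-congˡ (∏-1 n {λ i → C (suc i) (suc i)} λ {i} _ → C-diagonal i)) (K.*-identityʳ _))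

  private
    *-two : ∀ f n → (f * two) n K.≈ 2ᴷ K.* f n
    *-two f n = K.trans (at (trans (*-comm f two) (*-congʳ (sym (constant-+ K.1# K.1#)))) n)
        (constant-⊛ 2ᴷ f n)

    *-three : ∀ f n → (f * three) n K.≈ 3ᴷ K.* f n
    *-three f n = K.trans (at (trans (*-comm f three)
        (*-congʳ (trans (+-congˡ (sym (constant-+ K.1# K.1#))) (sym (constant-+ K.1# 2ᴷ))))) n)
        (constant-⊛ 3ᴷ f n)

  -- The sum runs to an arbitrary bound N above i, so that all rows share one range and the
  -- expansion is a matrix product. The factor f is arbitrary because the recurrence replaces it by
  -- `f * σ`.
  powerSum-expansion : ∀ i N → i ℕ.< N → ∀ f n → (f * powerSum i) n K.≈ ∑ N (λ k → C i k K.* (f * σ ^ k) n)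
  powerSum-expansion 0 (suc N) _ f n = K.begin
    (f * two) n                                                         K.≈⟨ *-two f n ⟩
    2ᴷ K.* f n
      K.≈⟨ K.*-congˡ (at (*-identityʳ f) n) ⟨
    2ᴷ K.* (f * 1#) n                                                   K.≈⟨ K.+-identityʳ _ ⟨
    2ᴷ K.* (f * 1#) n K.+ K.0#
      K.≈⟨ K.+-congˡ (∑-zero N {λ k → K.0# K.* (f * σ ^ suc k) n} λ _ → K.zeroˡ _) ⟨
    ∑ (suc N) (λ k → C 0 k K.* (f * σ ^ k) n)                           K.∎
  powerSum-expansion 1 (suc zero) (s≤s ()) f n
  powerSum-expansion 1 (suc (suc N)) _ f n = K.begin
    (f * powerSum 1) n                                                  K.≈⟨ at split n ⟩
    (f * three + f * σ ^ 1) n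
      K.≈⟨ K.+-cong (K.trans (*-three f n) (K.*-congˡ (K.sym (at (*-identityʳ f) n))))
          (K.sym (K.*-identityˡ _)) ⟩
    3ᴷ K.* (f * 1#) n K.+ K.1# K.* (f * σ ^ 1) n                        K.≈⟨ K.+-congˡ (K.+-identityʳ _) ⟨
    3ᴷ K.* (f * 1#) n K.+ (K.1# K.* (f * σ ^ 1) n K.+ K.0#)
      K.≈⟨ K.+-congˡ (K.+-congˡ (∑-zero N {λ k → K.0# K.* (f * σ ^ suc (suc k)) n} λ _ → K.zeroˡ _)) ⟨
    ∑ (suc (suc N)) (λ k → C 1 k K.* (f * σ ^ k) n)                     K.∎
    where
    split : f * powerSum 1 ≈ f * three + f * σ ^ 1
    split = begin
      f * (two * U K.1# * 1# + U (K.- K.1#) * 1#)     ≈⟨ *-congˡ (+-cong (*-identityʳ _) (*-identityʳ _)) ⟩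
      f * (two * U K.1# + U (K.- K.1#))               ≈⟨ *-congˡ sum-of-roots ⟩
      f * (σ + three)
        ≈⟨ solve 3 (λ f s t → f :* (s :+ t) := f :* t :+ f :* (s :* κ 1)) refl f σ three ⟩
      f * three + f * σ ^ 1                           ∎
  powerSum-expansion (suc (suc i)) (suc N) (s≤s i<N) f n = K.begin
    (f * powerSum (suc (suc i))) n
      K.≈⟨ at expand n ⟩
    (f * σ * powerSum (suc i) + f * powerSum (suc i) * three - f * powerSum i * two) n
      K.≈⟨ K.+-cong (K.+-cong
             (K.trans (powerSum-expansion (suc i) N i<N (f * σ) n)
                 (∑-cong N {λ k → C (suc i) k K.* (f * σ * σ ^ k) n} {λ k → C (suc i) k K.* h (suc k)}
                 (λ {k} _ → K.*-congˡ (at (*-assoc f σ (σ ^ k)) n))))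
             (K.trans (*-three (f * powerSum (suc i)) n)
                 (K.*-congˡ (powerSum-expansion (suc i) (suc N) (ℕ.m<n⇒m<1+n i<N) f n))))
             (K.-‿cong (K.trans (*-two (f * powerSum i) n)
                 (K.*-congˡ (powerSum-expansion i (suc N) (ℕ.m<n⇒m<1+n (ℕ.<-trans (ℕ.n<1+n i) i<N)) f
                 n)))) ⟩
    ∑ N (λ k → C (suc i) k K.* h (suc k)) K.+ 3ᴷ K.* ∑ (suc N) (λ k → C (suc i) k K.* h k) K.- 2ᴷ
        K.* ∑ (suc N) (λ k → C i k K.* h k)
      K.≈⟨ solveᴷ 8 (λ p t a x q b d r → p ⊞ t ⊠ (a ⊠ x ⊞ q) ⊟ d ⊠ (b ⊠ x ⊞ r)
             ⊜ (t ⊠ a ⊟ d ⊠ b) ⊠ x ⊞ (p ⊞ t ⊠ q ⊟ d ⊠ r)) K.refl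
           (∑ N (λ k → C (suc i) k K.* h (suc k))) 3ᴷ (C (suc i) 0) (h 0)
               (∑ N (λ k → C (suc i) (suc k) K.* h (suc k)))
               (C i 0) 2ᴷ (∑ N (λ k → C i (suc k) K.* h (suc k))) ⟩
    C (suc (suc i)) 0 K.* h 0 K.+ (∑ N (λ k → C (suc i) k K.* h (suc k)) K.+ 3ᴷ
        K.* ∑ N (λ k → C (suc i) (suc k) K.* h (suc k)) K.- 2ᴷ K.* ∑ N (λ k → C i (suc k) K.* h (suc k)))
      K.≈⟨ K.+-congˡ (combine N (C (suc i)) (C (suc i) ∘ suc) (C i ∘ suc) (h ∘ suc)) ⟩
    ∑ (suc N) (λ k → C (suc (suc i)) k K.* h k) K.∎
    where
    h : ℕ → K.Carrier
    h k = (f * σ ^ k) n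
    expand : f * powerSum (suc (suc i)) ≈ f * σ * powerSum (suc i) + f * powerSum (suc i) * three - f
        * powerSum i * two
    expand = trans (*-congˡ (powerSum-recurrence i))
      (solve 6 (λ f s t d p q → f :* (s :* p :+ t :* p :- d :* q)
          := f :* s :* p :+ f :* p :* t :- f :* q :* d) refl f σ three two (powerSum (suc i)) (powerSum i))
    combine : ∀ N (a b d x : ℕ → K.Carrier) →
      ∑ N (λ k → a k K.* x k) K.+ 3ᴷ K.* ∑ N (λ k → b k K.* x k) K.- 2ᴷ K.* ∑ N (λ k → d k K.* x k)
      K.≈ ∑ N (λ k → (a k K.+ 3ᴷ K.* b k K.- 2ᴷ K.* d k) K.* x k)
    combine zero    a b d x = solveᴷ 2 (λ t d → κᴷ 0 ⊞ t ⊠ κᴷ 0 ⊟ d ⊠ κᴷ 0 ⊜ κᴷ 0) K.refl 3ᴷ 2ᴷ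
    combine (suc N) a b d x = K.trans
      (solveᴷ 9 (λ t e a x p b q d r → (a ⊠ x ⊞ p) ⊞ t ⊠ (b ⊠ x ⊞ q) ⊟ e ⊠ (d ⊠ x ⊞ r)
               ⊜ (a ⊞ t ⊠ b ⊟ e ⊠ d) ⊠ x ⊞ (p ⊞ t ⊠ q ⊟ e ⊠ r)) K.refl
         3ᴷ 2ᴷ (a 0) (x 0) (∑ N (λ k → a (suc k) K.* x (suc k))) (b 0)
             (∑ N (λ k → b (suc k) K.* x (suc k))) (d 0) (∑ N (λ k → d (suc k) K.* x (suc k))))
      (K.+-congˡ (combine N (a ∘ suc) (b ∘ suc) (d ∘ suc) (x ∘ suc)))

  -- For α = x + 1 this is the generating function of the first summand in row i; `U*U[-1]^` treats
  -- the second one.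
  U*[2U]^ : ∀ α i → U α * (two * U K.1#) ^ i ≈ constant (K.↑ 2 K.^ i) * U (α K.+ K.↑ i)
  U*[2U]^ α zero    = trans (*-comm (U α) 1#) (*-congˡ (U-cong (K.sym (K.+-identityʳ α))))
  U*[2U]^ α (suc i) = begin
    U α * (two * U K.1# * (two * U K.1#) ^ i)
      ≈⟨ solve 4 (λ u d v p → u :* (d :* v :* p) := d :* v :* (u :* p))
          refl (U α) two (U K.1#) ((two * U K.1#) ^ i) ⟩
    two * U K.1# * (U α * (two * U K.1#) ^ i)
      ≈⟨ *-congˡ (U*[2U]^ α i) ⟩
    two * U K.1# * (constant (K.↑ 2 K.^ i) * U (α K.+ K.↑ i))
      ≈⟨ solve 4 (λ d u c v → d :* u :* (c :* v) := d :* c :* (v :* u))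
          refl two (U K.1#) (constant (K.↑ 2 K.^ i)) (U (α K.+ K.↑ i)) ⟩
    two * constant (K.↑ 2 K.^ i) * (U (α K.+ K.↑ i) * U K.1#)
      ≈⟨ *-cong (trans (*-congʳ two≈) (sym (constant-* (K.↑ 2) (K.↑ 2 K.^ i))))
           (trans (U-+ (α K.+ K.↑ i) K.1#) (U-cong (solveᴷ 2 (λ a m → a ⊞ m ⊞ κᴷ 1
               ⊜ a ⊞ (κᴷ 1 ⊞ m)) K.refl α (K.↑ i)))) ⟩
    constant (K.↑ 2 K.^ suc i) * U (α K.+ K.↑ suc i) ∎
    where
    two≈ : two ≈ constant (K.↑ 2)
    two≈ = trans (sym (constant-+ K.1# K.1#)) (constant-cong (K.+-congˡ (K.sym (K.+-identityʳ _))))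

  U*U[-1]^ : ∀ α i → U α * U (K.- K.1#) ^ i ≈ U (α K.- K.↑ i)
  U*U[-1]^ α zero    = trans (*-identityʳ (U α)) (U-cong (solveᴷ 1 (λ a → a ⊜ a ⊟ κᴷ 0) K.refl α))
  U*U[-1]^ α (suc i) = begin
    U α * (U (K.- K.1#) * U (K.- K.1#) ^ i)
      ≈⟨ solve 3 (λ u v p → u :* (v :* p) := v :* (u :* p)) refl (U α) (U (K.- K.1#)) (U (K.- K.1#) ^ i) ⟩
    U (K.- K.1#) * (U α * U (K.- K.1#) ^ i)     ≈⟨ *-congˡ (U*U[-1]^ α i) ⟩
    U (K.- K.1#) * U (α K.- K.↑ i)              ≈⟨ U-+ (K.- K.1#) (α K.- K.↑ i) ⟩
    U (K.- K.1# K.+ (α K.- K.↑ i))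
      ≈⟨ U-cong (solveᴷ 2 (λ a m → ⊟ κᴷ 1 ⊞ (a ⊟ m) ⊜ a ⊟ (κᴷ 1 ⊞ m)) K.refl α (K.↑ i)) ⟩
    U (α K.- K.↑ suc i)                         ∎

  D₃-evenDet : ∀ n x → K.D₃ (suc n) x K.≈ K.↑ 2 K.* evenDet (suc n) (x K.+ K.1#)
  D₃-evenDet n x = K.begin
    Det (suc n) entry
      K.≈⟨ Det-cong (suc n) {entry} {λ i j → ∑ (suc n) (λ k → C i k K.* H k j)} (λ {i} {j} i<n _ →
          entry-expansion i j i<n) ⟩
    Det (suc n) (λ i j → ∑ (suc n) (λ k → C i k K.* H k j))
      K.≈⟨ Det-· (suc n) C H ⟩
    Det (suc n) C K.* Det (suc n) H
      K.≈⟨ K.*-cong (K.trans (Det-C n) (K.+-congˡ (K.sym (K.+-identityʳ _)))) H-evenDet ⟩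
    K.↑ 2 K.* evenDet (suc n) (x K.+ K.1#) K.∎
    where
    α : K.Carrier
    α = x K.+ K.1#
    entry H : Matrixℕ
    entry i j = (K.↑ 2) K.^ i K.* K.binomial (x K.+ K.↑ i K.+ K.↑ (2 ℕ.* j)) (+ (2 ℕ.* j))
      K.+ K.binomial (x K.- K.↑ i K.+ K.↑ (2 ℕ.* j)) (+ (2 ℕ.* j))
    H k = even-part (U α * σ ^ k)
    entry-expansion : ∀ i j → i ℕ.< suc n → entry i j K.≈ ∑ (suc n) (λ k → C i k K.* H k j)
    entry-expansion i j i<n = K.begin
      entry i j
        K.≈⟨ K.+-cong (K.*-congˡ (K.trans (binomial-U (x K.+ K.↑ i) p)
            (at (U-cong (solveᴷ 2 (λ x m → x ⊞ m ⊞ κᴷ 1 ⊜ x ⊞ κᴷ 1 ⊞ m) K.refl x (K.↑ i))) p)))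
               (K.trans (binomial-U (x K.- K.↑ i) p) (at (U-cong (solveᴷ 2 (λ x m → x ⊟ m ⊞ κᴷ 1
                   ⊜ x ⊞ κᴷ 1 ⊟ m) K.refl x (K.↑ i))) p)) ⟩
      (K.↑ 2) K.^ i K.* U (α K.+ K.↑ i) p K.+ U (α K.- K.↑ i) p
        K.≈⟨ K.+-congʳ (constant-⊛ ((K.↑ 2) K.^ i) (U (α K.+ K.↑ i)) p) ⟨
      (constant (K.↑ 2 K.^ i) * U (α K.+ K.↑ i) + U (α K.- K.↑ i)) p
        K.≈⟨ at (trans (distribˡ (U α) _ _) (+-cong (U*[2U]^ α i) (U*U[-1]^ α i))) p ⟨
      (U α * powerSum i) p
        K.≈⟨ powerSum-expansion i (suc n) i<n (U α) p ⟩
      ∑ (suc n) (λ k → C i k K.* (U α * σ ^ k) p)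
        K.≈⟨ ∑-cong (suc n) {λ k → C i k K.* H k j} {λ k → C i k K.* (U α * σ ^ k) p} (λ {k} _ →
            K.*-congˡ (even-part-at (U α * σ ^ k) j)) ⟨
      ∑ (suc n) (λ k → C i k K.* H k j) K.∎
      where
      p : ℕ
      p = 2 ℕ.* j
    -- Up to the even series (1 + t²)^(-α), which the determinant does not see, (1 - t)^(-α) is s^α.
    U≈S*V : ∀ k → U α * σ ^ k ≈ S α * σ ^ k * V (K.- α)
    U≈S*V k = begin
      U α * σ ^ k                          ≈⟨ *-congʳ (*-identityʳ (U α)) ⟨
      U α * 1# * σ ^ k                     ≈⟨ *-congʳ (*-congˡ (V-inverse α)) ⟨
      U α * (V (K.- α) * V α) * σ ^ k
        ≈⟨ solve 4 (λ u v v′ p → u :* (v′ :* v) :* p := u :* v :* p :* v′)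
            refl (U α) (V α) (V (K.- α)) (σ ^ k) ⟩
      S α * σ ^ k * V (K.- α)              ∎
    H-evenDet : Det (suc n) H K.≈ evenDet (suc n) α
    H-evenDet = K.trans
      (Det-cong (suc n) {H} {λ k → even-part (S α * σ ^ k * V (K.- α))} λ {k} {j} _ _ →
          even-cong (U≈S*V k) j)
      (Det-even-part-⊛ (suc n) (λ k → S α * σ ^ k) {V (K.- α)} (V-even (K.- α)) K.refl)

open import Data.Nat.Combinatorics using (_C_; nCk+nC[k+1]≡[n+1]C[k+1]; nC1≡n)

-- The recursion for the determinant

module ClosedForms {c ℓ} (K : Field c ℓ) (char0 : CharacteristicZero K) where

  open FieldDefs K
  open Determinant K using (∏-cong)
  open Series K using (sign)
  open Powers K char0
    using (evenDet; oddDet; derivedDet; evenDet-cong; evenDet-suc; oddDet-derived; derivedDet-dual;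
        ↑-nonzero)
  open SetoidReasoning setoid
  open IntegerSolver commutativeRing
  open SemiringMult semiring using (×1-homo-*; ×-homo-+)
  open Exp semiring using (^-homo-*)

  ↑-+ : ∀ m n → ↑ (m ℕ.+ n) ≈ ↑ m + ↑ n
  ↑-+ m n = ×-homo-+ 1# m n

  ↑-* : ∀ m n → ↑ (m ℕ.* n) ≈ ↑ m * ↑ n
  ↑-* = ×1-homo-*

  *-cancelˡ : ∀ {a b d} → ¬ (a ≈ 0#) → a * b ≈ a * d → b ≈ d
  *-cancelˡ {a} {b} {d} a≉0 h = begin
    b                ≈⟨ undo b ⟨
    a ⁻¹ * (a * b)   ≈⟨ *-congˡ h ⟩
    a ⁻¹ * (a * d)   ≈⟨ undo d ⟩
    d                ∎
    where
    undo : ∀ y → a ⁻¹ * (a * y) ≈ y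
    undo y = begin
      a ⁻¹ * (a * y)   ≈⟨ solve 3 (λ i a y → i :* (a :* y) := a :* i :* y) refl (a ⁻¹) a y ⟩
      a * a ⁻¹ * y     ≈⟨ *-congʳ (inverseʳ a≉0) ⟩
      1# * y           ≈⟨ *-identityˡ y ⟩
      y                ∎

  *-nonzero : ∀ {a b} → ¬ (a ≈ 0#) → ¬ (b ≈ 0#) → ¬ (a * b ≈ 0#)
  *-nonzero a≉0 b≉0 ab≈0 = b≉0 (*-cancelˡ a≉0 (trans ab≈0 (sym (zeroʳ _))))

  ∏-nonzero : ∀ n {f} → (∀ i → ¬ (f i ≈ 0#)) → ¬ (∏ n f ≈ 0#)
  ∏-nonzero zero    h = 1≉0
  ∏-nonzero (suc n) h = *-nonzero (h 0) (∏-nonzero n (h ∘ suc))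

  ∏-last : ∀ n f → ∏ (suc n) f ≈ ∏ n f * f n
  ∏-last zero    f = *-comm _ _
  ∏-last (suc n) f = trans (*-congˡ (∏-last n (f ∘ suc))) (sym (*-assoc _ _ _))

  pochhammer-cong : ∀ n {α β} → α ≈ β → pochhammer α n ≈ pochhammer β n
  pochhammer-cong n h = ∏-cong n λ {k} _ → +-congʳ {x = ↑ k} h

  pochhammer-first : ∀ α n → pochhammer α (suc n) ≈ α * pochhammer (α + 1#) n
  pochhammer-first α n = *-cong (+-identityʳ α) (∏-cong n λ {k} _ → sym (+-assoc α 1# (↑ k)))

  -- The factors on the left are those of the symbol on the right, negated and in reverse order.
  -- This undoes the reflection that a recursion step leaves in the argument.
  pochhammer-reflect : ∀ n β → pochhammer (1# - (β + ↑ n)) n ≈ (- 1#) ^ n * pochhammer β n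
  pochhammer-reflect zero    β = sym (*-identityˡ _)
  pochhammer-reflect (suc n) β = begin
    pochhammer (1# - (β + ↑ suc n)) (suc n)
      ≈⟨ pochhammer-first (1# - (β + ↑ suc n)) n ⟩
    (1# - (β + ↑ suc n)) * pochhammer (1# - (β + ↑ suc n) + 1#) n
      ≈⟨ *-congˡ (trans (pochhammer-cong n (solve 2 (λ b m → κ 1 :- (b :+ (κ 1 :+ m)) :+ κ 1
          := κ 1 :- (b :+ m)) refl β (↑ n))) (pochhammer-reflect n β)) ⟩
    (1# - (β + ↑ suc n)) * ((- 1#) ^ n * pochhammer β n)
      ≈⟨ solve 4 (λ b m s p → (κ 1 :- (b :+ (κ 1 :+ m))) :* (s :* p) := (:- κ 1) :* s :* (p :* (b :+ m)))
          refl β (↑ n) ((- 1#) ^ n) (pochhammer β n) ⟩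
    - 1# * (- 1#) ^ n * (pochhammer β n * (β + ↑ n))
      ≈⟨ *-congˡ (∏-last n (λ k → β + ↑ k)) ⟨
    (- 1#) ^ suc n * pochhammer β (suc n) ∎

  -1^-square : ∀ n → (- 1#) ^ n * (- 1#) ^ n ≈ 1#
  -1^-square zero    = *-identityˡ 1#
  -1^-square (suc n) = trans (solve 1 (λ s → (:- κ 1) :* s :* ((:- κ 1) :* s) := s :* s)
      refl ((- 1#) ^ n)) (-1^-square n)

  sign-square : ∀ n → sign n * sign n ≈ 1#
  sign-square zero    = *-identityˡ 1#
  sign-square (suc n) = begin
    (- 1#) ^ n * sign n * ((- 1#) ^ n * sign n)
      ≈⟨ solve 2 (λ e s → e :* s :* (e :* s) := e :* e :* (s :* s)) refl ((- 1#) ^ n) (sign n) ⟩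
    (- 1#) ^ n * (- 1#) ^ n * (sign n * sign n)    ≈⟨ *-cong (-1^-square n) (sign-square n) ⟩
    1# * 1#                                        ≈⟨ *-identityˡ 1# ⟩
    1#                                             ∎

  -- The double factorial 1 · 3 ⋯ (2n - 1).
  oddProduct : ℕ → Carrier
  oddProduct n = ∏ n (λ j → ↑ suc (2 ℕ.* j))

  reflected : ℕ → Carrier → Carrier
  reflected n α = 1# - α + ↑ (n ℕ.+ n) * - (1# + 1#)

  evenDet-step : ∀ n α → oddProduct n * evenDet (suc n) α * sign n
      ≈ pochhammer (α + (1# + 1#)) n * evenDet n (reflected n (α + (1# + 1#)))
  evenDet-step n α = begin
    oddProduct n * evenDet (suc n) α * sign n          ≈⟨ *-congʳ (*-congˡ (evenDet-suc n α)) ⟩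
    oddProduct n * oddDet n (α + (1# + 1#)) * sign n   ≈⟨ *-congʳ (oddDet-derived n (α + (1# + 1#))) ⟩
    pochhammer (α + (1# + 1#)) n * derivedDet n (α + (1# + 1#)) * sign n   ≈⟨ *-assoc _ _ _ ⟩
    pochhammer (α + (1# + 1#)) n * (derivedDet n (α + (1# + 1#)) * sign n)
      ≈⟨ *-congˡ (derivedDet-dual n (α + (1# + 1#))) ⟩
    pochhammer (α + (1# + 1#)) n * evenDet n (reflected n (α + (1# + 1#))) ∎

  -- The two reflections compose to α ↦ α + 4. The second Pochhammer symbol appears at a reflected
  -- argument, and the sign (-1)ⁿ from turning it round cancels `sign (suc n) * sign n`.
  evenDet-two-steps : ∀ n α → oddProduct (suc n) * oddProduct n * evenDet (suc (suc n)) α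
                            ≈ pochhammer (α + ↑ 2) (suc n) * pochhammer (α + ↑ (3 ℕ.* n ℕ.+ 4)) n
                                * evenDet n (α + ↑ 4)
  evenDet-two-steps n α = begin
    o′ * o * e″
      ≈⟨ solve 3 (λ p q e → p :* q :* e := κ 1 :* (κ 1 :* (q :* (p :* e)))) refl o′ o e″ ⟩
    1# * (1# * (o * (o′ * e″)))
      -- Of the inserted signs `ε * s` serves the first step and `s` the second; the last `ε` meets
      -- the sign of the reflected Pochhammer symbol.
      ≈⟨ *-cong (-1^-square n) (*-congʳ (sign-square n)) ⟨
    ε * ε * (s * s * (o * (o′ * e″)))
      ≈⟨ solve 4 (λ ε s o y → ε :* ε :* (s :* s :* (o :* y)) := ε :* s :* o :* (y :* (ε :* s)))
          refl ε s o (o′ * e″) ⟩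
    ε * s * o * (o′ * e″ * (ε * s))
      ≈⟨ *-congˡ (evenDet-step (suc n) α) ⟩
    ε * s * o * (P * e′)
      ≈⟨ solve 5 (λ ε s o p e → ε :* s :* o :* (p :* e) := ε :* p :* (o :* e :* s)) refl ε s o P e′ ⟩
    ε * P * (o * e′ * s)
      ≈⟨ *-congˡ (evenDet-step n β) ⟩
    ε * P * (pochhammer (β + (1# + 1#)) n * evenDet n (reflected n (β + (1# + 1#))))
      ≈⟨ *-congˡ (*-cong (trans (pochhammer-cong n second) (pochhammer-reflect n (α + ↑ (3 ℕ.* n ℕ.+ 4))))
          (evenDet-cong n third)) ⟩
    ε * P * (ε * pochhammer (α + ↑ (3 ℕ.* n ℕ.+ 4)) n * evenDet n (α + ↑ 4))
      ≈⟨ solve 4 (λ ε p q e → ε :* p :* (ε :* q :* e) := ε :* ε :* (p :* q :* e))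
          refl ε P (pochhammer (α + ↑ (3 ℕ.* n ℕ.+ 4)) n) (evenDet n (α + ↑ 4)) ⟩
    ε * ε * (P * pochhammer (α + ↑ (3 ℕ.* n ℕ.+ 4)) n * evenDet n (α + ↑ 4))
      ≈⟨ trans (*-congʳ (-1^-square n)) (*-identityˡ _) ⟩
    P * pochhammer (α + ↑ (3 ℕ.* n ℕ.+ 4)) n * evenDet n (α + ↑ 4)
      ≈⟨ *-congʳ (*-congʳ (pochhammer-cong (suc n) (+-congˡ (+-congˡ (sym (+-identityʳ 1#)))))) ⟩
    pochhammer (α + ↑ 2) (suc n) * pochhammer (α + ↑ (3 ℕ.* n ℕ.+ 4)) n * evenDet n (α + ↑ 4) ∎
    where
    β o o′ s ε e′ e″ P : Carrier
    β  = reflected (suc n) (α + (1# + 1#))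
    o  = oddProduct n
    o′ = oddProduct (suc n)
    s  = sign n
    ε  = (- 1#) ^ n
    e′ = evenDet (suc n) β
    e″ = evenDet (suc (suc n)) α
    P  = pochhammer (α + (1# + 1#)) (suc n)
    ↑2n : ↑ (n ℕ.+ n) ≈ ↑ n + ↑ n
    ↑2n = ↑-+ n n
    ↑2n+2 : ↑ (suc n ℕ.+ suc n) ≈ 1# + ↑ n + (1# + ↑ n)
    ↑2n+2 = ↑-+ (suc n) (suc n)
    second : β + (1# + 1#) ≈ 1# - (α + ↑ (3 ℕ.* n ℕ.+ 4) + ↑ n)
    second = begin
      1# - (α + (1# + 1#)) + ↑ (suc n ℕ.+ suc n) * - (1# + 1#) + (1# + 1#)
        ≈⟨ +-congʳ (+-congˡ (*-congʳ ↑2n+2)) ⟩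
      1# - (α + (1# + 1#)) + (1# + ↑ n + (1# + ↑ n)) * - (1# + 1#) + (1# + 1#)
        ≈⟨ solve 2 (λ a n → κ 1 :- (a :+ (κ 1 :+ κ 1)) :+ (κ 1 :+ n :+ (κ 1 :+ n)) :* (:- (κ 1 :+ κ 1))
            :+ (κ 1 :+ κ 1)
                         := κ 1 :- (a :+ (κ 3 :* n :+ κ 4) :+ n)) refl α (↑ n) ⟩
      1# - (α + (↑ 3 * ↑ n + ↑ 4) + ↑ n)
        ≈⟨ +-congˡ (-‿cong (+-congʳ (+-congˡ (trans (↑-+ (3 ℕ.* n) 4) (+-congʳ (↑-* 3 n)))))) ⟨
      1# - (α + ↑ (3 ℕ.* n ℕ.+ 4) + ↑ n) ∎
    third : reflected n (β + (1# + 1#)) ≈ α + ↑ 4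
    third = begin
      1# - (1# - (α + (1# + 1#)) + ↑ (suc n ℕ.+ suc n) * - (1# + 1#) + (1# + 1#)) + ↑ (n ℕ.+ n)
          * - (1# + 1#)
        ≈⟨ +-cong (+-congˡ (-‿cong (+-congʳ (+-congˡ (*-congʳ ↑2n+2))))) (*-congʳ ↑2n) ⟩
      1# - (1# - (α + (1# + 1#)) + (1# + ↑ n + (1# + ↑ n)) * - (1# + 1#) + (1# + 1#)) + (↑ n + ↑ n)
          * - (1# + 1#)
        ≈⟨ solve 2 (λ a n → κ 1 :- (κ 1 :- (a :+ (κ 1 :+ κ 1)) :+ (κ 1 :+ n :+ (κ 1 :+ n))
            :* (:- (κ 1 :+ κ 1)) :+ (κ 1 :+ κ 1)) :+ (n :+ n) :* (:- (κ 1 :+ κ 1))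
                         := a :+ κ 4) refl α (↑ n) ⟩
      α + ↑ 4 ∎

  oddProduct-nonzero : ∀ n → ¬ (oddProduct n ≈ 0#)
  oddProduct-nonzero n = ∏-nonzero n λ j → char0 (2 ℕ.* j)

  oddProduct-factorial : ∀ n → (↑ 2) ^ n * ↑ (n !) * oddProduct n ≈ ↑ ((2 ℕ.* n) !)
  oddProduct-factorial zero    = solve 0 (κ 1 :* (κ 1 :+ κ 0) :* κ 1 := κ 1 :+ κ 0) refl
  oddProduct-factorial (suc n) = begin
    ↑ 2 * (↑ 2) ^ n * ↑ (suc n ℕ.* n !) * oddProduct (suc n)
      ≈⟨ *-cong (*-congˡ (↑-* (suc n) (n !))) (∏-last n (λ j → ↑ suc (2 ℕ.* j))) ⟩
    ↑ 2 * (↑ 2) ^ n * (↑ suc n * ↑ (n !)) * (oddProduct n * ↑ suc (2 ℕ.* n))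
      ≈⟨ solve 6 (λ t p m f o q → t :* p :* (m :* f) :* (o :* q) := t :* m :* (q :* (p :* f :* o)))
          refl (↑ 2) ((↑ 2) ^ n) (↑ suc n) (↑ (n !)) (oddProduct n) (↑ suc (2 ℕ.* n)) ⟩
    ↑ 2 * ↑ suc n * (↑ suc (2 ℕ.* n) * ((↑ 2) ^ n * ↑ (n !) * oddProduct n))
      ≈⟨ *-cong (sym (↑-* 2 (suc n))) (*-congˡ (oddProduct-factorial n)) ⟩
    ↑ (2 ℕ.* suc n) * (↑ suc (2 ℕ.* n) * ↑ ((2 ℕ.* n) !))
      ≡⟨ ≡.cong (λ m → ↑ m * (↑ suc (2 ℕ.* n) * ↑ ((2 ℕ.* n) !))) (ℕ.*-suc 2 n) ⟩
    ↑ suc (suc (2 ℕ.* n)) * (↑ suc (2 ℕ.* n) * ↑ ((2 ℕ.* n) !))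
      ≈⟨ trans (↑-* (suc (suc (2 ℕ.* n))) (suc (2 ℕ.* n) ℕ.* (2 ℕ.* n) !))
          (*-congˡ (↑-* (suc (2 ℕ.* n)) ((2 ℕ.* n) !))) ⟨
    ↑ (suc (suc (2 ℕ.* n)) !)
      ≡⟨ ≡.cong (λ m → ↑ (m !)) (ℕ.*-suc 2 n) ⟨
    ↑ ((2 ℕ.* suc n) !) ∎

  prefactor : ℕ → Carrier
  prefactor n = (↑ 2) ^ (n C 2) * ∏ n (λ i → ↑ (i !) / ↑ ((2 ℕ.* i) !))

  -- From n to n + 1 the prefactor gains 2ⁿ n! / (2n)!, the inverse of the double factorial by which
  -- one recursion step divides.
  prefactor-suc : ∀ n → oddProduct n * prefactor (suc n) ≈ prefactor n
  prefactor-suc n = begin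
    o * ((↑ 2) ^ (suc n C 2) * ∏ (suc n) f)
      ≈⟨ *-congˡ (*-cong power (∏-last n f)) ⟩
    o * ((↑ 2) ^ n * (↑ 2) ^ (n C 2) * (∏ n f * (↑ (n !) * d ⁻¹)))
      ≈⟨ solve 6 (λ o p q g m i → o :* (p :* q :* (g :* (m :* i))) := p :* m :* o :* i :* (q :* g))
          refl o ((↑ 2) ^ n) ((↑ 2) ^ (n C 2)) (∏ n f) (↑ (n !)) (d ⁻¹) ⟩
    (↑ 2) ^ n * ↑ (n !) * o * d ⁻¹ * prefactor n
      ≈⟨ *-congʳ (trans (*-congʳ (oddProduct-factorial n))
          (inverseʳ (↑-nonzero ((2 ℕ.* n) !) {{ℕ._!≢0 (2 ℕ.* n)}}))) ⟩
    1# * prefactor n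
      ≈⟨ *-identityˡ _ ⟩
    prefactor n ∎
    where
    o d : Carrier
    o = oddProduct n
    d = ↑ ((2 ℕ.* n) !)
    f : ℕ → Carrier
    f i = ↑ (i !) / ↑ ((2 ℕ.* i) !)
    power : (↑ 2) ^ (suc n C 2) ≈ (↑ 2) ^ n * (↑ 2) ^ (n C 2)
    power = begin
      (↑ 2) ^ (suc n C 2)
        ≡⟨ ≡.cong ((↑ 2) ^_) (≡.trans (≡.sym (nCk+nC[k+1]≡[n+1]C[k+1] n 1))
            (≡.cong (ℕ._+ n C 2) (nC1≡n n))) ⟩
      (↑ 2) ^ (n ℕ.+ n C 2)           ≈⟨ ^-homo-* (↑ 2) n (n C 2) ⟩
      (↑ 2) ^ n * (↑ 2) ^ (n C 2)     ∎

  -- Enough to keep the denominators of the Gamma product away from zero, and stable under x ↦ x +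
  -- 4, as the induction on n demands.
  Generic : Carrier → Set ℓ
  Generic x = ∀ m → ¬ (x + ↑ m ≈ 0#)

  generic-+4 : ∀ {x} → Generic x → Generic (x + ↑ 4)
  generic-+4 {x} gen m x+4+m≈0 = gen (4 ℕ.+ m)
      (trans (+-congˡ (↑-+ 4 m)) (trans (sym (+-assoc x (↑ 4) (↑ m))) x+4+m≈0))

  -- As n drops by 2, two initial values are needed. The multiplier in `step` is that of the
  -- two-step recursion at α = x + 1. For n ≥ 1 the common solution is half of `D₃ n x`; its value 1
  -- at n = 0 keeps the step valid there.
  record Recursive (F : ℕ → Carrier → Carrier) : Set (c ⊔ ℓ) where
    field
      at-0 : ∀ x → F 0 x ≈ 1#
      at-1 : ∀ x → Generic x → F 1 x ≈ 1#
      step : ∀ n x → Generic x → oddProduct (suc n) * oddProduct n * F (suc (suc n)) x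
                               ≈ pochhammer (x + ↑ 3) (suc n) * pochhammer (x + ↑ (3 ℕ.* n ℕ.+ 5)) n
                                   * F n (x + ↑ 4)

  open Recursive

  recursive-unique : ∀ {F G} → Recursive F → Recursive G → ∀ n x → Generic x → F n x ≈ G n x
  recursive-unique f g zero          x _   = trans (at-0 f x) (sym (at-0 g x))
  recursive-unique f g (suc zero)    x gen = trans (at-1 f x gen) (sym (at-1 g x gen))
  recursive-unique f g (suc (suc n)) x gen =
      *-cancelˡ (*-nonzero (oddProduct-nonzero (suc n)) (oddProduct-nonzero n))
    (trans (step f n x gen) (trans (*-congˡ (recursive-unique f g n (x + ↑ 4) (generic-+4 gen)))
        (sym (step g n x gen))))

  evenDet-recursive : Recursive (λ n x → evenDet n (x + 1#))
  evenDet-recursive = record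
    { at-0 = λ x → refl
    ; at-1 = λ x _ → evenDet-suc 0 (x + 1#)
    ; step = λ n x _ → trans (evenDet-two-steps n (x + 1#)) (*-cong (*-cong
        (pochhammer-cong (suc n) (solve 1 (λ x → x :+ κ 1 :+ κ 2 := x :+ κ 3) refl x))
        (pochhammer-cong n (begin
          x + 1# + ↑ (3 ℕ.* n ℕ.+ 4)        ≈⟨ +-congˡ (↑-+ (3 ℕ.* n) 4) ⟩
          x + 1# + (↑ (3 ℕ.* n) + ↑ 4)
            ≈⟨ solve 2 (λ x m → x :+ κ 1 :+ (m :+ κ 4) := x :+ (m :+ κ 5)) refl x (↑ (3 ℕ.* n)) ⟩
          x + (↑ (3 ℕ.* n) + ↑ 5)           ≈⟨ +-congˡ (↑-+ (3 ℕ.* n) 5) ⟨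
          x + ↑ (3 ℕ.* n ℕ.+ 5)             ∎)))
        (evenDet-cong n (solve 1 (λ x → x :+ κ 1 :+ κ 4 := x :+ κ 4 :+ κ 1) refl x)))
    }

  -- The product of Pochhammer symbols

  firstProduct secondProduct closedForm : ℕ → Carrier → Carrier
  -- The index i runs from 0 to ⌊(n - 1)/2⌋, where 2i + 1 ≤ n, so the truncated subtractions are
  -- exact; in the second product 2i + 2 ≤ n in the same way.
  firstProduct  n x = ∏ ⌊ n ℕ.+ 1 /2⌋ (λ i → pochhammer (x + ↑ (4 ℕ.* i) + ↑ 3) (n ∸ 2 ℕ.* i ∸ 1))
  secondProduct n x = ∏ ⌊ n /2⌋ (λ i → pochhammer (x - ↑ (2 ℕ.* i) + ↑ (3 ℕ.* n) - ↑ 1) (n ∸ 2 ℕ.* i ∸ 2))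
  closedForm    n x = prefactor n * firstProduct n x * secondProduct n x

  private
    monus : ∀ n i → suc (suc n) ∸ 2 ℕ.* suc i ≡ n ∸ 2 ℕ.* i
    monus n i = ≡.cong (suc (suc n) ∸_) (ℕ.*-suc 2 i)

  -- The factor i = 0 splits off, and the factor i + 1 at (n + 2, x) is the factor i at (n, x + 4):
  -- the argument gains 4 on either side, and the length depends only on n - 2i.
  firstProduct-step : ∀ n x → firstProduct (suc (suc n)) x
      ≈ pochhammer (x + ↑ 3) (suc n) * firstProduct n (x + ↑ 4)
  firstProduct-step n x = *-cong
    (pochhammer-cong (suc n) (+-congʳ (+-identityʳ x)))
    (∏-cong ⌊ n ℕ.+ 1 /2⌋ λ {i} _ → begin
      pochhammer (x + ↑ (4 ℕ.* suc i) + ↑ 3) (suc (suc n) ∸ 2 ℕ.* suc i ∸ 1)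
        ≡⟨ ≡.cong (λ m → pochhammer (x + ↑ (4 ℕ.* suc i) + ↑ 3) (m ∸ 1)) (monus n i) ⟩
      pochhammer (x + ↑ (4 ℕ.* suc i) + ↑ 3) (n ∸ 2 ℕ.* i ∸ 1)
        ≈⟨ pochhammer-cong (n ∸ 2 ℕ.* i ∸ 1) (+-congʳ
            (trans (+-congˡ (trans (reflexive (≡.cong ↑_ (ℕ.*-suc 4 i))) (↑-+ 4 (4 ℕ.* i))))
            (sym (+-assoc x (↑ 4) (↑ (4 ℕ.* i)))))) ⟩
      pochhammer (x + ↑ 4 + ↑ (4 ℕ.* i) + ↑ 3) (n ∸ 2 ℕ.* i ∸ 1) ∎)

  -- The same shift of i works here because -2(i + 1) + 3(n + 2) equals 4 - 2i + 3n.
  secondProduct-step : ∀ n x → secondProduct (suc (suc n)) x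
      ≈ pochhammer (x + ↑ (3 ℕ.* n ℕ.+ 5)) n * secondProduct n (x + ↑ 4)
  secondProduct-step n x = *-cong
    (pochhammer-cong n (begin
      x - ↑ 0 + ↑ (3 ℕ.* suc (suc n)) - ↑ 1    ≈⟨ +-congʳ (+-congˡ ↑3n+6) ⟩
      x - ↑ 0 + (↑ 6 + ↑ (3 ℕ.* n)) - ↑ 1
        ≈⟨ solve 2 (λ x m → x :- κ 0 :+ (κ 6 :+ m) :- (κ 1 :+ κ 0) := x :+ (m :+ κ 5))
            refl x (↑ (3 ℕ.* n)) ⟩
      x + (↑ (3 ℕ.* n) + ↑ 5)                  ≈⟨ +-congˡ (↑-+ (3 ℕ.* n) 5) ⟨
      x + ↑ (3 ℕ.* n ℕ.+ 5)                    ∎))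
    (∏-cong ⌊ n /2⌋ λ {i} _ → begin
      pochhammer (x - ↑ (2 ℕ.* suc i) + ↑ (3 ℕ.* suc (suc n)) - ↑ 1) (suc (suc n) ∸ 2 ℕ.* suc i ∸ 2)
        ≡⟨ ≡.cong (λ m → pochhammer (x - ↑ (2 ℕ.* suc i) + ↑ (3 ℕ.* suc (suc n)) - ↑ 1) (m ∸ 2))
            (monus n i) ⟩
      pochhammer (x - ↑ (2 ℕ.* suc i) + ↑ (3 ℕ.* suc (suc n)) - ↑ 1) (n ∸ 2 ℕ.* i ∸ 2)
        ≈⟨ pochhammer-cong (n ∸ 2 ℕ.* i ∸ 2) (begin
             x - ↑ (2 ℕ.* suc i) + ↑ (3 ℕ.* suc (suc n)) - ↑ 1
               ≈⟨ +-congʳ (+-cong (+-congˡ (-‿cong (trans (reflexive (≡.cong ↑_ (ℕ.*-suc 2 i)))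
                   (↑-+ 2 (2 ℕ.* i))))) ↑3n+6) ⟩
             x - (↑ 2 + ↑ (2 ℕ.* i)) + (↑ 6 + ↑ (3 ℕ.* n)) - ↑ 1
               ≈⟨ solve 4 (λ x a b u → x :- (κ 2 :+ a) :+ (κ 6 :+ b) :- u := x :+ κ 4 :- a :+ b :- u)
                   refl x (↑ (2 ℕ.* i)) (↑ (3 ℕ.* n)) (↑ 1) ⟩
             x + ↑ 4 - ↑ (2 ℕ.* i) + ↑ (3 ℕ.* n) - ↑ 1 ∎) ⟩
      pochhammer (x + ↑ 4 - ↑ (2 ℕ.* i) + ↑ (3 ℕ.* n) - ↑ 1) (n ∸ 2 ℕ.* i ∸ 2) ∎)
    where
    ↑3n+6 : ↑ (3 ℕ.* suc (suc n)) ≈ ↑ 6 + ↑ (3 ℕ.* n)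
    ↑3n+6 = trans (reflexive (≡.cong ↑_ (3[2+n] n))) (↑-+ 6 (3 ℕ.* n))
      where
      3[2+n] : ∀ n → 3 ℕ.* suc (suc n) ≡ 6 ℕ.+ 3 ℕ.* n
      3[2+n] = solve-∀

  closedForm-recursive : Recursive closedForm
  closedForm-recursive = record
    { at-0 = λ x → solve 0 (κ 1 :* κ 1 :* κ 1 :* κ 1 := κ 1) refl
    ; at-1 = λ x _ → trans
        (*-congʳ (*-congʳ (*-congˡ (trans (*-identityʳ _) (inverseʳ (char0 0))))))
        (solve 0 (κ 1 :* κ 1 :* (κ 1 :* κ 1) :* κ 1 := κ 1) refl)
    ; step = λ n x _ → begin
        oddProduct (suc n) * oddProduct n * (prefactor (suc (suc n)) * firstProduct (suc (suc n)) x
            * secondProduct (suc (suc n)) x)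
          ≈⟨ *-congˡ (*-cong (*-congˡ (firstProduct-step n x)) (secondProduct-step n x)) ⟩
        oddProduct (suc n) * oddProduct n * (prefactor (suc (suc n)) * (p n x * a n x) * (q n x * b n x))
          ≈⟨ solve 7 (λ o′ o r p a q b → o′ :* o :* (r :* (p :* a) :* (q :* b))
              := o :* (o′ :* r) :* (p :* q :* (a :* b))) refl
               (oddProduct (suc n)) (oddProduct n) (prefactor (suc (suc n))) (p n x) (a n x) (q n x)
                   (b n x) ⟩
        oddProduct n * (oddProduct (suc n) * prefactor (suc (suc n))) * (p n x * q n x * (a n x * b n x))
          ≈⟨ *-congʳ (trans (*-congˡ (prefactor-suc (suc n))) (prefactor-suc n)) ⟩
        prefactor n * (p n x * q n x * (a n x * b n x))
          ≈⟨ solve 5 (λ r p q a b → r :* (p :* q :* (a :* b)) := p :* q :* (r :* a :* b))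
              refl (prefactor n) (p n x) (q n x) (a n x) (b n x) ⟩
        p n x * q n x * closedForm n (x + ↑ 4) ∎
    }
    where
    p q a b : ℕ → Carrier → Carrier
    p n x = pochhammer (x + ↑ 3) (suc n)
    q n x = pochhammer (x + ↑ (3 ℕ.* n ℕ.+ 5)) n
    a n x = firstProduct n (x + ↑ 4)
    b n x = secondProduct n (x + ↑ 4)

  -- The product of Gamma quotients

  gammaFactor : ℕ → Carrier → Carrier
  gammaFactor k x = let i = suc k in
      (↑ 2) ^ (2 ℕ.* i ∸ 2)
    * (1# / pochhammer (↑ i) k)
    * (1# / pochhammer (↑ (2 ℕ.* i) + x) k)
    * pochhammer (↑ (3 ℕ.* i) + x - ↑ 2) k
    * pochhammer ((↑ i + x + ↑ 1) / ↑ 2) k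

  gammaProduct : ℕ → Carrier → Carrier
  gammaProduct n x = ∏ n (λ k → gammaFactor k x)

  doubledPochhammer : Carrier → ℕ → Carrier
  doubledPochhammer y n = ∏ n (λ k → y + ↑ (2 ℕ.* k))

  doubledPochhammer-cong : ∀ n {α β} → α ≈ β → doubledPochhammer α n ≈ doubledPochhammer β n
  doubledPochhammer-cong n h = ∏-cong n λ {k} _ → +-congʳ {x = ↑ (2 ℕ.* k)} h

  half-pochhammer : ∀ n y → (↑ 2) ^ n * pochhammer (y / ↑ 2) n ≈ doubledPochhammer y n
  half-pochhammer zero    y = *-identityˡ 1#
  half-pochhammer (suc n) y = begin
    (↑ 2) ^ suc n * pochhammer (y / ↑ 2) (suc n)
      ≈⟨ *-congˡ (∏-last n (λ k → y / ↑ 2 + ↑ k)) ⟩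
    ↑ 2 * (↑ 2) ^ n * (pochhammer (y / ↑ 2) n * (y / ↑ 2 + ↑ n))
      ≈⟨ solve 6 (λ t p q y i n → t :* p :* (q :* (y :* i :+ n)) := p :* q :* (y :* (t :* i) :+ t :* n))
          refl (↑ 2) ((↑ 2) ^ n) (pochhammer (y / ↑ 2) n) y ((↑ 2) ⁻¹) (↑ n) ⟩
    (↑ 2) ^ n * pochhammer (y / ↑ 2) n * (y * (↑ 2 * (↑ 2) ⁻¹) + ↑ 2 * ↑ n)
      ≈⟨ *-cong (half-pochhammer n y) (+-cong (trans (*-congˡ (inverseʳ (char0 1))) (*-identityʳ y))
          (sym (↑-* 2 n))) ⟩
    doubledPochhammer y n * (y + ↑ (2 ℕ.* n))
      ≈⟨ ∏-last n (λ k → y + ↑ (2 ℕ.* k)) ⟨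
    doubledPochhammer y (suc n) ∎

  factorial-pochhammer : ∀ m n → ↑ (m !) * pochhammer (↑ suc m) n ≈ ↑ ((n ℕ.+ m) !)
  factorial-pochhammer m zero    = *-identityʳ _
  factorial-pochhammer m (suc n) = begin
    ↑ (m !) * pochhammer (↑ suc m) (suc n)                    ≈⟨ *-congˡ (∏-last n (λ k → ↑ suc m + ↑ k)) ⟩
    ↑ (m !) * (pochhammer (↑ suc m) n * (↑ suc m + ↑ n))      ≈⟨ *-assoc _ _ _ ⟨
    ↑ (m !) * pochhammer (↑ suc m) n * (↑ suc m + ↑ n)
      ≈⟨ *-cong (factorial-pochhammer m n) (sym (↑-+ (suc m) n)) ⟩
    ↑ ((n ℕ.+ m) !) * ↑ (suc m ℕ.+ n)
      ≡⟨ ≡.cong (λ k → ↑ ((n ℕ.+ m) !) * ↑ suc k) (ℕ.+-comm m n) ⟩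
    ↑ ((n ℕ.+ m) !) * ↑ suc (n ℕ.+ m)                         ≈⟨ *-comm _ _ ⟩
    ↑ suc (n ℕ.+ m) * ↑ ((n ℕ.+ m) !)                         ≈⟨ ↑-* (suc (n ℕ.+ m)) ((n ℕ.+ m) !) ⟨
    ↑ ((suc n ℕ.+ m) !)                                       ∎

  -- Both sides are (2k)! / k!.
  pochhammer-oddProduct : ∀ k → pochhammer (↑ suc k) k ≈ (↑ 2) ^ k * oddProduct k
  pochhammer-oddProduct k = *-cancelˡ (↑-nonzero (k !) {{ℕ._!≢0 k}}) (begin
    ↑ (k !) * pochhammer (↑ suc k) k         ≈⟨ factorial-pochhammer k k ⟩
    ↑ ((k ℕ.+ k) !)                          ≡⟨ ≡.cong (λ m → ↑ ((k ℕ.+ m) !)) (ℕ.+-identityʳ k) ⟨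
    ↑ ((2 ℕ.* k) !)                          ≈⟨ oddProduct-factorial k ⟨
    (↑ 2) ^ k * ↑ (k !) * oddProduct k
      ≈⟨ solve 3 (λ p f o → p :* f :* o := f :* (p :* o)) refl ((↑ 2) ^ k) (↑ (k !)) (oddProduct k) ⟩
    ↑ (k !) * ((↑ 2) ^ k * oddProduct k)     ∎)

  2^-nonzero : ∀ n → ¬ ((↑ 2) ^ n ≈ 0#)
  2^-nonzero zero    = 1≉0
  2^-nonzero (suc n) = *-nonzero (char0 1) (2^-nonzero n)

  pochhammer-nonzero : ∀ {x} → Generic x → ∀ m n → ¬ (pochhammer (x + ↑ m) n ≈ 0#)
  pochhammer-nonzero {x} gen m n = ∏-nonzero n λ k h →
    gen (m ℕ.+ k) (trans (+-congˡ (↑-+ m k)) (trans (sym (+-assoc x (↑ m) (↑ k))) h))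

  -- The factor as a fraction without powers of 2: of its 2^(2k), one 2^k cancels against (k + 1)_k
  -- and the other clears the halves in the last Pochhammer symbol. Keeping numerator and
  -- denominator apart reduces the recursion to identities between products.
  gammaDenominator gammaNumerator : ℕ → Carrier → Carrier
  gammaDenominator k x = oddProduct k * pochhammer (x + ↑ (2 ℕ.* k ℕ.+ 2)) k
  gammaNumerator   k x = doubledPochhammer (x + ↑ (k ℕ.+ 2)) k * pochhammer (x + ↑ (3 ℕ.* k ℕ.+ 1)) k

  gammaDenominator-nonzero : ∀ {x} → Generic x → ∀ k → ¬ (gammaDenominator k x ≈ 0#)
  gammaDenominator-nonzero gen k = *-nonzero (oddProduct-nonzero k)
      (pochhammer-nonzero gen (2 ℕ.* k ℕ.+ 2) k)

  gammaFactor-fraction : ∀ k {x} → Generic x → gammaDenominator k x * gammaFactor k x ≈ gammaNumerator k x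
  gammaFactor-fraction k {x} gen = begin
    o * p₂ * ((↑ 2) ^ (2 ℕ.* suc k ∸ 2) * (1# / r₁) * (1# / r₂) * r₃ * r₄)
      ≈⟨ *-congˡ (*-cong (*-cong (*-congʳ (*-cong power (*-congˡ (⁻¹-cong (pochhammer-oddProduct k)))))
          (pochhammer-cong k third)) refl) ⟩
    o * p₂ * (t * t * (1# * (t * o) ⁻¹) * (1# * r₂ ⁻¹) * p₃ * r₄)
      ≈⟨ *-congˡ (*-congʳ (*-congʳ (*-congˡ (*-congˡ (⁻¹-cong (pochhammer-cong k second)))))) ⟩
    o * p₂ * (t * t * (1# * (t * o) ⁻¹) * (1# * p₂ ⁻¹) * p₃ * r₄)
      ≈⟨ solve 7 (λ o p t i j q r → o :* p :* (t :* t :* (κ 1 :* i) :* (κ 1 :* j) :* q :* r)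
          := t :* o :* i :* (p :* j) :* (t :* r :* q)) refl
           o p₂ t ((t * o) ⁻¹) (p₂ ⁻¹) p₃ r₄ ⟩
    t * o * (t * o) ⁻¹ * (p₂ * p₂ ⁻¹) * (t * r₄ * p₃)
      ≈⟨ *-congʳ (*-cong (inverseʳ (*-nonzero (2^-nonzero k) (oddProduct-nonzero k)))
          (inverseʳ (pochhammer-nonzero gen (2 ℕ.* k ℕ.+ 2) k))) ⟩
    1# * 1# * (t * r₄ * p₃)
      ≈⟨ trans (*-congʳ (*-identityˡ 1#)) (*-identityˡ _) ⟩
    t * r₄ * p₃
      ≈⟨ *-congʳ (trans (half-pochhammer k (↑ suc k + x + ↑ 1)) (doubledPochhammer-cong k fourth)) ⟩
    gammaNumerator k x ∎
    where
    t o r₁ r₂ r₃ r₄ p₂ p₃ : Carrier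
    t  = (↑ 2) ^ k
    o  = oddProduct k
    r₁ = pochhammer (↑ suc k) k
    r₂ = pochhammer (↑ (2 ℕ.* suc k) + x) k
    r₃ = pochhammer (↑ (3 ℕ.* suc k) + x - ↑ 2) k
    r₄ = pochhammer ((↑ suc k + x + ↑ 1) / ↑ 2) k
    p₂ = pochhammer (x + ↑ (2 ℕ.* k ℕ.+ 2)) k
    p₃ = pochhammer (x + ↑ (3 ℕ.* k ℕ.+ 1)) k
    power : (↑ 2) ^ (2 ℕ.* suc k ∸ 2) ≈ t * t
    power = begin
      (↑ 2) ^ (2 ℕ.* suc k ∸ 2)     ≡⟨ ≡.cong (λ m → (↑ 2) ^ (m ∸ 2)) (ℕ.*-suc 2 k) ⟩
      (↑ 2) ^ (k ℕ.+ (k ℕ.+ 0))     ≡⟨ ≡.cong (λ m → (↑ 2) ^ (k ℕ.+ m)) (ℕ.+-identityʳ k) ⟩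
      (↑ 2) ^ (k ℕ.+ k)             ≈⟨ ^-homo-* (↑ 2) k k ⟩
      t * t                         ∎
    second : ↑ (2 ℕ.* suc k) + x ≈ x + ↑ (2 ℕ.* k ℕ.+ 2)
    second = trans (+-comm _ x) (+-congˡ (reflexive (≡.cong ↑_ (eq k))))
      where
      eq : ∀ k → 2 ℕ.* suc k ≡ 2 ℕ.* k ℕ.+ 2
      eq = solve-∀
    third : ↑ (3 ℕ.* suc k) + x - ↑ 2 ≈ x + ↑ (3 ℕ.* k ℕ.+ 1)
    third = begin
      ↑ (3 ℕ.* suc k) + x - ↑ 2
        ≈⟨ +-congʳ (+-congʳ (trans (reflexive (≡.cong ↑_ (eq k))) (↑-+ (3 ℕ.* k ℕ.+ 1) 2))) ⟩
      ↑ (3 ℕ.* k ℕ.+ 1) + ↑ 2 + x - ↑ 2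
        ≈⟨ solve 3 (λ m t x → m :+ t :+ x :- t := x :+ m) refl (↑ (3 ℕ.* k ℕ.+ 1)) (↑ 2) x ⟩
      x + ↑ (3 ℕ.* k ℕ.+ 1)                   ∎
      where
      eq : ∀ k → 3 ℕ.* suc k ≡ 3 ℕ.* k ℕ.+ 1 ℕ.+ 2
      eq = solve-∀
    fourth : ↑ suc k + x + ↑ 1 ≈ x + ↑ (k ℕ.+ 2)
    fourth = begin
      1# + ↑ k + x + ↑ 1
        ≈⟨ solve 3 (λ k x z → κ 1 :+ k :+ x :+ (κ 1 :+ κ 0) := x :+ (k :+ κ 2)) refl (↑ k) x 0# ⟩
      x + (↑ k + ↑ 2)        ≈⟨ +-congˡ (↑-+ k 2) ⟨
      x + ↑ (k ℕ.+ 2)        ∎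

  private
    shifted : ∀ {m n} x → m ≡ 4 ℕ.+ n → x + ↑ m ≈ x + ↑ 4 + ↑ n
    shifted {n = n} x ≡.refl = trans (+-congˡ (↑-+ 4 n)) (sym (+-assoc x (↑ 4) (↑ n)))

    successor : ∀ {m n} x → m ≡ suc n → x + ↑ m ≈ x + ↑ n + 1#
    successor {n = n} x ≡.refl = trans (+-congˡ (+-comm 1# (↑ n))) (sym (+-assoc x (↑ n) 1#))

    further : ∀ {l} x m n → m ℕ.+ n ≡ l → x + ↑ m + ↑ n ≈ x + ↑ l
    further x m n ≡.refl = trans (+-assoc x (↑ m) (↑ n)) (+-congˡ (sym (↑-+ m n)))

  -- Both sides consist of the same linear factors. The outer factors a and b of the long
  -- `doubledPochhammer` extend the symbols starting at x + 3 and at x + 2n + 6, the latter followed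
  -- by e, the first factor of the symbol starting at x + 3n + 7. What lies between a and b,
  -- together with the symbol starting at x + 3n + 5, is the numerator at x + 4.
  gammaNumerator-step : ∀ n x → pochhammer (x + ↑ 3) (suc n) * pochhammer (x + ↑ (3 ℕ.* n ℕ.+ 5)) n
      * gammaNumerator (suc (suc n)) x * pochhammer (x + ↑ (2 ℕ.* n ℕ.+ 6)) n
    ≈ pochhammer (x + ↑ 3) (suc (suc n)) * pochhammer (x + ↑ (3 ℕ.* suc n ℕ.+ 5)) (suc n)
        * gammaNumerator n (x + ↑ 4) * pochhammer (x + ↑ (2 ℕ.* n ℕ.+ 6)) (suc (suc n))
  gammaNumerator-step n x = begin
    p₃ * p₅ * (doubledPochhammer (x + ↑ (suc (suc n) ℕ.+ 2)) (suc (suc n))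
        * pochhammer (x + ↑ (3 ℕ.* suc (suc n) ℕ.+ 1)) (suc (suc n))) * p₆
      ≈⟨ *-congʳ (*-congˡ (*-cong doubled (trans
          (pochhammer-first (x + ↑ (3 ℕ.* suc (suc n) ℕ.+ 1)) (suc n))
           (*-cong (+-congˡ (reflexive (≡.cong ↑_ (eq₇ n))))
               (pochhammer-cong (suc n) (sym (successor x (eq₈ n)))))))) ⟩
    p₃ * p₅ * (a * (d * b) * (e * p₈)) * p₆
      ≈⟨ solve 8 (λ p q a d b e r s → p :* q :* (a :* (d :* b) :* (e :* r)) :* s
          := p :* a :* r :* (d :* q) :* (s :* b :* e)) refl p₃ p₅ a d b e p₈ p₆ ⟩
    p₃ * a * p₈ * (d * p₅) * (p₆ * b * e)
      ≈⟨ *-cong (*-cong (*-congʳ (sym (trans (∏-last (suc n) (λ k → x + ↑ 3 + ↑ k))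
          (*-congˡ (further x 3 (suc n) (eq₃ n))))))
                        (*-congˡ (pochhammer-cong n (shifted x (eq₅ n)))))
                (sym (trans (∏-last (suc n) (λ k → x + ↑ (2 ℕ.* n ℕ.+ 6) + ↑ k)) (*-cong
                  (trans (∏-last n (λ k → x + ↑ (2 ℕ.* n ℕ.+ 6) + ↑ k))
                      (*-congˡ (further x (2 ℕ.* n ℕ.+ 6) n (eq₆ n))))
                  (further x (2 ℕ.* n ℕ.+ 6) (suc n) (eq₆′ n))))) ⟩
    pochhammer (x + ↑ 3) (suc (suc n)) * p₈ * gammaNumerator n (x + ↑ 4)
        * pochhammer (x + ↑ (2 ℕ.* n ℕ.+ 6)) (suc (suc n)) ∎
    where
    p₃ p₅ p₆ p₈ a b d e : Carrier
    p₃ = pochhammer (x + ↑ 3) (suc n)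
    p₅ = pochhammer (x + ↑ (3 ℕ.* n ℕ.+ 5)) n
    p₆ = pochhammer (x + ↑ (2 ℕ.* n ℕ.+ 6)) n
    p₈ = pochhammer (x + ↑ (3 ℕ.* suc n ℕ.+ 5)) (suc n)
    a  = x + ↑ (n ℕ.+ 4)
    b  = x + ↑ (3 ℕ.* n ℕ.+ 6)
    e  = x + ↑ (3 ℕ.* n ℕ.+ 7)
    d  = doubledPochhammer (x + ↑ 4 + ↑ (n ℕ.+ 2)) n
    eq₃ : ∀ n → 3 ℕ.+ suc n ≡ n ℕ.+ 4
    eq₃ = solve-∀
    eq₅ : ∀ n → 3 ℕ.* n ℕ.+ 5 ≡ 4 ℕ.+ (3 ℕ.* n ℕ.+ 1)
    eq₅ = solve-∀
    eq₆ : ∀ n → 2 ℕ.* n ℕ.+ 6 ℕ.+ n ≡ 3 ℕ.* n ℕ.+ 6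
    eq₆ = solve-∀
    eq₆′ : ∀ n → 2 ℕ.* n ℕ.+ 6 ℕ.+ suc n ≡ 3 ℕ.* n ℕ.+ 7
    eq₆′ = solve-∀
    eq₇ : ∀ n → 3 ℕ.* suc (suc n) ℕ.+ 1 ≡ 3 ℕ.* n ℕ.+ 7
    eq₇ = solve-∀
    eq₈ : ∀ n → 3 ℕ.* suc n ℕ.+ 5 ≡ suc (3 ℕ.* suc (suc n) ℕ.+ 1)
    eq₈ = solve-∀
    eq₄ : ∀ n → suc (suc n) ℕ.+ 2 ≡ n ℕ.+ 4
    eq₄ = solve-∀
    eq₂ : ∀ n i → suc (suc n) ℕ.+ 2 ℕ.+ 2 ℕ.* suc i ≡ 4 ℕ.+ (n ℕ.+ 2 ℕ.+ 2 ℕ.* i)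
    eq₂ = solve-∀
    eq₉ : ∀ n → n ℕ.+ 2 ℕ.+ 2 ℕ.* n ℕ.+ 4 ≡ 3 ℕ.* n ℕ.+ 6
    eq₉ = solve-∀
    doubled : doubledPochhammer (x + ↑ (suc (suc n) ℕ.+ 2)) (suc (suc n)) ≈ a * (d * b)
    doubled = begin
      (x + ↑ (suc (suc n) ℕ.+ 2) + 0#) * ∏ (suc n) (λ k → x + ↑ (suc (suc n) ℕ.+ 2) + ↑ (2 ℕ.* suc k))
        ≈⟨ *-cong (trans (+-identityʳ _) (+-congˡ (reflexive (≡.cong ↑_ (eq₄ n)))))
             (∏-cong (suc n) λ {k} _ → begin
               x + ↑ (suc (suc n) ℕ.+ 2) + ↑ (2 ℕ.* suc k)
                 ≈⟨ further x (suc (suc n) ℕ.+ 2) (2 ℕ.* suc k) (eq₂ n k) ⟩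
               x + ↑ (4 ℕ.+ (n ℕ.+ 2 ℕ.+ 2 ℕ.* k))
                 ≈⟨ shifted {n = n ℕ.+ 2 ℕ.+ 2 ℕ.* k} x ≡.refl ⟩
               x + ↑ 4 + ↑ (n ℕ.+ 2 ℕ.+ 2 ℕ.* k)
                 ≈⟨ further (x + ↑ 4) (n ℕ.+ 2) (2 ℕ.* k) ≡.refl ⟨
               x + ↑ 4 + ↑ (n ℕ.+ 2) + ↑ (2 ℕ.* k)             ∎) ⟩
      a * doubledPochhammer (x + ↑ 4 + ↑ (n ℕ.+ 2)) (suc n)
        ≈⟨ *-congˡ (∏-last n (λ k → x + ↑ 4 + ↑ (n ℕ.+ 2) + ↑ (2 ℕ.* k))) ⟩
      a * (d * (x + ↑ 4 + ↑ (n ℕ.+ 2) + ↑ (2 ℕ.* n)))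
        ≈⟨ *-congˡ (*-congˡ (begin
             x + ↑ 4 + ↑ (n ℕ.+ 2) + ↑ (2 ℕ.* n)       ≈⟨ further (x + ↑ 4) (n ℕ.+ 2) (2 ℕ.* n) ≡.refl ⟩
             x + ↑ 4 + ↑ (n ℕ.+ 2 ℕ.+ 2 ℕ.* n)
               ≈⟨ shifted x (≡.trans (≡.sym (eq₉ n)) (ℕ.+-comm (n ℕ.+ 2 ℕ.+ 2 ℕ.* n) 4)) ⟨
             x + ↑ (3 ℕ.* n ℕ.+ 6)                     ∎)) ⟩
      a * (d * b) ∎

  oddProduct-suc : ∀ n → oddProduct (suc n) ≈ oddProduct n * ↑ suc (2 ℕ.* n)
  oddProduct-suc n = ∏-last n (λ j → ↑ suc (2 ℕ.* j))

  -- This is the quotient of the recursions for n + 1 and for n: the product at x gains its factor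
  -- of index n + 2 and the product at x + 4 its factor of index n. It carries the induction in
  -- `gammaProduct-step`.
  gammaFactor-step : ∀ n {x} → Generic x →
    ↑ suc (2 ℕ.* suc n) * ↑ suc (2 ℕ.* n) * (pochhammer (x + ↑ 3) (suc n)
        * pochhammer (x + ↑ (3 ℕ.* n ℕ.+ 5)) n) * gammaFactor (suc (suc n)) x
    ≈ pochhammer (x + ↑ 3) (suc (suc n)) * pochhammer (x + ↑ (3 ℕ.* suc n ℕ.+ 5)) (suc n)
        * gammaFactor n (x + ↑ 4)
  gammaFactor-step n {x} gen = *-cancelˡ (*-nonzero (gammaDenominator-nonzero gen (suc (suc n)))
      (gammaDenominator-nonzero gen′ n)) (begin
    D * D′ * (u * v * P * q)
      ≈⟨ solve 6 (λ D D′ u v P q → D :* D′ :* (u :* v :* P :* q) := D :* q :* (D′ :* (u :* v :* P)))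
          refl D D′ u v P q ⟩
    D * q * (D′ * (u * v * P))
      ≈⟨ *-cong (gammaFactor-fraction (suc (suc n)) gen) (*-congʳ p₆′) ⟩
    N * (o * p₆ * (u * v * P))
      ≈⟨ solve 6 (λ N o p u v P → N :* (o :* p :* (u :* v :* P)) := o :* v :* u :* (P :* N :* p))
          refl N o p₆ u v P ⟩
    o * v * u * (P * N * p₆)
      ≈⟨ *-congˡ (gammaNumerator-step n x) ⟩
    o * v * u * (P′ * N′ * p₆₂)
      ≈⟨ *-congʳ (trans (oddProduct-suc (suc n)) (*-congʳ (oddProduct-suc n))) ⟨
    oddProduct (suc (suc n)) * (P′ * N′ * p₆₂)
      ≈⟨ *-congˡ (*-congʳ (*-congˡ (gammaFactor-fraction n gen′))) ⟨
    oddProduct (suc (suc n)) * (P′ * (D′ * q′) * p₆₂)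
      ≈⟨ solve 5 (λ o P D q p → o :* (P :* (D :* q) :* p) := o :* p :* D :* (P :* q))
          refl (oddProduct (suc (suc n))) P′ D′ q′ p₆₂ ⟩
    oddProduct (suc (suc n)) * p₆₂ * D′ * (P′ * q′)
      ≈⟨ *-congʳ (*-congʳ (*-congˡ (pochhammer-cong (suc (suc n))
          (+-congˡ (reflexive (≡.cong ↑_ (eq n))))))) ⟨
    D * D′ * (P′ * q′) ∎)
    where
    gen′ : Generic (x + ↑ 4)
    gen′ = generic-+4 gen
    u v P P′ D D′ N N′ q q′ o p₆ p₆₂ : Carrier
    u  = ↑ suc (2 ℕ.* suc n)
    v  = ↑ suc (2 ℕ.* n)
    P  = pochhammer (x + ↑ 3) (suc n) * pochhammer (x + ↑ (3 ℕ.* n ℕ.+ 5)) n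
    P′ = pochhammer (x + ↑ 3) (suc (suc n)) * pochhammer (x + ↑ (3 ℕ.* suc n ℕ.+ 5)) (suc n)
    D  = gammaDenominator (suc (suc n)) x
    D′ = gammaDenominator n (x + ↑ 4)
    N  = gammaNumerator (suc (suc n)) x
    N′ = gammaNumerator n (x + ↑ 4)
    q  = gammaFactor (suc (suc n)) x
    q′ = gammaFactor n (x + ↑ 4)
    o  = oddProduct n
    p₆ = pochhammer (x + ↑ (2 ℕ.* n ℕ.+ 6)) n
    p₆₂ = pochhammer (x + ↑ (2 ℕ.* n ℕ.+ 6)) (suc (suc n))
    eq : ∀ n → 2 ℕ.* suc (suc n) ℕ.+ 2 ≡ 2 ℕ.* n ℕ.+ 6
    eq = solve-∀
    eq′ : ∀ n → 2 ℕ.* n ℕ.+ 6 ≡ 4 ℕ.+ (2 ℕ.* n ℕ.+ 2)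
    eq′ = solve-∀
    p₆′ : D′ ≈ o * p₆
    p₆′ = *-congˡ (pochhammer-cong n (sym (shifted x (eq′ n))))

  gammaFactor-0 : ∀ {x} → Generic x → gammaFactor 0 x ≈ 1#
  gammaFactor-0 {x} gen = *-cancelˡ {1# * 1#} (*-nonzero 1≉0 1≉0)
      (trans (gammaFactor-fraction 0 gen) (sym (*-identityʳ _)))

  gammaFactor-1 : ∀ {x} → Generic x → gammaFactor 1 x ≈ x + ↑ 3
  gammaFactor-1 {x} gen = *-cancelˡ (gammaDenominator-nonzero gen 1) (trans (gammaFactor-fraction 1 gen)
    (solve 1 (λ x → (x :+ κ 3 :+ κ 0) :* κ 1 :* ((x :+ κ 4 :+ κ 0) :* κ 1)
        := (κ 1 :+ κ 0) :* κ 1 :* ((x :+ κ 4 :+ κ 0) :* κ 1) :* (x :+ κ 3)) refl x))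

  gammaProduct-step : ∀ n {x} → Generic x → oddProduct (suc n) * oddProduct n * gammaProduct (suc (suc n)) x
    ≈ pochhammer (x + ↑ 3) (suc n) * pochhammer (x + ↑ (3 ℕ.* n ℕ.+ 5)) n * gammaProduct n (x + ↑ 4)
  gammaProduct-step zero {x} gen = begin
    oddProduct 1 * oddProduct 0 * (gammaFactor 0 x * (gammaFactor 1 x * 1#))
      ≈⟨ *-congˡ (*-cong (gammaFactor-0 gen) (*-congʳ (gammaFactor-1 gen))) ⟩
    oddProduct 1 * oddProduct 0 * (1# * ((x + ↑ 3) * 1#))
      ≈⟨ solve 1 (λ x → (κ 1 :+ κ 0) :* κ 1 :* κ 1 :* (κ 1 :* ((x :+ κ 3) :* κ 1))
          := (x :+ κ 3 :+ κ 0) :* κ 1 :* κ 1 :* κ 1) refl x ⟩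
    pochhammer (x + ↑ 3) 1 * pochhammer (x + ↑ 5) 0 * gammaProduct 0 (x + ↑ 4) ∎
  gammaProduct-step (suc n) {x} gen = begin
    oddProduct (suc (suc n)) * oddProduct (suc n) * gammaProduct (suc (suc (suc n))) x
      ≈⟨ *-cong (*-cong (oddProduct-suc (suc n)) (oddProduct-suc n))
          (∏-last (suc (suc n)) (λ k → gammaFactor k x)) ⟩
    o′ * u * (o * v) * (H * q)
      ≈⟨ solve 6 (λ o′ u o v H q → o′ :* u :* (o :* v) :* (H :* q) := o′ :* o :* H :* (u :* v :* q))
          refl o′ u o v H q ⟩
    o′ * o * H * (u * v * q)
      ≈⟨ *-congʳ (gammaProduct-step n gen) ⟩
    P * H′ * (u * v * q)
      ≈⟨ solve 5 (λ P H u v q → P :* H :* (u :* v :* q) := u :* v :* P :* q :* H) refl P H′ u v q ⟩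
    u * v * P * q * H′
      ≈⟨ *-congʳ (gammaFactor-step n gen) ⟩
    P′ * q′ * H′
      ≈⟨ trans (*-assoc P′ q′ H′) (*-congˡ (*-comm q′ H′)) ⟩
    P′ * (H′ * q′)
      ≈⟨ *-congˡ (∏-last n (λ k → gammaFactor k (x + ↑ 4))) ⟨
    P′ * gammaProduct (suc n) (x + ↑ 4) ∎
    where
    o o′ u v H H′ q q′ P P′ : Carrier
    o  = oddProduct n
    o′ = oddProduct (suc n)
    u  = ↑ suc (2 ℕ.* suc n)
    v  = ↑ suc (2 ℕ.* n)
    H  = gammaProduct (suc (suc n)) x
    H′ = gammaProduct n (x + ↑ 4)
    q  = gammaFactor (suc (suc n)) x
    q′ = gammaFactor n (x + ↑ 4)
    P  = pochhammer (x + ↑ 3) (suc n) * pochhammer (x + ↑ (3 ℕ.* n ℕ.+ 5)) n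
    P′ = pochhammer (x + ↑ 3) (suc (suc n)) * pochhammer (x + ↑ (3 ℕ.* suc n ℕ.+ 5)) (suc n)

  gammaProduct-recursive : Recursive gammaProduct
  gammaProduct-recursive = record
    { at-0 = λ x → refl
    ; at-1 = λ x gen → trans (*-identityʳ _) (gammaFactor-0 gen)
    ; step = λ n x gen → gammaProduct-step n gen
    }

-- Specialisation to the indeterminate x

module Indeterminate {c ℓ} (K : Field c ℓ) (x : Field.Carrier K) (ind : FieldDefs.IsIndeterminate K x) where
  open FieldDefs K
  open IntegerSolver commutativeRing
  open SetoidReasoning setoid
  open Exp semiring using (^-homo-*)

  char0 : ∀ n → ¬ (↑ suc n ≈ 0#)
  char0 n h = ind (+ suc n ∷ []) (here λ ()) (trans (+-congˡ (zeroʳ x)) (trans (+-identityʳ _) h))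

  open ClosedForms K char0
  open Powers K char0 using (D₃-evenDet)

  generic : Generic x
  -- The polynomial m + t, which is nonzero by its leading coefficient also when m = 0.
  generic m h = ind (+ m ∷ + 1 ∷ []) (there (here λ ()))
    (trans (solve 2 (λ m x → m :+ x :* (κ 1 :+ κ 0 :+ x :* κ 0) := x :+ m) refl (↑ m) x) h)

  D₃-closedForm : ∀ m → D₃ (suc m) x ≈ ↑ 2 * closedForm (suc m) x
  D₃-closedForm m = trans (D₃-evenDet m x) (*-congˡ
      (recursive-unique evenDet-recursive closedForm-recursive (suc m) x generic))

  -- The constructors `up` and `down` in `shift₁` to `shift₄` make each `Γ-quotient` of the theorem
  -- reduce to the corresponding Pochhammer symbol in `gammaFactor`, so this is already the second
  -- formula.
  D₃-gammaProduct : ∀ m → D₃ (suc m) x ≈ ↑ 2 * gammaProduct (suc m) x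
  D₃-gammaProduct m = trans (D₃-evenDet m x)
      (*-congˡ (recursive-unique evenDet-recursive gammaProduct-recursive (suc m) x generic))

  closedForm-power : ∀ n → ↑ 2 * closedForm n x
    ≈ (↑ 2) ^ (n C 2 ℕ.+ 1) * ∏ n (λ i → ↑ (i !) / ↑ ((2 ℕ.* i) !)) * firstProduct n x * secondProduct n x
  closedForm-power n = begin
    ↑ 2 * (p * r * a * b)
      ≈⟨ solve 5 (λ t p r a b → t :* (p :* r :* a :* b) := p :* (t :* κ 1) :* r :* a :* b)
          refl (↑ 2) p r a b ⟩
    p * (↑ 2 * 1#) * r * a * b
      ≈⟨ *-congʳ (*-congʳ (*-congʳ (^-homo-* (↑ 2) (n C 2) 1))) ⟨
    (↑ 2) ^ (n C 2 ℕ.+ 1) * r * a * b ∎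
    where
    p r a b : Carrier
    p = (↑ 2) ^ (n C 2)
    r = ∏ n (λ i → ↑ (i !) / ↑ ((2 ℕ.* i) !))
    a = firstProduct n x
    b = secondProduct n x

theorem8 : ∀ {c ℓ : Level} (K : Field c ℓ) (x : Field.Carrier K)
    (ind : FieldDefs.IsIndeterminate K x) (n : ℕ) (n≥1 : 1 ℕ.≤ n) →
    let open FieldDefs K in
    (D₃ n x ≈
    (↑ 2) ^ (n C 2 ℕ.+ 1)
    * ∏ n (λ i → ↑ (i !) / ↑ ((2 ℕ.* i) !))
    * ∏ ⌊ n ℕ.+ 1 /2⌋ (λ i → pochhammer (x + ↑ (4 ℕ.* i) + ↑ 3) (n ∸ 2 ℕ.* i ∸ 1))
    * ∏ ⌊ n /2⌋ (λ i → pochhammer (x - ↑ (2 ℕ.* i) + ↑ (3 ℕ.* n) - ↑ 1) (n ∸ 2 ℕ.* i ∸ 2)))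
    ∧
    (D₃ n x ≈
    ↑ 2 * ∏ n (λ k → let i = suc k in
    (↑ 2) ^ (2 ℕ.* i ∸ 2)
    * Γ-quotient (↑ i) (↑ (2 ℕ.* i) - ↑ 1) (shift₁ k)
    * Γ-quotient (↑ (2 ℕ.* i) + x) (↑ (3 ℕ.* i) + x - ↑ 1) (shift₂ x k)
    * Γ-quotient (↑ (4 ℕ.* i) + x - ↑ 3) (↑ (3 ℕ.* i) + x - ↑ 2) (shift₃ x k)
    * Γ-quotient ((↑ (3 ℕ.* i) + x - ↑ 1) / ↑ 2) ((↑ i + x + ↑ 1) / ↑ 2) (shift₄ x ind k)))
theorem8 K x ind (suc m) n≥1 = Field.trans K (D₃-closedForm m)
    (closedForm-power (suc m)) , D₃-gammaProduct m
  where open Indeterminate K x ind
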